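{- Let $c_\lambda$ be the coefficient of $e_\lambda z^{|\lambda|}$ in $\mathcal{X}_{P_{v,w}}(z):=\sum_{n\ge 3}X_{P_{n,v,w}}z^{n+2}$, i.e. $\mathcal{X}_{P_{v,w}}(z)=\sum_\lambda c_\lambda e_\lambda z^{|\lambda|}$. Then: (a) for $k\ge 3$, $c_{(k+2)}=4(k+2)$, $c_{(k,2)}=4(k-2)$, and $c_{(k+1,1)}=4k$; (b) for $i\ge 3$, $c_{(i,i)}=4(i-1)i$, and for $i,j\ge 3$ with $i\ne j$, $c_{(i,j)}=4(j-1)i+4(i-1)j$; (c) $c_{(i,i,1)}=4(i-1)^2$ for $i\ge 3$, $c_{(i,j,1)}=8(i-1)(j-1)$ for $i,j\ge 3$ with $i\ne j$, and $c_{(i,j,1)}=0$ otherwise (i.e. whenever $\min(i,j)\le 2$); (d) if $c_{1\cup\mu}\ne 0$, then $1$ is not a part of $\mu$; (e) for all $k\ge 0$, $c_{(3^2,2^{k+1})}=32$ and $c_{(3^2,2^{k+1},1)}=16$.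
   Context: The chromatic symmetric function of a finite simple graph $H=(V,E)$ is $X_H=\sum_\kappa\prod_{u\in V}x_{\kappa(u)}$, the sum over all proper colorings $\kappa:V\to\mathbb{Z}_{>0}$. $P_n$ is the path on $n$ vertices. The twin of a graph at a vertex $v$ is obtained by adding a new vertex $v'$ joined to $v$ and to all neighbors of $v$. $P_{n,v,w}$ denotes $P_n$ twinned at its two leaves $v$ and $w$ in succession. $e_\lambda$ are the elementary symmetric functions indexed by partitions $\lambda$; the subscripts of $c$ denote partitions via their multiset of parts (order irrelevant), $a^m$ denotes $m$ parts equal to $a$, and $1\cup\mu$ is $\mu$ with an extra part $1$. -}

module Defs where

open import Level using (0ℓ)
open import Data.Bool using (if_then_else_)
open import Data.Empty using (⊥)
open import Data.Fin as Fin using (Fin; zero; suc; toℕ; fromℕ)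
open import Data.Fin.Properties as Fin using ()
open import Data.Integer as ℤ using (ℤ; +_; 0ℤ; 1ℤ)
open import Data.List using (List; []; _∷_; _++_; map; foldr; concatMap; filter; mapMaybe; length; lookup; upTo; allFin; cartesianProductWith)
open import Data.List.Relation.Binary.Permutation.Propositional using (_↭_)
open import Data.List.Relation.Unary.All using (All; all?)
open import Data.List.Relation.Unary.Linked using (Linked; linked?)
open import Data.Maybe using (Maybe; just; nothing)
open import Data.Nat as ℕ using (ℕ; zero; suc; _+_; _∸_; _≥_; NonZero)
open import Data.Nat.Properties as ℕ using (nonZero?)
open import Data.Nat.ListAction using (sum)
open import Data.Product using (_×_; _,_; proj₁; proj₂)
open import Data.Sum using (_⊎_; inj₁; inj₂; swap)
open import Data.Vec as Vec using (Vec)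
open import Relation.Binary using (Rel; Decidable; Symmetric)
open import Relation.Binary.PropositionalEquality using (_≡_; _≢_; sym)
open import Relation.Nullary using (¬_; Dec; yes; no; does)
open import Relation.Nullary.Decidable using (_×-dec_; _⊎-dec_; _→-dec_; ¬?)

record Graph (N : ℕ) : Set₁ where
  field
    Adj    : Rel (Fin N) 0ℓ
    adj?   : Decidable Adj
    symm   : Symmetric Adj
    irrefl : ∀ {u} → ¬ Adj u u

open Graph public

path : (n : ℕ) → Graph n
path n = record
  { Adj    = λ i j → toℕ j ≡ suc (toℕ i) ⊎ toℕ i ≡ suc (toℕ j)
  ; adj?   = λ i j → (toℕ j ℕ.≟ suc (toℕ i)) ⊎-dec (toℕ i ℕ.≟ suc (toℕ j))
  ; symm   = swap
  ; irrefl = λ { (inj₁ p) → ℕ.1+n≢n (sym p) ; (inj₂ p) → ℕ.1+n≢n (sym p) }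
  }

-- In the twin of G at v, the new vertex v′ is zero and an old vertex u
-- becomes suc u.
module _ {N : ℕ} (G : Graph N) (v : Fin N) where

  TwinAdj : Rel (Fin (suc N)) 0ℓ
  TwinAdj zero    zero    = ⊥
  TwinAdj zero    (suc u) = u ≡ v ⊎ Adj G v u
  TwinAdj (suc u) zero    = u ≡ v ⊎ Adj G v u
  TwinAdj (suc u) (suc w) = Adj G u w

  twinAdj? : Decidable TwinAdj
  twinAdj? zero    zero    = no λ ()
  twinAdj? zero    (suc u) = (u Fin.≟ v) ⊎-dec adj? G v u
  twinAdj? (suc u) zero    = (u Fin.≟ v) ⊎-dec adj? G v u
  twinAdj? (suc u) (suc w) = adj? G u w

  twinAdj-sym : Symmetric TwinAdj
  twinAdj-sym {zero}  {suc u} p = p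
  twinAdj-sym {suc u} {zero}  p = p
  twinAdj-sym {suc u} {suc w} p = symm G p

  twinAdj-irrefl : ∀ {u} → ¬ TwinAdj u u
  twinAdj-irrefl {suc u} p = irrefl G p

  twin : Graph (suc N)
  twin = record
    { Adj    = TwinAdj
    ; adj?   = twinAdj?
    ; symm   = λ {u} {w} → twinAdj-sym {u} {w}
    ; irrefl = λ {u} → twinAdj-irrefl {u}
    }

-- P_{n,v,w} for n = suc m: the leaves of the path are v = zero and
-- w = fromℕ m, and w is called suc w once the path is twinned at v.
twinnedPath : (m : ℕ) → Graph (2 + suc m)
twinnedPath m = twin (twin (path (suc m)) zero) (suc (fromℕ m))

-- α₁ ∷ … ∷ αₘ ∷ [] stands for x₁^α₁ ⋯ xₘ^αₘ; trailing zeros do not change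
-- the monomial, and all series below are insensitive to them.
Monomial : Set
Monomial = List ℕ

-- Formal power series over ℤ in x₁, x₂, x₃, …, given by their coefficients.
Series : Set
Series = Monomial → ℤ

sumℤ : List ℤ → ℤ
sumℤ = foldr ℤ._+_ 0ℤ

0ₛ : Series
0ₛ _ = 0ℤ

1ₛ : Series
1ₛ α = if does (all? (ℕ._≟ 0) α) then 1ℤ else 0ℤ

infixl 6 _+ₛ_
infixl 7 _*ₛ_ _·ₛ_

_+ₛ_ : Series → Series → Series
(f +ₛ g) α = f α ℤ.+ g α

_·ₛ_ : ℤ → Series → Series
(a ·ₛ f) α = a ℤ.* f α

-- All pairs (β , γ) of monomials with product α.
factorisations : Monomial → List (Monomial × Monomial)
factorisations []      = ([] , []) ∷ []
factorisations (a ∷ α) =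
  cartesianProductWith (λ i p → i ∷ proj₁ p , (a ∸ i) ∷ proj₂ p)
    (upTo (suc a)) (factorisations α)

_*ₛ_ : Series → Series → Series
(f *ₛ g) α = sumℤ (map (λ p → f (proj₁ p) ℤ.* g (proj₂ p)) (factorisations α))

∑ₛ : {A : Set} → List A → (A → Series) → Series
∑ₛ xs f = foldr _+ₛ_ 0ₛ (map f xs)

vectors : {A : Set} → List A → (N : ℕ) → List (Vec A N)
vectors xs zero    = Vec.[] ∷ []
vectors xs (suc N) = cartesianProductWith Vec._∷_ xs (vectors xs N)

module _ {N : ℕ} (G : Graph N) where

  Proper : {m : ℕ} → Vec (Fin m) N → Set
  Proper κ = ∀ u v → Adj G u v → Vec.lookup κ u ≢ Vec.lookup κ v

  proper? : {m : ℕ} (κ : Vec (Fin m) N) → Dec (Proper κ)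
  proper? κ = Fin.all? λ u → Fin.all? λ v →
    adj? G u v →-dec ¬? (Vec.lookup κ u Fin.≟ Vec.lookup κ v)

-- HasWeight α κ says that ∏ᵤ x_κ(u) = x^α.
HasWeight : {N : ℕ} (α : Monomial) → Vec (Fin (length α)) N → Set
HasWeight α κ = ∀ i → Vec.count (Fin._≟ i) κ ≡ lookup α i

hasWeight? : {N : ℕ} (α : Monomial) (κ : Vec (Fin (length α)) N) → Dec (HasWeight α κ)
hasWeight? α κ = Fin.all? λ i → Vec.count (Fin._≟ i) κ ℕ.≟ lookup α i

-- The coefficient of x^α in ∑_κ ∏ᵤ x_κ(u) is the number of proper
-- colourings of weight x^α; such a colouring uses only the colours of the
-- variables listed in α.
X : {N : ℕ} → Graph N → Series
X {N} G α = + length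
  (filter (λ κ → proper? G κ ×-dec hasWeight? α κ) (vectors (allFin (length α)) N))

record Partition : Set where
  constructor partition
  field
    parts      : List ℕ
    decreasing : Linked _≥_ parts
    positive   : All NonZero parts

open Partition public

asPartition : List ℕ → Maybe Partition
asPartition xs with linked? ℕ._≥?_ xs | all? nonZero? xs
... | yes d | yes p = just (partition xs d p)
... | _     | _     = nothing

incrementHead : List ℕ → List (List ℕ)
incrementHead []       = []
incrementHead (x ∷ xs) = (suc x ∷ xs) ∷ []

-- All lists of positive integers with sum n: a nonempty one either starts
-- with 1 or arises from one with sum n - 1 by incrementing its first entry.
compositions : ℕ → List (List ℕ)
compositions zero    = [] ∷ []
compositions (suc n) = map (1 ∷_) (compositions n) ++ concatMap incrementHead (compositions n)

partitionsOf : ℕ → List Partition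
partitionsOf n = mapMaybe asPartition (compositions n)

-- e k is the sum of all squarefree monomials of degree k.
e : ℕ → Series
e k α = if does (all? (ℕ._≤? 1) α ×-dec (sum α ℕ.≟ k)) then 1ℤ else 0ℤ

e[_] : Partition → Series
e[ μ ] = foldr _*ₛ_ 1ₛ (map e (parts μ))

-- ∑_{n ≥ 3} X_{P_{n,v,w}} z^{n+2}; a power series in z is given by its
-- coefficients, so 𝒳 N is the coefficient of z^N.
𝒳 : ℕ → Series
𝒳 (suc (suc (suc (suc (suc m))))) = X (twinnedPath (2 + m))
𝒳 _                               = 0ₛ

-- ∑_μ c_μ e_μ z^|μ|
eSeries : (Partition → ℤ) → ℕ → Series
eSeries c N = ∑ₛ (partitionsOf N) (λ μ → c μ ·ₛ e[ μ ])

IsECoefficientOf : (Partition → ℤ) → (ℕ → Series) → Set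
IsECoefficientOf c F = ∀ N α → F N α ≡ eSeries c N α

-- c_{(xs)} = a, where (xs) is the partition whose multiset of parts is xs.
_at_equals_ : (Partition → ℤ) → List ℕ → ℤ → Set
c at xs equals a = ∀ μ → parts μ ↭ xs → c μ ≡ a

-- ρ = 1 ∪ μ
_is1∪_ : Partition → Partition → Set
ρ is1∪ μ = parts ρ ↭ 1 ∷ parts μ

{-# OPTIONS --safe #-}

-- Deleting edges of the triangles at the two ends of the twinned path gives, with
-- Pₙ the chromatic symmetric function of the path on n vertices,
--   X(P_{n,v,w}) = 4 Pₙ₊₂ − 4 P₂ Pₙ + P₂² Pₙ₋₂   (n ≥ 3),   P₂ = 2 e₂.
-- Writing Aₙ(i) for the contribution to Pₙ₊₁ of the proper words that start with
-- the colour i, one has Aₙ(i) = xᵢ (Pₙ − Aₙ₋₁(i)), the same recursion that the terms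
-- xᵢ ∂eₖ/∂xᵢ satisfy with eₖ in place of Pₙ; comparing the two and summing over i yields
--   Pₙ₊₁ = eₙ₊₁ + ∑_{k+j=n} k eₖ₊₁ Pⱼ.
-- As the eₖ are algebraically independent, every c_λ can be read off from these
-- two formulas by recursion on λ.
module Submission where

open import Defs

open import Algebra using (CommutativeRing)
import Algebra.Properties.Group
import Algebra.Properties.Semiring.Sum
import Algebra.Solver.Ring.NaturalCoefficients.Default
open import Data.Bool using (Bool; true; false; if_then_else_; _∧_)
open import Data.Bool.Properties using (∧-zeroʳ)
open import Data.Fin as Fin using (Fin; zero; suc; fromℕ)
import Data.Fin.Properties as Fin
open import Data.Integer as ℤ using (ℤ; +_; 0ℤ; 1ℤ)
import Data.Integer.Properties as ℤ
import Data.Integer.Tactic.RingSolver as ℤ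
open import Data.List using (List; []; _∷_; _++_; map; foldr; length; lookup; filter; concatMap; mapMaybe; replicate; tabulate; allFin; upTo; applyUpTo; cartesianProductWith)
open import Data.List.Membership.Propositional using (_∈_; _∉_)
import Data.List.Properties as List
open import Data.List.Relation.Binary.Permutation.Propositional as Perm using (_↭_; prep; swap; ↭-refl; ↭-sym; ↭-trans)
import Data.List.Relation.Binary.Permutation.Propositional.Properties as Perm
open import Data.List.Relation.Unary.All as All using (All; []; _∷_; all?)
import Data.List.Relation.Unary.All.Properties as All
open import Data.List.Relation.Unary.Any using (here; there)
open import Data.List.Relation.Unary.Linked as Linked using (Linked; linked?)
import Data.List.Relation.Unary.Linked.Properties as Linked
open import Data.Maybe using (Maybe; just; nothing; maybe)
open import Data.Nat as ℕ using (ℕ; zero; suc; pred; _∸_; _⊓_; _≤_; _<_; _≥_; z≤n; s≤s; NonZero)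
open import Data.Nat.ListAction using (sum)
open import Data.Nat.ListAction.Properties using (sum-↭)
import Data.Nat.Properties as ℕ
open import Data.Product using (_×_; _,_; proj₁; proj₂; ∃-syntax)
open import Data.Sum using (_⊎_; inj₁; inj₂)
open import Data.Vec as Vec using (Vec; []; _∷_)
open import Function using (_∘_; id)
open import Level using (0ℓ)
open import Relation.Binary.PropositionalEquality using (_≡_; _≢_; refl; sym; trans; cong; cong₂; subst; ≢-sym; module ≡-Reasoning)
import Relation.Binary.Reasoning.Setoid
open import Relation.Nullary using (¬_; Dec; yes; no; does; contradiction)
open import Relation.Nullary.Decidable using (dec-true; dec-false; _×-dec_)

-- The word identities are proved over an arbitrary commutative ring with a finite weighted alphabet
-- and then used in ℤ[[x₁, ..., xₘ]] with the variables as weights. Degree N is treated in exactly m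
-- = N variables: a partition of N involves only e₁, ..., e_N, which are already independent in N
-- variables, so infinitely many variables never have to be handled at once. Likewise `X` at a
-- monomial α uses only `length α` colours.
--
-- As P₂ = 2 e₂, the right-hand side of the first formula equals 4 (Pₙ₊₂ - 2 e₂ Pₙ + e₂² Pₙ₋₂).
-- Multiplication by e₂ adds a part 2, so for |λ| ≥ 5 the number c_λ is four times a second
-- difference of path coefficients in the multiplicity of the part 2, negative multiplicities
-- counting as 0. Hence a partition without a part 2 simply gets four times its path coefficient,
-- and the values in (e) are constant because the path coefficients there are quadratic in the
-- number of parts 2.

module RingSums {c ℓ} (R : CommutativeRing c ℓ) where
  open CommutativeRing R hiding (zero) renaming (refl to ≈-refl; sym to ≈-sym; trans to ≈-trans)
  open Algebra.Properties.Semiring.Sum semiring renaming (sum to ∑)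
  open Algebra.Properties.Group +-group using () renaming (∙-cancelʳ to +-cancelʳ)
  open Algebra.Solver.Ring.NaturalCoefficients.Default commutativeSemiring
  open Relation.Binary.Reasoning.Setoid setoid

  -- Sums over antidiagonals.

  -- diag n φ = ∑_{i + j = n} φ i j
  diag : ℕ → (ℕ → ℕ → Carrier) → Carrier
  diag zero    φ = φ 0 0
  diag (suc n) φ = φ 0 (suc n) + diag n (λ i j → φ (suc i) j)

  diag-cong : ∀ n {φ ψ} → (∀ i j → φ i j ≈ ψ i j) → diag n φ ≈ diag n ψ
  diag-cong zero    h = h 0 0
  diag-cong (suc n) h = +-cong (h 0 (suc n)) (diag-cong n λ i j → h (suc i) j)

  diag-+ : ∀ n φ ψ → diag n (λ i j → φ i j + ψ i j) ≈ diag n φ + diag n ψ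
  diag-+ zero    φ ψ = ≈-refl
  diag-+ (suc n) φ ψ = ≈-trans (+-congˡ (diag-+ n _ _))
    (solve 4 (λ a b x y → (a :+ b) :+ (x :+ y) := (a :+ x) :+ (b :+ y)) ≈-refl _ _ _ _)

  diag-*ˡ : ∀ n x φ → x * diag n φ ≈ diag n (λ i j → x * φ i j)
  diag-*ˡ zero    x φ = ≈-refl
  diag-*ˡ (suc n) x φ = ≈-trans (distribˡ x _ _) (+-congˡ (diag-*ˡ n x _))

  diag-0 : ∀ n → diag n (λ _ _ → 0#) ≈ 0#
  diag-0 zero    = ≈-refl
  diag-0 (suc n) = ≈-trans (+-identityˡ _) (diag-0 n)

  diag-last : ∀ n φ → diag (suc n) φ ≈ diag n (λ i j → φ i (suc j)) + φ (suc n) 0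
  diag-last zero    φ = ≈-refl
  diag-last (suc n) φ = ≈-trans (+-congˡ (diag-last n λ i j → φ (suc i) j)) (≈-sym (+-assoc _ _ _))

  diag-swap : ∀ n φ → diag n φ ≈ diag n (λ i j → φ j i)
  diag-swap zero    φ = ≈-refl
  diag-swap (suc n) φ = ≈-trans (+-congˡ (diag-swap n _))
    (≈-trans (+-comm _ _) (≈-sym (diag-last n (λ i j → φ j i))))

  diag-assoc : ∀ n (φ : ℕ → ℕ → ℕ → Carrier) →
    diag n (λ i j → diag j (φ i)) ≈ diag n (λ k l → diag k (λ i j → φ i j l))
  diag-assoc zero    φ = ≈-refl
  diag-assoc (suc n) φ = begin
    (φ 0 0 (suc n) + diag n (λ i j → φ 0 (suc i) j)) + diag n (λ i j → diag j (φ (suc i)))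
      ≈⟨ +-assoc _ _ _ ⟩
    φ 0 0 (suc n) + (diag n (λ i j → φ 0 (suc i) j) + diag n (λ i j → diag j (φ (suc i))))
      ≈⟨ +-congˡ (+-congˡ (diag-assoc n (λ i → φ (suc i)))) ⟩
    φ 0 0 (suc n) + (diag n (λ i j → φ 0 (suc i) j) + diag n (λ k l → diag k (λ i j → φ (suc i) j l)))
      ≈⟨ +-congˡ (≈-sym (diag-+ n _ _)) ⟩
    φ 0 0 (suc n) + diag n (λ k l → φ 0 (suc k) l + diag k (λ i j → φ (suc i) j l)) ∎

  sum-diag : ∀ {m} n (φ : Fin m → ℕ → ℕ → Carrier) →
    ∑ (λ i → diag n (φ i)) ≈ diag n (λ j k → ∑ (λ i → φ i j k))
  sum-diag zero    φ = ≈-refl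
  sum-diag (suc n) φ = ≈-trans (∑-distrib-+ _ (λ i → diag n (λ j k → φ i (suc j) k)))
    (+-congˡ (sum-diag n (λ i j k → φ i (suc j) k)))

  -- Indicators of distinct colours.

  distinct : ∀ {m} → Fin m → Fin m → Carrier
  distinct i j with i Fin.≟ j
  ... | yes _ = 0#
  ... | no  _ = 1#

  distinct-sym : ∀ {m} (i j : Fin m) → distinct i j ≈ distinct j i
  distinct-sym i j with i Fin.≟ j | j Fin.≟ i
  ... | yes _    | yes _    = ≈-refl
  ... | no _     | no _     = ≈-refl
  ... | yes refl | no j≢i   = contradiction refl j≢i
  ... | no i≢j   | yes refl = contradiction refl i≢j

  distinct-suc : ∀ {m} (i j : Fin m) → distinct (suc i) (suc j) ≈ distinct i j
  distinct-suc i j with i Fin.≟ j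
  ... | yes _ = ≈-refl
  ... | no _  = ≈-refl

  -- Two of the three equalities j = k, w = j, w = k imply the third.
  distinct-triangle : ∀ {m} (w j k : Fin m) →
    distinct j k * (distinct w j * distinct w k) + distinct w k
      ≈ distinct w k * distinct j k + distinct w k * distinct w j
  distinct-triangle w j k with w Fin.≟ k | j Fin.≟ k | w Fin.≟ j
  ... | yes refl | yes refl | no w≢j = contradiction refl w≢j
  ... | yes refl | yes refl | yes _  =
    solve 0 (con 0 :* (con 0 :* con 0) :+ con 0 := con 0 :* con 0 :+ con 0 :* con 0) ≈-refl
  ... | yes refl | no _ | yes _ =
    solve 0 (con 1 :* (con 0 :* con 0) :+ con 0 := con 0 :* con 1 :+ con 0 :* con 0) ≈-refl
  ... | yes refl | no _ | no _ =
    solve 0 (con 1 :* (con 1 :* con 0) :+ con 0 := con 0 :* con 1 :+ con 0 :* con 1) ≈-refl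
  ... | no w≢k | yes refl | yes refl = contradiction refl w≢k
  ... | no _ | yes refl | no _ =
    solve 0 (con 0 :* (con 1 :* con 1) :+ con 1 := con 1 :* con 0 :+ con 1 :* con 1) ≈-refl
  ... | no _ | no _ | yes _ =
    solve 0 (con 1 :* (con 0 :* con 1) :+ con 1 := con 1 :* con 1 :+ con 1 :* con 0) ≈-refl
  ... | no _ | no _ | no _ =
    solve 0 (con 1 :* (con 1 :* con 1) :+ con 1 := con 1 :* con 1 :+ con 1 :* con 1) ≈-refl

  sum-distinct : ∀ {m} (i : Fin m) f → ∑ f ≈ f i + ∑ (λ j → distinct i j * f j)
  sum-distinct zero    f = +-congˡ (begin
    ∑ (λ j → f (suc j))                ≈⟨ sum-cong-≋ (λ j → ≈-sym (*-identityˡ (f (suc j)))) ⟩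
    ∑ (λ j → 1# * f (suc j))           ≈⟨ solve 2 (λ a s → s := con 0 :* a :+ s) ≈-refl (f zero) _ ⟩
    0# * f zero + ∑ (λ j → 1# * f (suc j)) ∎)
  sum-distinct (suc i) f = begin
    f zero + ∑ (λ j → f (suc j))
      ≈⟨ +-congˡ (sum-distinct i (λ j → f (suc j))) ⟩
    f zero + (f (suc i) + ∑ (λ j → distinct i j * f (suc j)))
      ≈⟨ solve 3 (λ a b s → a :+ (b :+ s) := b :+ (con 1 :* a :+ s)) ≈-refl _ _ _ ⟩
    f (suc i) + (1# * f zero + ∑ (λ j → distinct i j * f (suc j)))
      ≈⟨ +-congˡ (+-congˡ (sum-cong-≋ λ j → *-congʳ (≈-sym (distinct-suc i j)))) ⟩
    f (suc i) + (1# * f zero + ∑ (λ j → distinct (suc i) (suc j) * f (suc j))) ∎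

  -- Words with distinct neighbours, and triangles attached to them.

  -- Words in letters of weights x with distinct neighbours: walks n i is the
  -- weight of those with n letters that may follow the letter i, and paths n
  -- is the weight of all those with n letters.
  module Words {m : ℕ} (x : Fin m → Carrier) where

    total : (Fin m → Carrier) → Carrier
    total f = ∑ (λ i → x i * f i)

    step : (Fin m → Carrier) → Fin m → Carrier
    step f i = total (λ j → distinct i j * f j)

    walks : ℕ → Fin m → Carrier
    walks zero    _ = 1#
    walks (suc n) = step (walks n)

    paths : ℕ → Carrier
    paths zero    = 1#
    paths (suc n) = total (walks n)

    total-cong : ∀ {f g} → (∀ i → f i ≈ g i) → total f ≈ total g
    total-cong h = sum-cong-≋ λ i → *-congˡ (h i)

    total-*ˡ : ∀ a f → a * total f ≈ total (λ i → a * f i)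
    total-*ˡ a f = ≈-trans (*-distribˡ-sum a (λ i → x i * f i))
      (sum-cong-≋ λ i → solve 3 (λ a x f → a :* (x :* f) := x :* (a :* f)) ≈-refl a (x i) (f i))

    total-+ : ∀ f g → total (λ i → f i + g i) ≈ total f + total g
    total-+ f g = ≈-trans (sum-cong-≋ λ i → distribˡ (x i) (f i) (g i)) (∑-distrib-+ _ λ i → x i * g i)

    total-comm : ∀ (f : Fin m → Fin m → Carrier) →
      total (λ i → total (f i)) ≈ total (λ j → total (λ i → f i j))
    total-comm f = begin
      ∑ (λ i → x i * ∑ (λ j → x j * f i j))
        ≈⟨ sum-cong-≋ (λ i → *-distribˡ-sum (x i) λ j → x j * f i j) ⟩
      ∑ (λ i → ∑ (λ j → x i * (x j * f i j)))
        ≈⟨ ∑-comm (λ i j → x i * (x j * f i j)) ⟩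
      ∑ (λ j → ∑ (λ i → x i * (x j * f i j)))
        ≈⟨ sum-cong-≋ (λ j → ≈-sym (total-*ˡ (x j) λ i → f i j)) ⟩
      ∑ (λ j → x j * ∑ (λ i → x i * f i j)) ∎

    -- The forbidden letter j = i accounts for `x i * f i`. For f = `walks n` this is, up to the
    -- factor xᵢ, the recursion for Aₙ(i) = `x i * walks n i`, written without subtraction.
    step-+walk : ∀ f i → step f i + x i * f i ≈ total f
    step-+walk f i = begin
      ∑ (λ j → x j * (distinct i j * f j)) + x i * f i
        ≈⟨ +-congʳ (sum-cong-≋ λ j →
             solve 3 (λ x d f → x :* (d :* f) := d :* (x :* f)) ≈-refl (x j) (distinct i j) (f j)) ⟩
      ∑ (λ j → distinct i j * (x j * f j)) + x i * f i
        ≈⟨ +-comm _ _ ⟩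
      x i * f i + ∑ (λ j → distinct i j * (x j * f j))
        ≈⟨ ≈-sym (sum-distinct i λ j → x j * f j) ⟩
      ∑ (λ j → x j * f j) ∎

    -- Since `distinct` is symmetric, `step` is a symmetric operator for the form
    -- `total (λ i → f i * g i)`. This lets steps be moved from one end of a word to the other.
    step-selfadjoint : ∀ f g → total (λ i → step f i * g i) ≈ total (λ i → f i * step g i)
    step-selfadjoint f g = begin
      total (λ i → step f i * g i)
        ≈⟨ total-cong (λ i → ≈-trans (*-comm _ _) (total-*ˡ (g i) _)) ⟩
      total (λ i → total (λ j → g i * (distinct i j * f j)))
        ≈⟨ total-comm (λ i j → g i * (distinct i j * f j)) ⟩
      total (λ j → total (λ i → g i * (distinct i j * f j)))
        ≈⟨ total-cong (λ j → total-cong λ i → ≈-trans (*-congˡ (*-congʳ (distinct-sym i j)))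
             (solve 3 (λ g d f → g :* (d :* f) := f :* (d :* g)) ≈-refl (g i) (distinct j i) (f j))) ⟩
      total (λ j → total (λ i → f j * (distinct j i * g i)))
        ≈⟨ total-cong (λ j → ≈-sym (total-*ˡ (f j) _)) ⟩
      total (λ j → f j * step g j) ∎

    -- The following linear relations are stated without subtraction so that
    -- the semiring solver applies.
    total-linear : ∀ {f g h} a → (∀ i → f i + a * g i ≈ h i + h i) →
      total f + a * total g ≈ total h + total h
    total-linear {f} {g} {h} a eq = begin
      total f + a * total g              ≈⟨ +-congˡ (total-*ˡ a g) ⟩
      total f + total (λ i → a * g i)    ≈⟨ ≈-sym (total-+ f _) ⟩
      total (λ i → f i + a * g i)        ≈⟨ total-cong eq ⟩
      total (λ i → h i + h i)            ≈⟨ total-+ h h ⟩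
      total h + total h                  ∎

    step-linear : ∀ {f g h} a → (∀ i → f i + a * g i ≈ h i + h i) →
      ∀ i → step f i + a * step g i ≈ step h i + step h i
    step-linear {f} {g} {h} a eq i = total-linear a λ j → begin
      distinct i j * f j + a * (distinct i j * g j)
        ≈⟨ solve 4 (λ d f a g → d :* f :+ a :* (d :* g) := d :* (f :+ a :* g)) ≈-refl (distinct i j) (f j) a (g j) ⟩
      distinct i j * (f j + a * g j)
        ≈⟨ *-congˡ (eq j) ⟩
      distinct i j * (h j + h j)
        ≈⟨ distribˡ _ _ _ ⟩
      distinct i j * h j + distinct i j * h j ∎

    triangle : Fin m → Carrier
    triangle j = total (λ k → distinct j k * total (λ w → distinct w j * distinct w k))

    -- Sum `distinct-triangle` over k and w: on the left stands a triangle at j and an edge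
    -- disconnected from j, of weight `paths 2`; on the right stand the paths j, k, w and j, w, k,
    -- each of weight `walks 2 j`.
    triangle-walks : ∀ j → triangle j + paths 2 * 1# ≈ walks 2 j + walks 2 j
    triangle-walks j = begin
      triangle j + paths 2 * 1#
        ≈⟨ +-cong (total-cong λ k → total-*ˡ (distinct j k) _) (*-identityʳ _) ⟩
      total (λ k → total (λ w → distinct j k * (distinct w j * distinct w k)))
        + total (λ k → total (λ w → distinct k w * 1#))
        ≈⟨ ≈-sym (total-+ _ _) ⟩
      total (λ k → total (λ w → distinct j k * (distinct w j * distinct w k)) + total (λ w → distinct k w * 1#))
        ≈⟨ total-cong (λ k → ≈-sym (total-+ _ _)) ⟩
      total (λ k → total (λ w → distinct j k * (distinct w j * distinct w k) + distinct k w * 1#))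
        ≈⟨ total-cong (λ k → total-cong λ w →
             ≈-trans (+-congˡ (≈-trans (*-identityʳ _) (distinct-sym k w))) (distinct-triangle w j k)) ⟩
      total (λ k → total (λ w → distinct w k * distinct j k + distinct w k * distinct w j))
        ≈⟨ total-cong (λ k → total-+ _ _) ⟩
      total (λ k → total (λ w → distinct w k * distinct j k) + total (λ w → distinct w k * distinct w j))
        ≈⟨ total-+ _ _ ⟩
      total (λ k → total (λ w → distinct w k * distinct j k)) + total (λ k → total (λ w → distinct w k * distinct w j))
        ≈⟨ +-congˡ (total-comm (λ k w → distinct w k * distinct w j)) ⟩
      total (λ k → total (λ w → distinct w k * distinct j k)) + total (λ w → total (λ k → distinct w k * distinct w j))
        ≈⟨ +-cong
             (total-cong λ k → ≈-trans (total-cong λ w →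
               ≈-trans (*-congʳ (distinct-sym w k))
                 (solve 2 (λ a b → a :* b := b :* (a :* con 1)) ≈-refl (distinct k w) (distinct j k)))
               (≈-sym (total-*ˡ (distinct j k) _)))
             (total-cong λ w → ≈-trans (total-cong λ k →
               ≈-trans (*-congˡ (distinct-sym w j))
                 (solve 2 (λ a b → a :* b := b :* (a :* con 1)) ≈-refl (distinct w k) (distinct j w)))
               (≈-sym (total-*ˡ (distinct j w) _))) ⟩
      walks 2 j + walks 2 j ∎

    triangleWalks : ℕ → Fin m → Carrier
    triangleWalks zero    = triangle
    triangleWalks (suc n) = step (triangleWalks n)

    triangleWalks-walks : ∀ n j →
      triangleWalks n j + paths 2 * walks n j ≈ walks (2 ℕ.+ n) j + walks (2 ℕ.+ n) j
    triangleWalks-walks zero    = triangle-walks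
    triangleWalks-walks (suc n) = step-linear (paths 2) (triangleWalks-walks n)

    -- The relation `triangle-walks` with anything f attached at j. Self-adjointness, used twice,
    -- turns the two letters before j into two further steps applied to f.
    triangle-total : ∀ f →
      total (λ j → triangle j * f j) + paths 2 * total f ≈ total (step (step f)) + total (step (step f))
    triangle-total f = ≈-trans
      (total-linear {h = λ j → walks 2 j * f j} (paths 2) λ j → begin
        triangle j * f j + paths 2 * f j
          ≈⟨ solve 3 (λ t p f → t :* f :+ p :* f := (t :+ p :* con 1) :* f) ≈-refl (triangle j) (paths 2) (f j) ⟩
        (triangle j + paths 2 * 1#) * f j
          ≈⟨ *-congʳ (triangle-walks j) ⟩
        (walks 2 j + walks 2 j) * f j
          ≈⟨ distribʳ _ _ _ ⟩
        walks 2 j * f j + walks 2 j * f j ∎)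
      (+-cong walks₂ walks₂)
      where
      walks₂ : total (λ j → walks 2 j * f j) ≈ total (step (step f))
      walks₂ = begin
        total (λ j → step (step (λ _ → 1#)) j * f j)   ≈⟨ step-selfadjoint (walks 1) f ⟩
        total (λ j → step (λ _ → 1#) j * step f j)     ≈⟨ step-selfadjoint (walks 0) (step f) ⟩
        total (λ j → 1# * step (step f) j)             ≈⟨ total-cong (λ j → *-identityˡ _) ⟩
        total (step (step f))                          ∎

    -- Two consecutive colours are carried along because the twin of the last leaf must avoid both
    -- the leaf and its neighbour.
    twinnedTail : Fin m → ℕ → Fin m → Fin m → Carrier
    twinnedTail w zero    i j = distinct w i * distinct w j
    twinnedTail w (suc n) i j = total (λ k → distinct j k * twinnedTail w n j k)

    -- The letters w and v are the colours of the twins, i and j those of the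
    -- first two vertices of the path, and n further vertices follow them.
    twinnedPaths : ℕ → Carrier
    twinnedPaths n = total λ w → total λ v → total λ i → total λ j →
      (distinct v i * (distinct v j * distinct i j)) * twinnedTail w n i j

    -- Once a further vertex follows, the colour i no longer matters, so the right side depends on j
    -- alone; this is where a path with at least three vertices is needed. Summing over w innermost
    -- closes the triangle at the far end.
    total-twinnedTail : ∀ n i j → total (λ w → twinnedTail w (suc n) i j) ≈ triangleWalks n j
    total-twinnedTail zero i j = begin
      total (λ w → total (λ k → distinct j k * (distinct w j * distinct w k)))
        ≈⟨ total-comm (λ w k → distinct j k * (distinct w j * distinct w k)) ⟩
      total (λ k → total (λ w → distinct j k * (distinct w j * distinct w k)))
        ≈⟨ total-cong (λ k → ≈-sym (total-*ˡ (distinct j k) _)) ⟩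
      triangle j ∎
    total-twinnedTail (suc n) i j = begin
      total (λ w → total (λ k → distinct j k * twinnedTail w (suc n) j k))
        ≈⟨ total-comm (λ w k → distinct j k * twinnedTail w (suc n) j k) ⟩
      total (λ k → total (λ w → distinct j k * twinnedTail w (suc n) j k))
        ≈⟨ total-cong (λ k → ≈-sym (total-*ˡ (distinct j k) _)) ⟩
      total (λ k → distinct j k * total (λ w → twinnedTail w (suc n) j k))
        ≈⟨ total-cong (λ k → *-congˡ (total-twinnedTail n j k)) ⟩
      step (triangleWalks n) j ∎

    -- The interchanges of sums first bring w innermost, which turns the far end into
    -- `triangleWalks n j`, and then reorder the rest as j, i, v, so that v and i complete the
    -- triangle at the near end.
    twinnedPaths-triangle : ∀ n → twinnedPaths (suc n) ≈ total (λ j → triangle j * triangleWalks n j)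
    twinnedPaths-triangle n = begin
      twinnedPaths (suc n)
        ≈⟨ total-comm _ ⟩
      total (λ v → total λ w → total λ i → total λ j → K v i j * t w i j)
        ≈⟨ total-cong (λ v → total-comm _) ⟩
      total (λ v → total λ i → total λ w → total λ j → K v i j * t w i j)
        ≈⟨ total-cong (λ v → total-cong λ i → total-comm _) ⟩
      total (λ v → total λ i → total λ j → total λ w → K v i j * t w i j)
        ≈⟨ total-cong (λ v → total-cong λ i → total-cong λ j →
             ≈-trans (≈-sym (total-*ˡ (K v i j) _)) (*-congˡ (total-twinnedTail n i j))) ⟩
      total (λ v → total λ i → total λ j → K v i j * q j)
        ≈⟨ total-cong (λ v → total-comm _) ⟩
      total (λ v → total λ j → total λ i → K v i j * q j)
        ≈⟨ total-comm _ ⟩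
      total (λ j → total λ v → total λ i → K v i j * q j)
        ≈⟨ total-cong (λ j → total-comm _) ⟩
      total (λ j → total λ i → total λ v → K v i j * q j)
        ≈⟨ total-cong (λ j → total-cong λ i → total-cong λ v →
             ≈-trans (*-congʳ (*-congˡ (*-congˡ (distinct-sym i j))))
               (solve 4 (λ a b c q → (a :* (b :* c)) :* q := q :* (c :* (b :* a))) ≈-refl
                 (distinct v i) (distinct v j) (distinct j i) (q j))) ⟩
      total (λ j → total λ i → total λ v → q j * (distinct j i * (distinct v j * distinct v i)))
        ≈⟨ total-cong (λ j → ≈-trans
             (total-cong λ i → ≈-trans (≈-sym (total-*ˡ (q j) _)) (*-congˡ (≈-sym (total-*ˡ (distinct j i) _))))
             (≈-trans (≈-sym (total-*ˡ (q j) _)) (*-comm _ _))) ⟩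
      total (λ j → triangle j * q j) ∎
      where
      K : Fin m → Fin m → Fin m → Carrier
      K v i j = distinct v i * (distinct v j * distinct i j)
      t : Fin m → Fin m → Fin m → Carrier
      t w i j = twinnedTail w (suc n) i j
      q : Fin m → Carrier
      q = triangleWalks n

    -- Let h k be the weight of a path ending in one triangle, on k + 3 vertices. Opening the near
    -- triangle gives T + P h n = 2 h (n + 2), and opening the remaining one gives h k + P
    -- `paths (1 + k)` = 2 `paths (3 + k)`; eliminate h.
    twinnedPaths-paths : ∀ n →
      let p = paths (5 ℕ.+ n); q = paths 2 * paths (3 ℕ.+ n); r = paths 2 * (paths 2 * paths (1 ℕ.+ n)) in
      twinnedPaths (suc n) + (q + q + (q + q)) ≈ (p + p + (p + p)) + r
    twinnedPaths-paths n = begin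
      T + (P * p₃ + P * p₃ + (P * p₃ + P * p₃))
        ≈⟨ solve 3 (λ t p q → t :+ (p :* q :+ p :* q :+ (p :* q :+ p :* q))
             := t :+ p :* (q :+ q) :+ (p :* q :+ p :* q)) ≈-refl T P p₃ ⟩
      T + P * (p₃ + p₃) + (P * p₃ + P * p₃)
        ≈⟨ +-congʳ (+-cong (twinnedPaths-triangle n) (*-congˡ (≈-sym (H n)))) ⟩
      T′ + P * (h n + P * p₁) + (P * p₃ + P * p₃)
        ≈⟨ solve 5 (λ t p h q r → t :+ p :* (h :+ p :* q) :+ (p :* r :+ p :* r)
             := (t :+ p :* h) :+ (p :* r :+ p :* r) :+ p :* (p :* q)) ≈-refl T′ P (h n) p₁ p₃ ⟩
      (T′ + P * h n) + (P * p₃ + P * p₃) + P * (P * p₁)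
        ≈⟨ +-congʳ (+-congʳ (triangle-total (triangleWalks n))) ⟩
      (h (2 ℕ.+ n) + h (2 ℕ.+ n)) + (P * p₃ + P * p₃) + P * (P * p₁)
        ≈⟨ solve 3 (λ h a b → (h :+ h) :+ (a :+ a) :+ b := (h :+ a) :+ (h :+ a) :+ b) ≈-refl _ _ _ ⟩
      (h (2 ℕ.+ n) + P * p₃) + (h (2 ℕ.+ n) + P * p₃) + P * (P * p₁)
        ≈⟨ +-congʳ (+-cong (H (2 ℕ.+ n)) (H (2 ℕ.+ n))) ⟩
      (p₅ + p₅ + (p₅ + p₅)) + P * (P * p₁) ∎
      where
      T T′ P p₁ p₃ p₅ : Carrier
      T  = twinnedPaths (suc n)
      T′ = total (λ j → triangle j * triangleWalks n j)
      P  = paths 2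
      p₁ = paths (1 ℕ.+ n)
      p₃ = paths (3 ℕ.+ n)
      p₅ = paths (5 ℕ.+ n)
      h : ℕ → Carrier
      h k = total (triangleWalks k)
      H : ∀ k → h k + P * paths (suc k) ≈ paths (3 ℕ.+ k) + paths (3 ℕ.+ k)
      H k = total-linear P (triangleWalks-walks k)

    -- Here `y k i` stands for xᵢ ∂eₖ/∂xᵢ and `d k` for k eₖ₊₁. Splitting (k + 1) eₖ₊₁ into
    -- `d k + e (suc k)` avoids integer multiples in the abstract ring and isolates the part that
    -- cancels in `paths-suc`.
    module Recurrence (e d : ℕ → Carrier) (y : ℕ → Fin m → Carrier)
      (e₀ : e 0 ≈ 1#)
      (y₀ : ∀ i → y 0 i ≈ 0#)
      (y-suc : ∀ k i → y (suc k) i + x i * y k i ≈ x i * e k)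
      (sum-y : ∀ k → ∑ (y (suc k)) ≈ d k + e (suc k))
      where

      -- Both sides solve the recursion u + xᵢ u⁻ = xᵢ ∑ eₖ pathsⱼ, where u⁻ is the
      -- preceding term.
      elementary-walks : ∀ n i →
        diag n (λ k j → e k * (x i * walks j i)) ≈ diag n (λ k j → y (suc k) i * paths j)
      elementary-walks zero i = begin
        e 0 * (x i * 1#)         ≈⟨ solve 2 (λ e x → e :* (x :* con 1) := x :* e) ≈-refl (e 0) (x i) ⟩
        x i * e 0                ≈⟨ ≈-sym (y-suc 0 i) ⟩
        y 1 i + x i * y 0 i      ≈⟨ +-congˡ (*-congˡ (y₀ i)) ⟩
        y 1 i + x i * 0#         ≈⟨ solve 2 (λ y x → y :+ x :* con 0 := y :* con 1) ≈-refl (y 1 i) (x i) ⟩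
        y 1 i * 1#               ∎
      elementary-walks (suc n) i = +-cancelʳ (x i * G n) (G (suc n)) (H (suc n)) (begin
        G (suc n) + x i * G n
          ≈⟨ +-cong (diag-last n λ k j → e k * (x i * walks j i)) (diag-*ˡ n (x i) _) ⟩
        (diag n (λ k j → e k * (x i * walks (suc j) i)) + e (suc n) * (x i * 1#))
          + diag n (λ k j → x i * (e k * (x i * walks j i)))
          ≈⟨ solve 3 (λ a b c → (a :+ b) :+ c := (a :+ c) :+ b) ≈-refl _ _ _ ⟩
        (diag n (λ k j → e k * (x i * walks (suc j) i)) + diag n (λ k j → x i * (e k * (x i * walks j i))))
          + e (suc n) * (x i * 1#)
          ≈⟨ +-cong (≈-sym (diag-+ n _ _))
               (solve 2 (λ e x → e :* (x :* con 1) := x :* (e :* con 1)) ≈-refl (e (suc n)) (x i)) ⟩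
        diag n (λ k j → e k * (x i * walks (suc j) i) + x i * (e k * (x i * walks j i)))
          + x i * (e (suc n) * 1#)
          ≈⟨ +-congʳ (diag-cong n λ k j → ≈-trans
               (solve 4 (λ e x s w → e :* (x :* s) :+ x :* (e :* (x :* w)) := x :* (e :* (s :+ x :* w))) ≈-refl
                 (e k) (x i) (walks (suc j) i) (walks j i))
               (*-congˡ (*-congˡ (step-+walk (walks j) i)))) ⟩
        diag n (λ k j → x i * (e k * paths (suc j))) + x i * (e (suc n) * 1#)
          ≈⟨ ≈-sym (diag-last n λ k j → x i * (e k * paths j)) ⟩
        x i * (e 0 * paths (suc n)) + diag n (λ k j → x i * (e (suc k) * paths j))
          ≈⟨ +-cong (≈-trans (≈-sym (*-assoc _ _ _)) (*-congʳ (≈-sym (y-suc 0 i))))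
               (diag-cong n λ k j → ≈-trans (≈-sym (*-assoc _ _ _)) (*-congʳ (≈-sym (y-suc (suc k) i)))) ⟩
        (y 1 i + x i * y 0 i) * paths (suc n) + diag n (λ k j → (y (suc (suc k)) i + x i * y (suc k) i) * paths j)
          ≈⟨ +-cong (*-congʳ (≈-trans (+-congˡ (*-congˡ (y₀ i)))
                 (solve 2 (λ y x → y :+ x :* con 0 := y) ≈-refl (y 1 i) (x i))))
               (diag-cong n λ k j →
                 solve 4 (λ a x b p → (a :+ x :* b) :* p := a :* p :+ x :* (b :* p)) ≈-refl
                   (y (suc (suc k)) i) (x i) (y (suc k) i) (paths j)) ⟩
        y 1 i * paths (suc n) + diag n (λ k j → y (suc (suc k)) i * paths j + x i * (y (suc k) i * paths j))
          ≈⟨ +-congˡ (diag-+ n _ _) ⟩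
        y 1 i * paths (suc n) + (diag n (λ k j → y (suc (suc k)) i * paths j) + diag n (λ k j → x i * (y (suc k) i * paths j)))
          ≈⟨ ≈-sym (+-assoc _ _ _) ⟩
        H (suc n) + diag n (λ k j → x i * (y (suc k) i * paths j))
          ≈⟨ +-congˡ (≈-sym (diag-*ˡ n (x i) _)) ⟩
        H (suc n) + x i * H n
          ≈⟨ +-congˡ (*-congˡ (≈-sym (elementary-walks n i))) ⟩
        H (suc n) + x i * G n ∎)
        where
        G H : ℕ → Carrier
        G k = diag k (λ k j → e k * (x i * walks j i))
        H k = diag k (λ k j → y (suc k) i * paths j)

      -- Summing `elementary-walks` over i gives ∑ eₖ Pⱼ₊₁ = ∑ (dₖ + eₖ₊₁) Pⱼ over k + j = n.
      -- Shifting the index on the left produces the same sum V = ∑ eₖ₊₁ Pⱼ; after cancelling it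
      -- only the two boundary terms e₀ Pₙ₊₁ and eₙ₊₁ P₀ remain.
      paths-suc : ∀ n → paths (suc n) ≈ diag n (λ k j → d k * paths j) + e (suc n)
      paths-suc n = +-cancelʳ V _ _ (begin
        paths (suc n) + V
          ≈⟨ +-congʳ (≈-trans (≈-sym (*-identityˡ _)) (*-congʳ (≈-sym e₀))) ⟩
        e 0 * paths (suc n) + V
          ≈⟨ diag-last n (λ k j → e k * paths j) ⟩
        diag n (λ k j → e k * paths (suc j)) + e (suc n) * 1#
          ≈⟨ +-cong (diag-cong n λ k j → *-distribˡ-sum (e k) λ i → x i * walks j i) (*-identityʳ _) ⟩
        diag n (λ k j → ∑ (λ i → e k * (x i * walks j i))) + e (suc n)
          ≈⟨ +-congʳ (≈-sym (sum-diag n λ i k j → e k * (x i * walks j i))) ⟩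
        ∑ (λ i → diag n (λ k j → e k * (x i * walks j i))) + e (suc n)
          ≈⟨ +-congʳ (sum-cong-≋ (elementary-walks n)) ⟩
        ∑ (λ i → diag n (λ k j → y (suc k) i * paths j)) + e (suc n)
          ≈⟨ +-congʳ (sum-diag n λ i k j → y (suc k) i * paths j) ⟩
        diag n (λ k j → ∑ (λ i → y (suc k) i * paths j)) + e (suc n)
          ≈⟨ +-congʳ (diag-cong n λ k j → ≈-trans (≈-sym (*-distribʳ-sum (paths j) (y (suc k))))
               (≈-trans (*-congʳ (sum-y k)) (distribʳ _ _ _))) ⟩
        diag n (λ k j → d k * paths j + e (suc k) * paths j) + e (suc n)
          ≈⟨ +-congʳ (diag-+ n _ _) ⟩
        (diag n (λ k j → d k * paths j) + V) + e (suc n)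
          ≈⟨ solve 3 (λ a v e → (a :+ v) :+ e := (a :+ e) :+ v) ≈-refl _ _ _ ⟩
        (diag n (λ k j → d k * paths j) + e (suc n)) + V ∎)
        where
        V : Carrier
        V = diag n (λ k j → e (suc k) * paths j)

open RingSums ℤ.+-*-commutativeRing using (diag; diag-cong; diag-+; diag-*ˡ; diag-0; diag-swap; diag-assoc)
open ≡-Reasoning

-- The commutative ring of formal power series in m variables.

sumℤ-++ : ∀ xs ys → sumℤ (xs ++ ys) ≡ sumℤ xs ℤ.+ sumℤ ys
sumℤ-++ []       ys = sym (ℤ.+-identityˡ _)
sumℤ-++ (x ∷ xs) ys = trans (cong (ℤ._+_ x) (sumℤ-++ xs ys)) (sym (ℤ.+-assoc x _ _))

sumℤ-cartesianProductWith : ∀ {A B C : Set} (F : C → ℤ) (h : A → B → C) xs ys →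
  sumℤ (map F (cartesianProductWith h xs ys)) ≡ sumℤ (map (λ x → sumℤ (map (λ y → F (h x y)) ys)) xs)
sumℤ-cartesianProductWith F h []       ys = refl
sumℤ-cartesianProductWith F h (x ∷ xs) ys = begin
  sumℤ (map F (map (h x) ys ++ cartesianProductWith h xs ys))
    ≡⟨ cong sumℤ (List.map-++ F (map (h x) ys) _) ⟩
  sumℤ (map F (map (h x) ys) ++ map F (cartesianProductWith h xs ys))
    ≡⟨ sumℤ-++ (map F (map (h x) ys)) _ ⟩
  sumℤ (map F (map (h x) ys)) ℤ.+ sumℤ (map F (cartesianProductWith h xs ys))
    ≡⟨ cong₂ ℤ._+_ (cong sumℤ (sym (List.map-∘ ys))) (sumℤ-cartesianProductWith F h xs ys) ⟩
  sumℤ (map (λ y → F (h x y)) ys) ℤ.+ sumℤ (map (λ x → sumℤ (map (λ y → F (h x y)) ys)) xs) ∎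

sumℤ-upTo : ∀ a (φ : ℕ → ℕ → ℤ) → sumℤ (applyUpTo (λ i → φ i (a ∸ i)) (suc a)) ≡ diag a φ
sumℤ-upTo zero    φ = ℤ.+-identityʳ _
sumℤ-upTo (suc a) φ = cong (ℤ._+_ (φ 0 (suc a))) (sumℤ-upTo a (λ i → φ (suc i)))

infixl 8 _⟨_⟩

-- The coefficient of the i-th power of the first variable.
_⟨_⟩ : Series → ℕ → Series
(f ⟨ i ⟩) α = f (i ∷ α)

*ₛ-[] : ∀ f g → (f *ₛ g) [] ≡ f [] ℤ.* g []
*ₛ-[] f g = ℤ.+-identityʳ _

-- Read as power series in the first variable with series in the others as coefficients, f and g
-- multiply by the Cauchy product. With this, each ring axiom follows by induction on the monomial
-- from a property of `diag`.
*ₛ-∷ : ∀ f g a α → (f *ₛ g) (a ∷ α) ≡ diag a (λ i j → (f ⟨ i ⟩ *ₛ g ⟨ j ⟩) α)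
*ₛ-∷ f g a α = begin
  (f *ₛ g) (a ∷ α)
    ≡⟨ sumℤ-cartesianProductWith (λ p → f (proj₁ p) ℤ.* g (proj₂ p))
         (λ i p → i ∷ proj₁ p , (a ∸ i) ∷ proj₂ p) (upTo (suc a)) (factorisations α) ⟩
  sumℤ (map (λ i → (f ⟨ i ⟩ *ₛ g ⟨ a ∸ i ⟩) α) (upTo (suc a)))
    ≡⟨ cong sumℤ (List.map-upTo (λ i → (f ⟨ i ⟩ *ₛ g ⟨ a ∸ i ⟩) α) (suc a)) ⟩
  sumℤ (applyUpTo (λ i → (f ⟨ i ⟩ *ₛ g ⟨ a ∸ i ⟩) α) (suc a))
    ≡⟨ sumℤ-upTo a (λ i j → (f ⟨ i ⟩ *ₛ g ⟨ j ⟩) α) ⟩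
  diag a (λ i j → (f ⟨ i ⟩ *ₛ g ⟨ j ⟩) α) ∎

infix 4 _≈[_]_

-- Equality of the images in ℤ[[x₁, …, xₘ]].
_≈[_]_ : Series → ℕ → Series → Set
f ≈[ m ] g = ∀ α → length α ≡ m → f α ≡ g α

⟨⟩-cong : ∀ {m f g} → f ≈[ suc m ] g → ∀ i → f ⟨ i ⟩ ≈[ m ] g ⟨ i ⟩
⟨⟩-cong f≈g i α ∣α∣ = f≈g (i ∷ α) (cong suc ∣α∣)

-- Both factors in every factorisation of α have the same length as α, so agreement in m variables
-- is enough.
*ₛ-cong : ∀ {m f f′ g g′} → f ≈[ m ] f′ → g ≈[ m ] g′ → f *ₛ g ≈[ m ] f′ *ₛ g′
*ₛ-cong {f = f} {f′} {g} {g′} f≈ g≈ [] ∣α∣ =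
  trans (*ₛ-[] f g) (trans (cong₂ ℤ._*_ (f≈ [] ∣α∣) (g≈ [] ∣α∣)) (sym (*ₛ-[] f′ g′)))
*ₛ-cong {suc m} {f} {f′} {g} {g′} f≈ g≈ (a ∷ α) ∣α∣ = begin
  (f *ₛ g) (a ∷ α)
    ≡⟨ *ₛ-∷ f g a α ⟩
  diag a (λ i j → (f ⟨ i ⟩ *ₛ g ⟨ j ⟩) α)
    ≡⟨ diag-cong a (λ i j → *ₛ-cong {m} (⟨⟩-cong f≈ i) (⟨⟩-cong g≈ j) α (ℕ.suc-injective ∣α∣)) ⟩
  diag a (λ i j → (f′ ⟨ i ⟩ *ₛ g′ ⟨ j ⟩) α)
    ≡⟨ sym (*ₛ-∷ f′ g′ a α) ⟩
  (f′ *ₛ g′) (a ∷ α) ∎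

*ₛ-comm : ∀ f g α → (f *ₛ g) α ≡ (g *ₛ f) α
*ₛ-comm f g []      = cong (ℤ._+ 0ℤ) (ℤ.*-comm (f []) (g []))
*ₛ-comm f g (a ∷ α) = begin
  (f *ₛ g) (a ∷ α)                         ≡⟨ *ₛ-∷ f g a α ⟩
  diag a (λ i j → (f ⟨ i ⟩ *ₛ g ⟨ j ⟩) α)  ≡⟨ diag-swap a _ ⟩
  diag a (λ i j → (f ⟨ j ⟩ *ₛ g ⟨ i ⟩) α)  ≡⟨ diag-cong a (λ i j → *ₛ-comm (f ⟨ j ⟩) (g ⟨ i ⟩) α) ⟩
  diag a (λ i j → (g ⟨ i ⟩ *ₛ f ⟨ j ⟩) α)  ≡⟨ sym (*ₛ-∷ g f a α) ⟩
  (g *ₛ f) (a ∷ α)                         ∎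

*ₛ-distribʳ : ∀ h f g α → ((f +ₛ g) *ₛ h) α ≡ (f *ₛ h) α ℤ.+ (g *ₛ h) α
*ₛ-distribʳ h f g [] = lemma (f []) (g []) (h [])
  where
  lemma : ∀ a b c → (a ℤ.+ b) ℤ.* c ℤ.+ 0ℤ ≡ (a ℤ.* c ℤ.+ 0ℤ) ℤ.+ (b ℤ.* c ℤ.+ 0ℤ)
  lemma = ℤ.solve-∀
*ₛ-distribʳ h f g (a ∷ α) = begin
  ((f +ₛ g) *ₛ h) (a ∷ α)
    ≡⟨ *ₛ-∷ (f +ₛ g) h a α ⟩
  diag a (λ i j → ((f ⟨ i ⟩ +ₛ g ⟨ i ⟩) *ₛ h ⟨ j ⟩) α)
    ≡⟨ diag-cong a (λ i j → *ₛ-distribʳ (h ⟨ j ⟩) (f ⟨ i ⟩) (g ⟨ i ⟩) α) ⟩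
  diag a (λ i j → (f ⟨ i ⟩ *ₛ h ⟨ j ⟩) α ℤ.+ (g ⟨ i ⟩ *ₛ h ⟨ j ⟩) α)
    ≡⟨ diag-+ a _ _ ⟩
  diag a (λ i j → (f ⟨ i ⟩ *ₛ h ⟨ j ⟩) α) ℤ.+ diag a (λ i j → (g ⟨ i ⟩ *ₛ h ⟨ j ⟩) α)
    ≡⟨ sym (cong₂ ℤ._+_ (*ₛ-∷ f h a α) (*ₛ-∷ g h a α)) ⟩
  (f *ₛ h) (a ∷ α) ℤ.+ (g *ₛ h) (a ∷ α) ∎

*ₛ-distribˡ : ∀ h f g α → (h *ₛ (f +ₛ g)) α ≡ (h *ₛ f) α ℤ.+ (h *ₛ g) α
*ₛ-distribˡ h f g α = trans (*ₛ-comm h (f +ₛ g) α)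
  (trans (*ₛ-distribʳ h f g α) (cong₂ ℤ._+_ (*ₛ-comm f h α) (*ₛ-comm g h α)))

·ₛ-*ₛ : ∀ a f g α → ((a ·ₛ f) *ₛ g) α ≡ a ℤ.* (f *ₛ g) α
·ₛ-*ₛ a f g [] = lemma a (f []) (g [])
  where
  lemma : ∀ a b c → (a ℤ.* b) ℤ.* c ℤ.+ 0ℤ ≡ a ℤ.* (b ℤ.* c ℤ.+ 0ℤ)
  lemma = ℤ.solve-∀
·ₛ-*ₛ a f g (b ∷ β) = begin
  ((a ·ₛ f) *ₛ g) (b ∷ β)                                 ≡⟨ *ₛ-∷ (a ·ₛ f) g b β ⟩
  diag b (λ i j → ((a ·ₛ f ⟨ i ⟩) *ₛ g ⟨ j ⟩) β)          ≡⟨ diag-cong b (λ i j → ·ₛ-*ₛ a (f ⟨ i ⟩) (g ⟨ j ⟩) β) ⟩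
  diag b (λ i j → a ℤ.* (f ⟨ i ⟩ *ₛ g ⟨ j ⟩) β)           ≡⟨ sym (diag-*ˡ b a _) ⟩
  a ℤ.* diag b (λ i j → (f ⟨ i ⟩ *ₛ g ⟨ j ⟩) β)           ≡⟨ cong (a ℤ.*_) (sym (*ₛ-∷ f g b β)) ⟩
  a ℤ.* (f *ₛ g) (b ∷ β)                                  ∎

*ₛ-zeroˡ : ∀ g α → (0ₛ *ₛ g) α ≡ 0ℤ
*ₛ-zeroˡ g α = ·ₛ-*ₛ 0ℤ 0ₛ g α

*ₛ-diag : ∀ n (φ : ℕ → ℕ → Series) g α →
  ((λ β → diag n (λ i j → φ i j β)) *ₛ g) α ≡ diag n (λ i j → (φ i j *ₛ g) α)
*ₛ-diag zero    φ g α = refl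
*ₛ-diag (suc n) φ g α = trans (*ₛ-distribʳ g (φ 0 (suc n)) _ α)
  (cong (ℤ._+_ ((φ 0 (suc n) *ₛ g) α)) (*ₛ-diag n (λ i → φ (suc i)) g α))

*ₛ-assoc : ∀ f g h α → ((f *ₛ g) *ₛ h) α ≡ (f *ₛ (g *ₛ h)) α
*ₛ-assoc f g h [] = lemma (f []) (g []) (h [])
  where
  lemma : ∀ a b c → (a ℤ.* b ℤ.+ 0ℤ) ℤ.* c ℤ.+ 0ℤ ≡ a ℤ.* (b ℤ.* c ℤ.+ 0ℤ) ℤ.+ 0ℤ
  lemma = ℤ.solve-∀
*ₛ-assoc f g h (a ∷ α) = begin
  ((f *ₛ g) *ₛ h) (a ∷ α)
    ≡⟨ *ₛ-∷ (f *ₛ g) h a α ⟩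
  diag a (λ k l → ((f *ₛ g) ⟨ k ⟩ *ₛ h ⟨ l ⟩) α)
    ≡⟨ diag-cong a (λ k l → trans
         (*ₛ-cong {length α} (λ β _ → *ₛ-∷ f g k β) (λ _ _ → refl) α refl)
         (*ₛ-diag k (λ i j → f ⟨ i ⟩ *ₛ g ⟨ j ⟩) (h ⟨ l ⟩) α)) ⟩
  diag a (λ k l → diag k (λ i j → ((f ⟨ i ⟩ *ₛ g ⟨ j ⟩) *ₛ h ⟨ l ⟩) α))
    ≡⟨ sym (diag-assoc a (λ i j l → ((f ⟨ i ⟩ *ₛ g ⟨ j ⟩) *ₛ h ⟨ l ⟩) α)) ⟩
  diag a (λ i k → diag k (λ j l → ((f ⟨ i ⟩ *ₛ g ⟨ j ⟩) *ₛ h ⟨ l ⟩) α))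
    -- `*ₛ-diag` distributes over a sum in the left factor, so f is moved to the right before the
    -- inner sum is collected.
    ≡⟨ diag-cong a (λ i k → diag-cong k λ j l → trans
         (*ₛ-assoc (f ⟨ i ⟩) (g ⟨ j ⟩) (h ⟨ l ⟩) α)
         (*ₛ-comm (f ⟨ i ⟩) (g ⟨ j ⟩ *ₛ h ⟨ l ⟩) α)) ⟩
  diag a (λ i k → diag k (λ j l → ((g ⟨ j ⟩ *ₛ h ⟨ l ⟩) *ₛ f ⟨ i ⟩) α))
    ≡⟨ diag-cong a (λ i k → trans
         (sym (*ₛ-diag k (λ j l → g ⟨ j ⟩ *ₛ h ⟨ l ⟩) (f ⟨ i ⟩) α))
         (trans (*ₛ-cong {length α} (λ β _ → sym (*ₛ-∷ g h k β)) (λ _ _ → refl) α refl)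
           (*ₛ-comm ((g *ₛ h) ⟨ k ⟩) (f ⟨ i ⟩) α))) ⟩
  diag a (λ i k → (f ⟨ i ⟩ *ₛ (g *ₛ h) ⟨ k ⟩) α)
    ≡⟨ sym (*ₛ-∷ f (g *ₛ h) a α) ⟩
  (f *ₛ (g *ₛ h)) (a ∷ α) ∎

*ₛ-identityˡ : ∀ f α → (1ₛ *ₛ f) α ≡ f α
*ₛ-identityˡ f []          = trans (*ₛ-[] 1ₛ f) (ℤ.*-identityˡ _)
*ₛ-identityˡ f (zero ∷ α)  = trans (*ₛ-∷ 1ₛ f 0 α) (*ₛ-identityˡ (f ⟨ 0 ⟩) α)
*ₛ-identityˡ f (suc a ∷ α) = begin
  (1ₛ *ₛ f) (suc a ∷ α)
    ≡⟨ *ₛ-∷ 1ₛ f (suc a) α ⟩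
  (1ₛ *ₛ f ⟨ suc a ⟩) α ℤ.+ diag a (λ i j → (0ₛ *ₛ f ⟨ j ⟩) α)
    ≡⟨ cong₂ ℤ._+_ (*ₛ-identityˡ (f ⟨ suc a ⟩) α)
         (trans (diag-cong a λ i j → *ₛ-zeroˡ (f ⟨ j ⟩) α) (diag-0 a)) ⟩
  f (suc a ∷ α) ℤ.+ 0ℤ
    ≡⟨ ℤ.+-identityʳ _ ⟩
  f (suc a ∷ α) ∎

-ₛ_ : Series → Series
(-ₛ f) α = ℤ.- f α

seriesRing : ℕ → CommutativeRing 0ℓ 0ℓ
seriesRing m = record
  { Carrier = Series ; _≈_ = _≈[ m ]_ ; _+_ = _+ₛ_ ; _*_ = _*ₛ_ ; -_ = -ₛ_ ; 0# = 0ₛ ; 1# = 1ₛ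
  ; isCommutativeRing = record
    { isRing = record
      { +-isAbelianGroup = record
        { isGroup = record
          { isMonoid = record
            { isSemigroup = record
              { isMagma = record
                { isEquivalence = record
                  { refl  = λ _ _ → refl
                  ; sym   = λ p α ∣α∣ → sym (p α ∣α∣)
                  ; trans = λ p q α ∣α∣ → trans (p α ∣α∣) (q α ∣α∣)
                  }
                ; ∙-cong = λ p q α ∣α∣ → cong₂ ℤ._+_ (p α ∣α∣) (q α ∣α∣)
                }
              ; assoc = λ f g h α _ → ℤ.+-assoc (f α) (g α) (h α)
              }
            ; identity = (λ f α _ → ℤ.+-identityˡ (f α)) , (λ f α _ → ℤ.+-identityʳ (f α))
            }
          ; inverse = (λ f α _ → ℤ.+-inverseˡ (f α)) , (λ f α _ → ℤ.+-inverseʳ (f α))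
          ; ⁻¹-cong = λ p α ∣α∣ → cong ℤ.-_ (p α ∣α∣)
          }
        ; comm = λ f g α _ → ℤ.+-comm (f α) (g α)
        }
      ; *-cong = *ₛ-cong
      ; *-assoc = λ f g h α _ → *ₛ-assoc f g h α
      ; *-identity = (λ f α _ → *ₛ-identityˡ f α)
                   , (λ f α _ → trans (*ₛ-comm f 1ₛ α) (*ₛ-identityˡ f α))
      ; distrib = (λ h f g α _ → *ₛ-distribˡ h f g α) , (λ h f g α _ → *ₛ-distribʳ h f g α)
      }
    ; *-comm = λ f g α _ → *ₛ-comm f g α
    }
  }

-- Variables, elementary symmetric functions and their Euler derivatives.

-- Multiplication by xᵢ.
shift : ∀ {m} → Fin m → Series → Series
shift _       f []          = 0ℤ
shift zero    f (zero ∷ α)  = 0ℤ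
shift zero    f (suc a ∷ α) = f (a ∷ α)
shift (suc i) f (a ∷ α)     = shift i (f ⟨ a ⟩) α

var : ∀ {m} → Fin m → Series
var i = shift i 1ₛ

shift-cong : ∀ {m} (i : Fin m) {f g} → (∀ α → f α ≡ g α) → ∀ α → shift i f α ≡ shift i g α
shift-cong _       h []          = refl
shift-cong zero    h (zero ∷ α)  = refl
shift-cong zero    h (suc a ∷ α) = h (a ∷ α)
shift-cong (suc i) h (a ∷ α)     = shift-cong i (λ β → h (a ∷ β)) α

shift-0 : ∀ {m} (i : Fin m) α → shift i 0ₛ α ≡ 0ℤ
shift-0 _       []          = refl
shift-0 zero    (zero ∷ α)  = refl
shift-0 zero    (suc a ∷ α) = refl
shift-0 (suc i) (a ∷ α)     = shift-0 i α

shift-+ : ∀ {m} (i : Fin m) f g α → shift i (f +ₛ g) α ≡ shift i f α ℤ.+ shift i g α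
shift-+ _       f g []          = refl
shift-+ zero    f g (zero ∷ α)  = refl
shift-+ zero    f g (suc a ∷ α) = refl
shift-+ (suc i) f g (a ∷ α)     = shift-+ i (f ⟨ a ⟩) (g ⟨ a ⟩) α

shift-diag : ∀ {m} (i : Fin m) n (φ : ℕ → ℕ → Series) α →
  shift i (λ β → diag n (λ j k → φ j k β)) α ≡ diag n (λ j k → shift i (φ j k) α)
shift-diag i zero    φ α = refl
shift-diag i (suc n) φ α = trans (shift-+ i (φ 0 (suc n)) _ α)
  (cong (ℤ._+_ (shift i (φ 0 (suc n)) α)) (shift-diag i n (λ j → φ (suc j)) α))

shift-*ₛ : ∀ {m} (i : Fin m) f g α → (shift i f *ₛ g) α ≡ shift i (f *ₛ g) α
shift-*ₛ i       f g []          = refl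
shift-*ₛ zero    f g (zero ∷ α)  = trans (*ₛ-∷ (shift zero f) g 0 α) (*ₛ-zeroˡ (g ⟨ 0 ⟩) α)
shift-*ₛ zero    f g (suc a ∷ α) = begin
  (shift zero f *ₛ g) (suc a ∷ α)
    ≡⟨ *ₛ-∷ (shift zero f) g (suc a) α ⟩
  (0ₛ *ₛ g ⟨ suc a ⟩) α ℤ.+ diag a (λ i j → (f ⟨ i ⟩ *ₛ g ⟨ j ⟩) α)
    ≡⟨ cong₂ ℤ._+_ (*ₛ-zeroˡ (g ⟨ suc a ⟩) α) (sym (*ₛ-∷ f g a α)) ⟩
  0ℤ ℤ.+ (f *ₛ g) (a ∷ α)
    ≡⟨ ℤ.+-identityˡ _ ⟩
  (f *ₛ g) (a ∷ α) ∎
shift-*ₛ (suc i) f g (a ∷ α)     = begin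
  (shift (suc i) f *ₛ g) (a ∷ α)
    ≡⟨ *ₛ-∷ (shift (suc i) f) g a α ⟩
  diag a (λ j k → (shift i (f ⟨ j ⟩) *ₛ g ⟨ k ⟩) α)
    ≡⟨ diag-cong a (λ j k → shift-*ₛ i (f ⟨ j ⟩) (g ⟨ k ⟩) α) ⟩
  diag a (λ j k → shift i (f ⟨ j ⟩ *ₛ g ⟨ k ⟩) α)
    ≡⟨ sym (shift-diag i a (λ j k → f ⟨ j ⟩ *ₛ g ⟨ k ⟩) α) ⟩
  shift i (λ β → diag a (λ j k → (f ⟨ j ⟩ *ₛ g ⟨ k ⟩) β)) α
    ≡⟨ shift-cong i (λ β → sym (*ₛ-∷ f g a β)) α ⟩
  shift i ((f *ₛ g) ⟨ a ⟩) α ∎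

var-*ₛ : ∀ {m} (i : Fin m) f α → (var i *ₛ f) α ≡ shift i f α
var-*ₛ i f α = trans (shift-*ₛ i 1ₛ f α) (shift-cong i (*ₛ-identityˡ f) α)

e₀≡1 : ∀ α → e 0 α ≡ 1ₛ α
e₀≡1 []                = refl
e₀≡1 (zero ∷ α)        = e₀≡1 α
e₀≡1 (suc zero ∷ α)    = cong (if_then 1ℤ else 0ℤ) (∧-zeroʳ (does (all? (ℕ._≤? 1) α)))
e₀≡1 (suc (suc a) ∷ α) = refl

e₀-suc : ∀ a α → e 0 (suc a ∷ α) ≡ 0ℤ
e₀-suc a α = e₀≡1 (suc a ∷ α)

e-short : ∀ {k} α → length α < k → e k α ≡ 0ℤ
e-short {suc k} []                _         = refl
e-short {suc k} (zero ∷ α)        (s≤s ∣α∣) = e-short α (ℕ.m<n⇒m<1+n ∣α∣)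
e-short {suc k} (suc zero ∷ α)    (s≤s ∣α∣) = e-short {k} α ∣α∣
e-short {suc k} (suc (suc a) ∷ α) _         = refl

exponent : ∀ {m} → Fin m → Monomial → ℕ
exponent _       []      = 0
exponent zero    (a ∷ α) = a
exponent (suc i) (a ∷ α) = exponent i α

-- xᵢ ∂eₖ/∂xᵢ
euler : ∀ {m} → ℕ → Fin m → Series
euler k i α = + exponent i α ℤ.* e k α

euler-0 : ∀ {m} (i : Fin m) α → euler 0 i α ≡ 0ℤ
euler-0 i       []          = refl
euler-0 zero    (zero ∷ α)  = refl
euler-0 zero    (suc a ∷ α) = trans (cong (ℤ._*_ (+ suc a)) (e₀-suc a α)) (ℤ.*-zeroʳ (+ suc a))
euler-0 (suc i) (zero ∷ α)  = euler-0 i α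
euler-0 (suc i) (suc a ∷ α) =
  trans (cong (ℤ._*_ (+ exponent i α)) (e₀-suc a α)) (ℤ.*-zeroʳ (+ exponent i α))

-- Let êₖ be eₖ in the variables other than xᵢ. Then xᵢ ∂eₖ₊₁/∂xᵢ = xᵢ êₖ and eₖ = êₖ + xᵢ êₖ₋₁;
-- multiply the latter by xᵢ.
euler-suc : ∀ {m} k (i : Fin m) α → euler (suc k) i α ℤ.+ shift i (euler k i) α ≡ shift i (e k) α
euler-suc k i       []                = refl
euler-suc k zero    (zero ∷ α)        = refl
euler-suc k zero    (suc zero ∷ α)    = lemma (e k α)
  where
  lemma : ∀ a → 1ℤ ℤ.* a ℤ.+ 0ℤ ≡ a
  lemma = ℤ.solve-∀
euler-suc k zero    (suc (suc zero) ∷ α) = trans (ℤ.+-identityˡ _) (ℤ.*-identityˡ (e k (1 ∷ α)))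
euler-suc k zero    (suc (suc (suc a)) ∷ α) = lemma (+ suc (suc (suc a))) (+ suc (suc a))
  where
  lemma : ∀ a b → a ℤ.* 0ℤ ℤ.+ b ℤ.* 0ℤ ≡ 0ℤ
  lemma = ℤ.solve-∀
euler-suc k       (suc i) (zero ∷ α)        = euler-suc k i α
euler-suc zero    (suc i) (suc zero ∷ α)    = begin
  euler 0 i α ℤ.+ shift i (λ β → + exponent i β ℤ.* e 0 (1 ∷ β)) α
    ≡⟨ cong₂ ℤ._+_ (euler-0 i α) (shift-cong i (λ β →
         trans (cong (ℤ._*_ (+ exponent i β)) (e₀-suc 0 β)) (ℤ.*-zeroʳ (+ exponent i β))) α) ⟩
  0ℤ ℤ.+ shift i 0ₛ α
    ≡⟨ ℤ.+-identityˡ _ ⟩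
  shift i 0ₛ α
    ≡⟨ shift-cong i (λ β → sym (e₀-suc 0 β)) α ⟩
  shift i (λ β → e 0 (1 ∷ β)) α ∎
euler-suc (suc k) (suc i) (suc zero ∷ α)    = euler-suc k i α
euler-suc k       (suc i) (suc (suc a) ∷ α) =
  trans (cong₂ ℤ._+_ (ℤ.*-zeroʳ (+ exponent i α))
          (trans (shift-cong i (λ β → ℤ.*-zeroʳ (+ exponent i β)) α) (shift-0 i α)))
    (sym (shift-0 i α))

e-degree : ∀ k α → + sum α ℤ.* e k α ≡ + k ℤ.* e k α
e-degree k α with sum α ℕ.≟ k
... | yes refl = refl
... | no  ∑α≢k = trans (vanishes (+ sum α)) (sym (vanishes (+ k)))
  where
  vanishes : ∀ a → a ℤ.* e k α ≡ 0ℤ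
  vanishes a = trans (cong (λ b → a ℤ.* (if b then 1ℤ else 0ℤ))
    (dec-false (all? (ℕ._≤? 1) α ×-dec (sum α ℕ.≟ k)) (λ p → ∑α≢k (proj₂ p)))) (ℤ.*-zeroʳ a)

module ∑ℤ = Algebra.Properties.Semiring.Sum ℤ.+-*-semiring

∑-exponent : ∀ α → ∑ℤ.sum (λ i → + exponent {length α} i α) ≡ + sum α
∑-exponent []      = refl
∑-exponent (a ∷ α) = trans (cong (ℤ._+_ (+ a)) (∑-exponent α)) (sym (ℤ.pos-+ a (sum α)))

module ∑Series (m : ℕ) where
  open CommutativeRing (seriesRing m) using (semiring)
  open Algebra.Properties.Semiring.Sum semiring public renaming (sum to ∑)

  ∑-coefficient : ∀ {n} (f : Fin n → Series) α → ∑ f α ≡ ∑ℤ.sum (λ i → f i α)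
  ∑-coefficient {zero}  f α = refl
  ∑-coefficient {suc n} f α = cong (ℤ._+_ (f zero α)) (∑-coefficient (λ i → f (suc i)) α)

  -- Euler's identity for a homogeneous series of degree k + 1, with the degree split as
  -- `Recurrence` expects.
  ∑-euler : ∀ k → ∑ {m} (euler (suc k)) ≈[ m ] (+ k ·ₛ e (suc k)) +ₛ e (suc k)
  ∑-euler k α refl = begin
    ∑ {length α} (euler (suc k)) α
      ≡⟨ ∑-coefficient {length α} (euler (suc k)) α ⟩
    ∑ℤ.sum (λ (i : Fin (length α)) → + exponent i α ℤ.* e (suc k) α)
      ≡⟨ sym (∑ℤ.*-distribʳ-sum (e (suc k) α) (λ (i : Fin (length α)) → + exponent i α)) ⟩
    ∑ℤ.sum (λ (i : Fin (length α)) → + exponent i α) ℤ.* e (suc k) α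
      ≡⟨ cong (ℤ._* e (suc k) α) (∑-exponent α) ⟩
    + sum α ℤ.* e (suc k) α
      ≡⟨ e-degree (suc k) α ⟩
    + suc k ℤ.* e (suc k) α
      ≡⟨ trans (ℤ.suc-* (+ k) (e (suc k) α)) (ℤ.+-comm (e (suc k) α) _) ⟩
    + k ℤ.* e (suc k) α ℤ.+ e (suc k) α ∎

  open RingSums (seriesRing m) public using (distinct; module Words) renaming (diag to diagₛ; diag-cong to diagₛ-cong)
  open Words (var {m}) public
  open Recurrence e (λ k → + k ·ₛ e (suc k)) euler
    (λ α _ → e₀≡1 α)
    (λ i α _ → euler-0 i α)
    (λ k i α _ → trans
      (cong (ℤ._+_ (euler (suc k) i α)) (var-*ₛ i (euler k i) α))
      (trans (euler-suc k i α) (sym (var-*ₛ i (e k) α))))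
    ∑-euler
    public

-- Weights of colourings as coefficients of monomials.

indicator : Bool → ℤ
indicator b = if b then 1ℤ else 0ℤ

indicator-does : ∀ {P : Set} {z} (P? : Dec P) → (P → z ≡ 1ℤ) → (¬ P → z ≡ 0ℤ) → indicator (does P?) ≡ z
indicator-does (yes p) one zer = sym (one p)
indicator-does (no ¬p) one zer = sym (zer ¬p)

length-filter : ∀ {A : Set} {P : A → Set} (P? : ∀ x → Dec (P x)) xs →
  + length (filter P? xs) ≡ sumℤ (map (λ x → indicator (does (P? x))) xs)
length-filter P? []       = refl
length-filter P? (x ∷ xs) with does (P? x)
... | true  = trans (ℤ.pos-+ 1 _) (cong (ℤ._+_ 1ℤ) (length-filter P? xs))
... | false = trans (length-filter P? xs) (sym (ℤ.+-identityˡ _))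

sumℤ-cong : ∀ {A : Set} {f g : A → ℤ} → (∀ x → f x ≡ g x) → ∀ xs → sumℤ (map f xs) ≡ sumℤ (map g xs)
sumℤ-cong h xs = cong sumℤ (List.map-cong h xs)

sumℤ-tabulate : ∀ {m} (f : Fin m → ℤ) → sumℤ (tabulate f) ≡ ∑ℤ.sum f
sumℤ-tabulate {zero}  f = refl
sumℤ-tabulate {suc m} f = cong (ℤ._+_ (f zero)) (sumℤ-tabulate (f ∘ suc))

colourMonomial : ∀ {m N} → Vec (Fin m) N → Series
colourMonomial []      = 1ₛ
colourMonomial (k ∷ κ) = shift k (colourMonomial κ)

shift-tabulate-0 : ∀ {m} (k : Fin m) f (a : Fin m → ℕ) → a k ≡ 0 → shift k f (tabulate a) ≡ 0ℤ
shift-tabulate-0 zero    f a ak≡0 rewrite ak≡0 = refl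
shift-tabulate-0 (suc k) f a ak≡0 = shift-tabulate-0 k (f ⟨ a zero ⟩) (a ∘ suc) ak≡0

shift-tabulate : ∀ {m} (k : Fin m) f (a b : Fin m → ℕ) → a k ≡ suc (b k) → (∀ i → k ≢ i → a i ≡ b i) →
  shift k f (tabulate a) ≡ f (tabulate b)
shift-tabulate zero    f a b ak≡ a≡b rewrite ak≡ =
  cong (λ α → f (b zero ∷ α)) (List.tabulate-cong λ i → a≡b (suc i) λ ())
shift-tabulate (suc k) f a b ak≡ a≡b rewrite a≡b zero (λ ()) =
  shift-tabulate k (f ⟨ b zero ⟩) (a ∘ suc) (b ∘ suc) ak≡ λ i k≢i → a≡b (suc i) (k≢i ∘ Fin.suc-injective)

1ₛ-tabulate-0 : ∀ {m} (a : Fin m → ℕ) → (∀ i → 0 ≡ a i) → 1ₛ (tabulate a) ≡ 1ℤ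
1ₛ-tabulate-0 {zero}  a a≡0 = refl
1ₛ-tabulate-0 {suc m} a a≡0 rewrite sym (a≡0 zero) = 1ₛ-tabulate-0 (a ∘ suc) (a≡0 ∘ suc)

1ₛ-tabulate-≢0 : ∀ {m} (a : Fin m → ℕ) → ¬ (∀ i → 0 ≡ a i) → 1ₛ (tabulate a) ≡ 0ℤ
1ₛ-tabulate-≢0 {zero}  a a≢0 = contradiction (λ ()) a≢0
1ₛ-tabulate-≢0 {suc m} a a≢0 with a zero in a0≡
... | suc _ = refl
... | zero  = 1ₛ-tabulate-≢0 (a ∘ suc) λ a≡0 → a≢0 λ { zero → sym a0≡ ; (suc i) → a≡0 i }

Weighs : ∀ {m N} → (Fin m → ℕ) → Vec (Fin m) N → Set
Weighs a κ = ∀ i → Vec.count (Fin._≟ i) κ ≡ a i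

count-≡ : ∀ {m N} (k : Fin m) (κ : Vec (Fin m) N) → Vec.count (Fin._≟ k) (k ∷ κ) ≡ suc (Vec.count (Fin._≟ k) κ)
count-≡ k κ with k Fin.≟ k
... | yes _  = refl
... | no k≢k = contradiction refl k≢k

count-≢ : ∀ {m N} {k i : Fin m} (κ : Vec (Fin m) N) → k ≢ i → Vec.count (Fin._≟ i) (k ∷ κ) ≡ Vec.count (Fin._≟ i) κ
count-≢ {k = k} {i} κ k≢i with k Fin.≟ i
... | yes k≡i = contradiction k≡i k≢i
... | no _    = refl

-- The exponents of x^a / xₖ; used when `a k` is nonzero.
lower : ∀ {m} → Fin m → (Fin m → ℕ) → Fin m → ℕ
lower k a i with k Fin.≟ i
... | yes _ = pred (a i)
... | no _  = a i

lower-≡ : ∀ {m} (k : Fin m) a → lower k a k ≡ pred (a k)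
lower-≡ k a with k Fin.≟ k
... | yes _  = refl
... | no k≢k = contradiction refl k≢k

lower-≢ : ∀ {m} {k i : Fin m} a → k ≢ i → lower k a i ≡ a i
lower-≢ {k = k} {i} a k≢i with k Fin.≟ i
... | yes k≡i = contradiction k≡i k≢i
... | no _    = refl

shift-lower : ∀ {m} (k : Fin m) f a → a k ≢ 0 → shift k f (tabulate a) ≡ f (tabulate (lower k a))
shift-lower k f a ak≢0 = shift-tabulate k f a (lower k a)
  (trans (sym (ℕ.suc-pred (a k) {{ℕ.≢-nonZero ak≢0}})) (cong suc (sym (lower-≡ k a))))
  (λ i k≢i → sym (lower-≢ a k≢i))

colourMonomial-weighs : ∀ {m N} (κ : Vec (Fin m) N) a → Weighs a κ → colourMonomial κ (tabulate a) ≡ 1ℤ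
colourMonomial-weighs []      a w = 1ₛ-tabulate-0 a w
colourMonomial-weighs (k ∷ κ) a w = trans (shift-lower k _ a ak≢0) (colourMonomial-weighs κ (lower k a) w′)
  where
  ak≡ : suc (Vec.count (Fin._≟ k) κ) ≡ a k
  ak≡ = trans (sym (count-≡ k κ)) (w k)
  ak≢0 : a k ≢ 0
  ak≢0 ak≡0 = contradiction (trans ak≡ ak≡0) λ ()
  w′ : Weighs (lower k a) κ
  w′ i with k Fin.≟ i
  ... | yes refl = cong pred ak≡
  ... | no k≢i   = trans (sym (count-≢ κ k≢i)) (w i)

colourMonomial-¬weighs : ∀ {m N} (κ : Vec (Fin m) N) a → ¬ Weighs a κ → colourMonomial κ (tabulate a) ≡ 0ℤ
colourMonomial-¬weighs []      a ¬w = 1ₛ-tabulate-≢0 a ¬w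
colourMonomial-¬weighs (k ∷ κ) a ¬w with a k ℕ.≟ 0
... | yes ak≡0 = shift-tabulate-0 k _ a ak≡0
... | no  ak≢0 = trans (shift-lower k _ a ak≢0) (colourMonomial-¬weighs κ (lower k a) (¬w ∘ weighs))
  where
  weighs : Weighs (lower k a) κ → Weighs a (k ∷ κ)
  weighs w i with k Fin.≟ i | w i
  ... | yes refl | wi = trans (cong suc wi) (ℕ.suc-pred (a k) {{ℕ.≢-nonZero ak≢0}})
  ... | no _     | wi = wi

-- Rewriting α as `tabulate (lookup α)` replaces the list by a function on colours, whose exponent
-- at any one colour can be lowered as the vertices are removed one by one.
colourMonomial-hasWeight : ∀ α {N} (κ : Vec (Fin (length α)) N) →
  indicator (does (hasWeight? α κ)) ≡ colourMonomial κ α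
colourMonomial-hasWeight α κ = indicator-does (hasWeight? α κ)
  (λ w → trans (cong (colourMonomial κ) (sym (List.tabulate-lookup α))) (colourMonomial-weighs κ (lookup α) w))
  (λ ¬w → trans (cong (colourMonomial κ) (sym (List.tabulate-lookup α))) (colourMonomial-¬weighs κ (lookup α) ¬w))

-- Proper colourings of the twinned path, read along the path.

-- i and j are the colours of two consecutive vertices of the path, κ those
-- of the vertices after them, and w that of the twin of the last vertex.
ProperTail : ∀ {m n} → Fin m → Fin m → Fin m → Vec (Fin m) n → Set
ProperTail w i j []      = w ≢ i × w ≢ j
ProperTail w i j (k ∷ κ) = j ≢ k × ProperTail w j k κ

module _ {m : ℕ} (w : Fin m) where

  -- The second component copies the shape of `TwinAdj` at the last leaf, so that it can be
  -- exchanged with properness of the twinned graph while induction still runs along the path.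
  ProperEnd : ∀ {n} → Vec (Fin m) (suc n) → Set
  ProperEnd {n} κ = Proper (path (suc n)) κ
    × (∀ u → u ≡ fromℕ n ⊎ Adj (path (suc n)) (fromℕ n) u → w ≢ Vec.lookup κ u)

  properEnd⇒properTail : ∀ {n} i j (κ : Vec (Fin m) n) → ProperEnd (i ∷ j ∷ κ) → i ≢ j × ProperTail w i j κ
  properEnd⇒properTail i j []      (pr , end) =
    pr zero (suc zero) (inj₁ refl) , end zero (inj₂ (inj₂ refl)) , end (suc zero) (inj₁ refl)
  properEnd⇒properTail i j (k ∷ κ) (pr , end) =
    pr zero (suc zero) (inj₁ refl) , properEnd⇒properTail j k κ
      ( (λ { a b (inj₁ p) → pr (suc a) (suc b) (inj₁ (cong suc p))
           ; a b (inj₂ p) → pr (suc a) (suc b) (inj₂ (cong suc p)) })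
      , (λ { u (inj₁ p)        → end (suc u) (inj₁ (cong suc p))
           ; u (inj₂ (inj₁ p)) → end (suc u) (inj₂ (inj₁ (cong suc p)))
           ; u (inj₂ (inj₂ p)) → end (suc u) (inj₂ (inj₂ (cong suc p))) }))

  properTail⇒properEnd : ∀ {n} i j (κ : Vec (Fin m) n) → i ≢ j → ProperTail w i j κ → ProperEnd (i ∷ j ∷ κ)
  properTail⇒properEnd {n} i j κ i≢j tail = proper , end κ tail
    where
    rest : ∀ {n} j (κ : Vec (Fin m) n) → ProperTail w i j κ → Proper (path (suc n)) (j ∷ κ)
    rest j []      _            zero zero (inj₁ ())
    rest j []      _            zero zero (inj₂ ())
    rest j (k ∷ κ) (j≢k , tail) = proj₁ (properTail⇒properEnd j k κ j≢k tail)
    proper : Proper (path (suc (suc n))) (i ∷ j ∷ κ)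
    proper zero          (suc zero)    _        = i≢j
    proper (suc zero)    zero          _        = ≢-sym i≢j
    proper (suc a)       (suc b)       (inj₁ p) = rest j κ tail a b (inj₁ (ℕ.suc-injective p))
    proper (suc a)       (suc b)       (inj₂ p) = rest j κ tail a b (inj₂ (ℕ.suc-injective p))
    proper zero          zero          (inj₁ ())
    proper zero          zero          (inj₂ ())
    proper zero          (suc (suc b)) (inj₁ ())
    proper zero          (suc (suc b)) (inj₂ ())
    proper (suc (suc a)) zero          (inj₁ ())
    proper (suc (suc a)) zero          (inj₂ ())
    end : ∀ {n} (κ : Vec (Fin m) n) → ProperTail w i j κ →
      ∀ u → u ≡ fromℕ (suc n) ⊎ Adj (path (suc (suc n))) (fromℕ (suc n)) u → w ≢ Vec.lookup (i ∷ j ∷ κ) u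
    end []      (w≢i , w≢j) zero       _ = w≢i
    end []      (w≢i , w≢j) (suc zero) _ = w≢j
    end (k ∷ κ) (j≢k , tail) zero    (inj₂ (inj₁ ()))
    end (k ∷ κ) (j≢k , tail) zero    (inj₂ (inj₂ ()))
    end (k ∷ κ) (j≢k , tail) (suc u) (inj₁ p) =
      proj₂ (properTail⇒properEnd j k κ j≢k tail) u (inj₁ (Fin.suc-injective p))
    end (k ∷ κ) (j≢k , tail) (suc u) (inj₂ (inj₁ p)) =
      proj₂ (properTail⇒properEnd j k κ j≢k tail) u (inj₂ (inj₁ (ℕ.suc-injective p)))
    end (k ∷ κ) (j≢k , tail) (suc u) (inj₂ (inj₂ p)) =
      proj₂ (properTail⇒properEnd j k κ j≢k tail) u (inj₂ (inj₂ (ℕ.suc-injective p)))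

  module _ (v i j : Fin m) {n : ℕ} (κ : Vec (Fin m) (suc n)) where

    ProperTwinned : Set
    ProperTwinned = (v ≢ i × (v ≢ j × i ≢ j)) × ProperTail w i j κ

    proper⇒properTwinned : Proper (twinnedPath (2 ℕ.+ n)) (w ∷ v ∷ i ∷ j ∷ κ) → ProperTwinned
    proper⇒properTwinned pr =
      (pr (suc zero) (suc (suc zero)) (inj₁ refl) , pr (suc zero) (suc (suc (suc zero))) (inj₂ (inj₁ refl)) , proj₁ tail) ,
      proj₂ tail
      where
      tail : i ≢ j × ProperTail w i j κ
      tail = properEnd⇒properTail i j κ
        ( (λ a b → pr (suc (suc a)) (suc (suc b)))
        , (λ { u (inj₁ p) → pr zero (suc (suc u)) (inj₁ (cong suc p)) ; u (inj₂ p) → pr zero (suc (suc u)) (inj₂ p) }))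

    properTwinned⇒proper : ProperTwinned → Proper (twinnedPath (2 ℕ.+ n)) (w ∷ v ∷ i ∷ j ∷ κ)
    properTwinned⇒proper ((v≢i , v≢j , i≢j) , tail) = proper
      where
      properEnd : ProperEnd (i ∷ j ∷ κ)
      properEnd = properTail⇒properEnd i j κ i≢j tail
      w≢ : ∀ u → suc u ≡ suc (fromℕ (2 ℕ.+ n)) ⊎ Adj (path (3 ℕ.+ n)) (fromℕ (2 ℕ.+ n)) u → w ≢ Vec.lookup (i ∷ j ∷ κ) u
      w≢ u (inj₁ p) = proj₂ properEnd u (inj₁ (Fin.suc-injective p))
      w≢ u (inj₂ p) = proj₂ properEnd u (inj₂ p)
      v≢ : ∀ u → u ≡ zero ⊎ Adj (path (3 ℕ.+ n)) zero u → v ≢ Vec.lookup (i ∷ j ∷ κ) u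
      v≢ zero          _ = v≢i
      v≢ (suc zero)    _ = v≢j
      v≢ (suc (suc u)) (inj₂ (inj₁ ()))
      v≢ (suc (suc u)) (inj₂ (inj₂ ()))
      -- The two twins would be adjacent only if the leaves were equal or neighbours, which at least
      -- three vertices on the path exclude.
      w′v′ : ¬ (zero ≡ suc (fromℕ (2 ℕ.+ n)) ⊎ (fromℕ (2 ℕ.+ n) ≡ zero ⊎ Adj (path (3 ℕ.+ n)) zero (fromℕ (2 ℕ.+ n))))
      w′v′ (inj₁ ())
      w′v′ (inj₂ (inj₁ ()))
      w′v′ (inj₂ (inj₂ (inj₁ ())))
      w′v′ (inj₂ (inj₂ (inj₂ ())))
      proper : Proper (twinnedPath (2 ℕ.+ n)) (w ∷ v ∷ i ∷ j ∷ κ)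
      proper zero          (suc zero)    p = contradiction p w′v′
      proper (suc zero)    zero          p = contradiction p w′v′
      proper zero          (suc (suc u)) p = w≢ u p
      proper (suc (suc u)) zero          p = ≢-sym (w≢ u p)
      proper (suc zero)    (suc (suc u)) p = v≢ u p
      proper (suc (suc u)) (suc zero)    p = ≢-sym (v≢ u p)
      proper (suc (suc a)) (suc (suc b)) p = proj₁ properEnd a b p

-- The chromatic symmetric function as a sum over words.

module Colourings (m : ℕ) where
  open ∑Series m
  open CommutativeRing (seriesRing m) using (_≈_; _*_; 0#; 1#; *-congˡ; *-congʳ; *-cong; *-identityˡ; zeroˡ; zeroʳ)
    renaming (refl to ≈-refl; sym to ≈-sym; trans to ≈-trans)

  -- Iterated `total`s, one per vertex, instead of one sum over a list: on the first four vertices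
  -- of the twinned path this unfolds to the shape of `twinnedPaths`.
  colourings : ∀ N → (Vec (Fin m) N → Series) → Series
  colourings zero    F = F []
  colourings (suc N) F = total (λ k → colourings N (λ κ → F (k ∷ κ)))

  colourings-cong : ∀ N {F G : Vec (Fin m) N → Series} → (∀ κ → F κ ≈ G κ) → colourings N F ≈ colourings N G
  colourings-cong zero    h = h []
  colourings-cong (suc N) h = total-cong λ k → colourings-cong N λ κ → h (k ∷ κ)

  colourings-*ˡ : ∀ N a F → colourings N (λ κ → a * F κ) ≈ a * colourings N F
  colourings-*ˡ zero    a F = ≈-refl
  colourings-*ˡ (suc N) a F =
    ≈-trans (total-cong λ k → colourings-*ˡ N a (λ κ → F (k ∷ κ))) (≈-sym (total-*ˡ a _))

  tailIndicator : ∀ {n} → Fin m → Fin m → Fin m → Vec (Fin m) n → Series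
  tailIndicator w i j []      = distinct w i * distinct w j
  tailIndicator w i j (k ∷ κ) = distinct j k * tailIndicator w j k κ

  colourings-tail : ∀ n w i j → colourings n (tailIndicator w i j) ≈ twinnedTail w n i j
  colourings-tail zero    w i j = ≈-refl
  colourings-tail (suc n) w i j = total-cong λ k →
    ≈-trans (colourings-*ˡ n (distinct j k) (tailIndicator w j k)) (*-congˡ {distinct j k} {colourings n (tailIndicator w j k)} (colourings-tail n w j k))

  -- Ties a proposition to a 0/1 series without naming a decision procedure. The exhaustive search
  -- `proper?` can then be replaced by a product of `distinct` factors on the strength of a logical
  -- equivalence alone.
  Indicates : Set → Series → Set
  Indicates P f = (P × f ≈ 1#) ⊎ (¬ P × f ≈ 0#)

  distinct-indicates : ∀ (i j : Fin m) → Indicates (i ≢ j) (distinct i j)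
  distinct-indicates i j with i Fin.≟ j
  ... | yes i≡j = inj₂ ((λ i≢j → i≢j i≡j) , ≈-refl)
  ... | no i≢j  = inj₁ (i≢j , ≈-refl)

  *-indicates : ∀ {P Q : Set} {f g} → Indicates P f → Indicates Q g → Indicates (P × Q) (f * g)
  *-indicates {f = f} {g} (inj₁ (p , f≈1)) (inj₁ (q , g≈1)) = inj₁ ((p , q) , ≈-trans (*-cong {f} {1#} {g} {1#} f≈1 g≈1) (*-identityˡ 1#))
  *-indicates {f = f} {g} (inj₁ _) (inj₂ (¬q , g≈0)) = inj₂ (¬q ∘ proj₂ , ≈-trans (*-congˡ {f} {g} {0#} g≈0) (zeroʳ f))
  *-indicates {f = f} {g} (inj₂ (¬p , f≈0)) _ = inj₂ (¬p ∘ proj₁ , ≈-trans (*-congʳ {g} {f} {0#} f≈0) (zeroˡ g))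

  indicatorₛ : Bool → Series
  indicatorₛ b = if b then 1ₛ else 0ₛ

  indicates⇒indicatorₛ : ∀ {P Q : Set} {f} → Indicates P f → (Q? : Dec Q) → (P → Q) → (Q → P) → indicatorₛ (does Q?) ≈ f
  indicates⇒indicatorₛ (inj₁ (p , f≈1))  (yes q) _  _  = ≈-sym f≈1
  indicates⇒indicatorₛ (inj₁ (p , f≈1))  (no ¬q) to _  = contradiction (to p) ¬q
  indicates⇒indicatorₛ (inj₂ (¬p , f≈0)) (yes q) _ from = contradiction (from q) ¬p
  indicates⇒indicatorₛ (inj₂ (¬p , f≈0)) (no _)  _  _  = ≈-sym f≈0

  tail-indicates : ∀ {n} w i j (κ : Vec (Fin m) n) → Indicates (ProperTail w i j κ) (tailIndicator w i j κ)
  tail-indicates w i j []      = *-indicates (distinct-indicates w i) (distinct-indicates w j)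
  tail-indicates w i j (k ∷ κ) = *-indicates (distinct-indicates j k) (tail-indicates w j k κ)

  colourings-twinnedPath : ∀ n →
    colourings (5 ℕ.+ n) (λ κ → indicatorₛ (does (proper? (twinnedPath (2 ℕ.+ n)) κ))) ≈ twinnedPaths (suc n)
  colourings-twinnedPath n = total-cong λ w → total-cong λ v → total-cong λ i → total-cong λ j → ≈-trans
    (colourings-cong (suc n) λ κ → indicates⇒indicatorₛ
      (*-indicates (*-indicates (distinct-indicates v i) (*-indicates (distinct-indicates v j) (distinct-indicates i j)))
        (tail-indicates w i j κ))
      (proper? (twinnedPath (2 ℕ.+ n)) (w ∷ v ∷ i ∷ j ∷ κ))
      (properTwinned⇒proper w v i j κ) (proper⇒properTwinned w v i j κ))
    (≈-trans (colourings-*ˡ (suc n) (K v i j) (tailIndicator w i j))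
      (*-congˡ {K v i j} (colourings-tail (suc n) w i j)))
    where
    K : Fin m → Fin m → Fin m → Series
    K v i j = distinct v i * (distinct v j * distinct i j)

  shift-sumℤ : ∀ {A : Set} (k : Fin m) (f : A → Series) xs α →
    shift k (λ β → sumℤ (map (λ x → f x β) xs)) α ≡ sumℤ (map (λ x → shift k (f x) α) xs)
  shift-sumℤ k f []       α = shift-0 k α
  shift-sumℤ k f (x ∷ xs) α = trans (shift-+ k (f x) _ α) (cong (ℤ._+_ (shift k (f x) α)) (shift-sumℤ k f xs α))

  shift-if : ∀ (k : Fin m) b f α → shift k (λ β → if b then f β else 0ℤ) α ≡ (if b then shift k f α else 0ℤ)
  shift-if k true  f α = refl
  shift-if k false f α = shift-0 k α

  -- Multiplying by a variable is a `shift`, and shifts commute with finite sums, so the weight of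
  -- each colouring can be pushed inside to become its `colourMonomial`.
  colourings-vectors : ∀ N (b : Vec (Fin m) N → Bool) α →
    colourings N (λ κ → indicatorₛ (b κ)) α
      ≡ sumℤ (map (λ κ → if b κ then colourMonomial κ α else 0ℤ) (vectors (allFin m) N))
  colourings-vectors zero b α with b []
  ... | true  = sym (ℤ.+-identityʳ _)
  ... | false = refl
  colourings-vectors (suc N) b α = begin
    total (λ k → colourings N (λ κ → indicatorₛ (b (k ∷ κ)))) α
      ≡⟨ ∑-coefficient (λ k → var k * colourings N (λ κ → indicatorₛ (b (k ∷ κ)))) α ⟩
    ∑ℤ.sum (λ k → (var k * colourings N (λ κ → indicatorₛ (b (k ∷ κ)))) α)
      ≡⟨ ∑ℤ.sum-cong-≗ (λ k → trans (var-*ₛ k _ α)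
           (trans (shift-cong k (colourings-vectors N (λ κ → b (k ∷ κ))) α)
             (trans (shift-sumℤ k (λ κ β → if b (k ∷ κ) then colourMonomial κ β else 0ℤ) (vectors (allFin m) N) α)
               (sumℤ-cong (λ κ → shift-if k (b (k ∷ κ)) (colourMonomial κ) α) (vectors (allFin m) N))))) ⟩
    ∑ℤ.sum (λ k → F k)
      ≡⟨ sym (sumℤ-tabulate F) ⟩
    sumℤ (tabulate F)
      ≡⟨ cong sumℤ (sym (List.map-tabulate id F)) ⟩
    sumℤ (map F (allFin m))
      ≡⟨ sym (sumℤ-cartesianProductWith (λ κ → if b κ then colourMonomial κ α else 0ℤ) _∷_ (allFin m) (vectors (allFin m) N)) ⟩
    sumℤ (map (λ κ → if b κ then colourMonomial κ α else 0ℤ) (vectors (allFin m) (suc N))) ∎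
    where
    F : Fin m → ℤ
    F k = sumℤ (map (λ κ → if b (k ∷ κ) then shift k (colourMonomial κ) α else 0ℤ) (vectors (allFin m) N))

X≡colourings : ∀ {N} (G : Graph N) α →
  X G α ≡ Colourings.colourings (length α) N (λ κ → if does (proper? G κ) then 1ₛ else 0ₛ) α
X≡colourings {N} G α = trans (length-filter _ (vectors (allFin (length α)) N))
  (trans (sumℤ-cong (λ κ → trans (indicator-∧ (does (proper? G κ)) _)
      (cong (if does (proper? G κ) then_else 0ℤ) (colourMonomial-hasWeight α κ))) (vectors (allFin (length α)) N))
    (sym (Colourings.colourings-vectors (length α) N (λ κ → does (proper? G κ)) α)))
  where
  indicator-∧ : ∀ a b → indicator (a ∧ b) ≡ (if a then indicator b else 0ℤ)
  indicator-∧ true  b = refl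
  indicator-∧ false b = refl

X-twinnedPath : ∀ n m → X (twinnedPath (2 ℕ.+ n)) ≈[ m ] ∑Series.twinnedPaths m (suc n)
X-twinnedPath n _ α refl =
  trans (X≡colourings (twinnedPath (2 ℕ.+ n)) α) (Colourings.colourings-twinnedPath (length α) n α refl)

-- Algebraic independence of e₁, ..., eₘ in m variables.

-- Polynomials over ℤ in e₁, …, eₘ: those in e₁, …, eₘ₊₁ are lists of
-- coefficients of the powers of eₘ₊₁.
Poly : ℕ → Set
Poly zero    = ℤ
Poly (suc m) = List (Poly m)

eval : ∀ m → Poly m → Series
eval zero    a       = a ·ₛ 1ₛ
eval (suc m) []      = 0ₛ
eval (suc m) (q ∷ p) = eval m q +ₛ (e (suc m) *ₛ eval (suc m) p)

-- coeff m p v is the coefficient of ∏ₖ eₖ^(v k).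
coeff : ∀ m → Poly m → (ℕ → ℕ) → ℤ
coeffAt : ∀ m → List (Poly m) → ℕ → (ℕ → ℕ) → ℤ
coeff zero    a v = a
coeff (suc m) p v = coeffAt m p (v (suc m)) v
coeffAt m []      j       v = 0ℤ
coeffAt m (q ∷ p) zero    v = coeff m q v
coeffAt m (q ∷ p) (suc j) v = coeffAt m p j v

*ₛ-congˡ : ∀ f {g h} → (∀ α → g α ≡ h α) → ∀ α → (f *ₛ g) α ≡ (f *ₛ h) α
*ₛ-congˡ f g≡h α = *ₛ-cong {length α} {f} (λ _ _ → refl) (λ β _ → g≡h β) α refl

*ₛ-zeroʳ : ∀ f α → (f *ₛ 0ₛ) α ≡ 0ℤ
*ₛ-zeroʳ f α = trans (*ₛ-comm f 0ₛ α) (*ₛ-zeroˡ f α)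

-- Lists may carry trailing zeros, so the zero polynomial has many representatives and vanishing is
-- asked of every coefficient.
IsZero : ∀ m → Poly m → Set
IsZero zero    a = a ≡ 0ℤ
IsZero (suc m) p = All (IsZero m) p

coeff-isZero : ∀ m p v → IsZero m p → coeff m p v ≡ 0ℤ
coeff-isZero zero    a v z = z
coeff-isZero (suc m) p v z = go p (v (suc m)) z
  where
  go : ∀ p j → All (IsZero m) p → coeffAt m p j v ≡ 0ℤ
  go []      j       []       = refl
  go (q ∷ p) zero    (z ∷ _)  = coeff-isZero m q v z
  go (q ∷ p) (suc j) (_ ∷ zs) = go p j zs

eval-isZero : ∀ m p → IsZero m p → ∀ α → eval m p α ≡ 0ℤ
eval-isZero zero    a       refl     α = refl
eval-isZero (suc m) []      []       α = refl
eval-isZero (suc m) (q ∷ p) (z ∷ zs) α = cong₂ ℤ._+_ (eval-isZero m q z α)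
  (trans (*ₛ-congˡ (e (suc m)) (eval-isZero (suc m) p zs) α) (*ₛ-zeroʳ (e (suc m)) α))

-- Setting a variable to 0 turns eₖ into eₖ of the remaining variables, hence leaves every
-- polynomial in the eₖ formally unchanged.
eval-0∷ : ∀ m p α → eval m p (0 ∷ α) ≡ eval m p α
eval-0∷ zero    a       α = refl
eval-0∷ (suc m) []      α = refl
eval-0∷ (suc m) (q ∷ p) α = cong₂ ℤ._+_ (eval-0∷ m q α)
  (trans (*ₛ-∷ (e (suc m)) (eval (suc m) p) 0 α) (*ₛ-congˡ (e (suc m)) (eval-0∷ (suc m) p) α))

e-short-*ₛ : ∀ {k} f α → length α < k → (e k *ₛ f) α ≡ 0ℤ
e-short-*ₛ {k} f α ∣α∣<k = trans
  (*ₛ-cong {length α} {e k} {0ₛ} {f} (λ β ∣β∣ → e-short β (ℕ.≤-<-trans (ℕ.≤-reflexive ∣β∣) ∣α∣<k)) (λ _ _ → refl) α refl)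
  (*ₛ-zeroˡ f α)

diag-first : ∀ n φ → (∀ i j → φ (suc i) j ≡ 0ℤ) → diag n φ ≡ φ 0 n
diag-first zero    φ h = refl
diag-first (suc n) φ h =
  trans (cong (ℤ._+_ (φ 0 (suc n))) (trans (diag-cong n h) (diag-0 n))) (ℤ.+-identityʳ _)

-- In m variables eₘ = x₁ ⋯ xₘ.
e-top-*ₛ : ∀ f α → (e (length α) *ₛ f) (map suc α) ≡ f α
e-top-*ₛ f []      = trans (*ₛ-[] (e 0) f) (ℤ.*-identityˡ (f []))
e-top-*ₛ f (a ∷ α) = begin
  (e (suc m) *ₛ f) (suc a ∷ map suc α)
    ≡⟨ *ₛ-∷ (e (suc m)) f (suc a) (map suc α) ⟩
  (e (suc m) *ₛ f ⟨ suc a ⟩) (map suc α) ℤ.+ diag a (λ i j → (e (suc m) ⟨ suc i ⟩ *ₛ f ⟨ j ⟩) (map suc α))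
    ≡⟨ cong₂ ℤ._+_ (e-short-*ₛ (f ⟨ suc a ⟩) (map suc α) (s≤s (ℕ.≤-reflexive (List.length-map suc α))))
         (diag-first a _ λ i j → *ₛ-zeroˡ (f ⟨ j ⟩) (map suc α)) ⟩
  0ℤ ℤ.+ (e m *ₛ f ⟨ a ⟩) (map suc α)
    ≡⟨ trans (ℤ.+-identityˡ _) (e-top-*ₛ (f ⟨ a ⟩) α) ⟩
  f (a ∷ α) ∎
  where
  m : ℕ
  m = length α

-- Setting one of the m + 1 variables to 0 kills eₘ₊₁ and isolates the constant
-- term q; what remains is divisible by eₘ₊₁, which is not a zero divisor.
eval-injective : ∀ m p → eval m p ≈[ m ] 0ₛ → IsZero m p
eval-injective zero    a       h = trans (sym (ℤ.*-identityʳ a)) (h [] refl)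
eval-injective (suc m) []      h = []
eval-injective (suc m) (q ∷ p) h = zq ∷ eval-injective (suc m) p zp
  where
  E : Series
  E = e (suc m) *ₛ eval (suc m) p
  zq : IsZero m q
  zq = eval-injective m q λ β ∣β∣ → begin
    eval m q β                   ≡⟨ sym (eval-0∷ m q β) ⟩
    eval m q (0 ∷ β)             ≡⟨ sym (ℤ.+-identityʳ _) ⟩
    eval m q (0 ∷ β) ℤ.+ 0ℤ
      ≡⟨ cong (ℤ._+_ (eval m q (0 ∷ β))) (sym (trans (*ₛ-∷ (e (suc m)) (eval (suc m) p) 0 β)
           (e-short-*ₛ _ β (s≤s (ℕ.≤-reflexive ∣β∣))))) ⟩
    eval m q (0 ∷ β) ℤ.+ E (0 ∷ β) ≡⟨ h (0 ∷ β) (cong suc ∣β∣) ⟩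
    0ℤ                           ∎
  zp : eval (suc m) p ≈[ suc m ] 0ₛ
  zp α ∣α∣ = begin
    eval (suc m) p α
      ≡⟨ sym (e-top-*ₛ (eval (suc m) p) α) ⟩
    (e (length α) *ₛ eval (suc m) p) (map suc α)
      ≡⟨ cong (λ k → (e k *ₛ eval (suc m) p) (map suc α)) ∣α∣ ⟩
    E (map suc α)
      ≡⟨ sym (ℤ.+-identityˡ _) ⟩
    0ℤ ℤ.+ E (map suc α)
      ≡⟨ cong (ℤ._+ E (map suc α)) (sym (eval-isZero m q zq (map suc α))) ⟩
    eval m q (map suc α) ℤ.+ E (map suc α)
      ≡⟨ h (map suc α) (trans (List.length-map suc α) ∣α∣) ⟩
    0ℤ ∎

-- Arithmetic of polynomials in the eₖ.

infixl 6 _⊞_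
infixr 7 _⊡_

0ₚ 1ₚ : ∀ {m} → Poly m
0ₚ {zero}  = 0ℤ
0ₚ {suc m} = []
1ₚ {zero}  = 1ℤ
1ₚ {suc m} = 1ₚ ∷ []

_⊞_ : ∀ {m} → Poly m → Poly m → Poly m
_⊞_ {zero}  a       b       = a ℤ.+ b
_⊞_ {suc m} []      q       = q
_⊞_ {suc m} (a ∷ p) []      = a ∷ p
_⊞_ {suc m} (a ∷ p) (b ∷ q) = (a ⊞ b) ∷ (p ⊞ q)

_⊡_ : ∀ {m} → ℤ → Poly m → Poly m
_⊡_ {zero}  c a       = c ℤ.* a
_⊡_ {suc m} c []      = []
_⊡_ {suc m} c (a ∷ p) = (c ⊡ a) ∷ (c ⊡ p)

-- Multiplication by eₖ, with a junk value unless 1 ≤ k ≤ m.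
mulE : ∀ m → ℕ → Poly m → Poly m
mulE zero    k a = 0ℤ
mulE (suc m) k p with k ℕ.≟ suc m
... | yes _ = 0ₚ ∷ p
... | no  _ = map (mulE m k) p

eval-0ₚ : ∀ m α → eval m 0ₚ α ≡ 0ℤ
eval-0ₚ zero    α = refl
eval-0ₚ (suc m) α = refl

eval-1ₚ : ∀ m α → eval m 1ₚ α ≡ 1ₛ α
eval-1ₚ zero    α = ℤ.*-identityˡ (1ₛ α)
eval-1ₚ (suc m) α = trans (cong₂ ℤ._+_ (eval-1ₚ m α) (*ₛ-zeroʳ (e (suc m)) α)) (ℤ.+-identityʳ _)

eval-⊞ : ∀ m p q α → eval m (p ⊞ q) α ≡ eval m p α ℤ.+ eval m q α
eval-⊞ zero    a       b       α = ℤ.*-distribʳ-+ (1ₛ α) a b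
eval-⊞ (suc m) []      q       α = sym (ℤ.+-identityˡ _)
eval-⊞ (suc m) (a ∷ p) []      α = sym (ℤ.+-identityʳ _)
eval-⊞ (suc m) (a ∷ p) (b ∷ q) α = trans
  (cong₂ ℤ._+_ (eval-⊞ m a b α)
    (trans (*ₛ-congˡ (e (suc m)) (eval-⊞ (suc m) p q) α)
      (*ₛ-distribˡ (e (suc m)) (eval (suc m) p) (eval (suc m) q) α)))
  (lemma (eval m a α) (eval m b α) _ _)
  where
  lemma : ∀ a b c d → (a ℤ.+ b) ℤ.+ (c ℤ.+ d) ≡ (a ℤ.+ c) ℤ.+ (b ℤ.+ d)
  lemma = ℤ.solve-∀

*ₛ-·ₛ : ∀ a f g α → (f *ₛ (a ·ₛ g)) α ≡ a ℤ.* (f *ₛ g) α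
*ₛ-·ₛ a f g α = trans (*ₛ-comm f (a ·ₛ g) α) (trans (·ₛ-*ₛ a g f α) (cong (ℤ._*_ a) (*ₛ-comm g f α)))

eval-⊡ : ∀ m c p α → eval m (c ⊡ p) α ≡ c ℤ.* eval m p α
eval-⊡ zero    c a       α = ℤ.*-assoc c a (1ₛ α)
eval-⊡ (suc m) c []      α = sym (ℤ.*-zeroʳ c)
eval-⊡ (suc m) c (a ∷ p) α = trans
  (cong₂ ℤ._+_ (eval-⊡ m c a α)
    (trans (*ₛ-congˡ (e (suc m)) (eval-⊡ (suc m) c p) α) (*ₛ-·ₛ c (e (suc m)) (eval (suc m) p) α)))
  (sym (ℤ.*-distribˡ-+ c (eval m a α) _))

*ₛ-leftComm : ∀ f g h α → (f *ₛ (g *ₛ h)) α ≡ (g *ₛ (f *ₛ h)) α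
*ₛ-leftComm f g h α = begin
  (f *ₛ (g *ₛ h)) α ≡⟨ sym (*ₛ-assoc f g h α) ⟩
  ((f *ₛ g) *ₛ h) α ≡⟨ *ₛ-cong {length α} {f *ₛ g} {g *ₛ f} {h} (λ β _ → *ₛ-comm f g β) (λ _ _ → refl) α refl ⟩
  ((g *ₛ f) *ₛ h) α ≡⟨ *ₛ-assoc g f h α ⟩
  (g *ₛ (f *ₛ h)) α ∎

eval-mulE : ∀ m k p → 1 ≤ k → k ≤ m → ∀ α → eval m (mulE m k p) α ≡ (e k *ₛ eval m p) α
eval-mulE zero    (suc k) a _ ()
eval-mulE (suc m) k p 1≤k k≤1+m α with k ℕ.≟ suc m
... | yes refl  = trans (cong (ℤ._+ (e (suc m) *ₛ eval (suc m) p) α) (eval-0ₚ m α)) (ℤ.+-identityˡ _)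
... | no  k≢1+m = go p α
  where
  go : ∀ p α → eval (suc m) (map (mulE m k) p) α ≡ (e k *ₛ eval (suc m) p) α
  go []      α = sym (*ₛ-zeroʳ (e k) α)
  go (q ∷ p) α = begin
    eval m (mulE m k q) α ℤ.+ (e (suc m) *ₛ eval (suc m) (map (mulE m k) p)) α
      ≡⟨ cong₂ ℤ._+_ (eval-mulE m k q 1≤k (ℕ.≤-pred (ℕ.≤∧≢⇒< k≤1+m k≢1+m)) α)
           (trans (*ₛ-congˡ (e (suc m)) (go p) α) (*ₛ-leftComm (e (suc m)) (e k) (eval (suc m) p) α)) ⟩
    (e k *ₛ eval m q) α ℤ.+ (e k *ₛ (e (suc m) *ₛ eval (suc m) p)) α
      ≡⟨ sym (*ₛ-distribˡ (e k) (eval m q) (e (suc m) *ₛ eval (suc m) p) α) ⟩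
    (e k *ₛ eval (suc m) (q ∷ p)) α ∎

coeff-0ₚ : ∀ m v → coeff m 0ₚ v ≡ 0ℤ
coeff-0ₚ zero    v = refl
coeff-0ₚ (suc m) v = refl

coeff-1ₚ : ∀ m v → (∀ k → 1 ≤ k → v k ≡ 0) → coeff m 1ₚ v ≡ 1ℤ
coeff-1ₚ zero    v v≡0 = refl
coeff-1ₚ (suc m) v v≡0 rewrite v≡0 (suc m) (s≤s z≤n) = coeff-1ₚ m v v≡0

coeff-1ₚ-≢0 : ∀ m v k → 1 ≤ k → k ≤ m → v k ≢ 0 → coeff m 1ₚ v ≡ 0ℤ
coeff-1ₚ-≢0 zero    v (suc k) _ () vk≢0
coeff-1ₚ-≢0 (suc m) v k 1≤k k≤1+m vk≢0 with v (suc m) in v≡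
... | suc _ = refl
... | zero  = coeff-1ₚ-≢0 m v k 1≤k (ℕ.≤-pred (ℕ.≤∧≢⇒< k≤1+m λ { refl → vk≢0 v≡ })) vk≢0

coeff-⊞ : ∀ m p q v → coeff m (p ⊞ q) v ≡ coeff m p v ℤ.+ coeff m q v
coeff-⊞ zero    a b v = refl
coeff-⊞ (suc m) p q v = go p q (v (suc m))
  where
  go : ∀ p q j → coeffAt m (p ⊞ q) j v ≡ coeffAt m p j v ℤ.+ coeffAt m q j v
  go []      q       j       = sym (ℤ.+-identityˡ _)
  go (a ∷ p) []      j       = sym (ℤ.+-identityʳ _)
  go (a ∷ p) (b ∷ q) zero    = coeff-⊞ m a b v
  go (a ∷ p) (b ∷ q) (suc j) = go p q j

coeff-⊡ : ∀ m c p v → coeff m (c ⊡ p) v ≡ c ℤ.* coeff m p v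
coeff-⊡ zero    c a v = refl
coeff-⊡ (suc m) c p v = go p (v (suc m))
  where
  go : ∀ p j → coeffAt m (c ⊡ p) j v ≡ c ℤ.* coeffAt m p j v
  go []      j       = sym (ℤ.*-zeroʳ c)
  go (a ∷ p) zero    = coeff-⊡ m c a v
  go (a ∷ p) (suc j) = go p j

coeff-cong : ∀ m p {v w} → (∀ k → k ≤ m → v k ≡ w k) → coeff m p v ≡ coeff m p w
coeffAt-cong : ∀ m p j {v w} → (∀ k → k ≤ m → v k ≡ w k) → coeffAt m p j v ≡ coeffAt m p j w
coeff-cong zero    a v≡w = refl
coeff-cong (suc m) p {v} v≡w rewrite sym (v≡w (suc m) ℕ.≤-refl) =
  coeffAt-cong m p (v (suc m)) λ k k≤m → v≡w k (ℕ.m≤n⇒m≤1+n k≤m)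
coeffAt-cong m []      j       v≡w = refl
coeffAt-cong m (q ∷ p) zero    v≡w = coeff-cong m q v≡w
coeffAt-cong m (q ∷ p) (suc j) v≡w = coeffAt-cong m p j v≡w

coeff-mulE-0 : ∀ m k p v → v k ≡ 0 → coeff m (mulE m k p) v ≡ 0ℤ
coeff-mulE-0 zero    k a v vk≡0 = refl
coeff-mulE-0 (suc m) k p v vk≡0 with k ℕ.≟ suc m
... | yes refl rewrite vk≡0 = coeff-0ₚ m v
... | no  _    = go p (v (suc m))
  where
  go : ∀ p j → coeffAt m (map (mulE m k) p) j v ≡ 0ℤ
  go []      j       = refl
  go (q ∷ p) zero    = coeff-mulE-0 m k q v vk≡0
  go (q ∷ p) (suc j) = go p j

-- Here w is the exponent vector v divided by eₖ. Levels above k of the nested lists are traversed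
-- unchanged; at level k the multiplication is a cons, which shifts the exponent by one.
coeff-mulE-suc : ∀ m k p {v w} → 1 ≤ k → k ≤ m → v k ≡ suc (w k) → (∀ i → i ≢ k → v i ≡ w i) →
  coeff m (mulE m k p) v ≡ coeff m p w
coeff-mulE-suc zero    (suc k) a _ () vk≡ v≡w
coeff-mulE-suc (suc m) k p {v} {w} 1≤k k≤1+m vk≡ v≡w with k ℕ.≟ suc m
... | yes refl rewrite vk≡ = coeffAt-cong m p (w (suc m)) λ i i≤m → v≡w i (ℕ.<⇒≢ (s≤s i≤m))
... | no  k≢1+m rewrite v≡w (suc m) (≢-sym k≢1+m) = go p (w (suc m))
  where
  go : ∀ p j → coeffAt m (map (mulE m k) p) j v ≡ coeffAt m p j w
  go []      j       = refl
  go (q ∷ p) zero    = coeff-mulE-suc m k q 1≤k (ℕ.≤-pred (ℕ.≤∧≢⇒< k≤1+m k≢1+m)) vk≡ v≡w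
  go (q ∷ p) (suc j) = go p j

-- The path and the twinned path as polynomials in the eₖ.

module _ (m : ℕ) where

  -- The formula `paths-suc` turned into a definition. Unrolling its sum with an offset k, rather
  -- than calling `diag`, keeps the recursion structural.
  pathPoly : ℕ → Poly m
  pathTail : ℕ → ℕ → Poly m
  pathPoly zero    = 1ₚ
  pathPoly (suc n) = pathTail n 0 ⊞ mulE m (suc n) 1ₚ
  -- ∑_{i + j = n} (i + k) e_{i+k+1} pathPoly j
  pathTail zero    k = + k ⊡ mulE m (suc k) (pathPoly 0)
  pathTail (suc n) k = (+ k ⊡ mulE m (suc k) (pathPoly (suc n))) ⊞ pathTail n (suc k)

  -- With P₂ = 2 e₂ the coefficients 4, -4, 1 of the overview become 4, -8, 4. The path underneath
  -- has n + 3 vertices.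
  twinnedPoly : ℕ → Poly m
  twinnedPoly n = + 4 ⊡ pathPoly (5 ℕ.+ n)
    ⊞ (ℤ.- + 8) ⊡ mulE m 2 (pathPoly (3 ℕ.+ n))
    ⊞ + 4 ⊡ mulE m 2 (mulE m 2 (pathPoly (1 ℕ.+ n)))

  open ∑Series m
  open CommutativeRing (seriesRing m) using (_≈_; *-congʳ; *-congˡ)

  eval-mulE-cong : ∀ k p f → 1 ≤ k → k ≤ m → eval m p ≈ f → eval m (mulE m k p) ≈ e k *ₛ f
  eval-mulE-cong k p f 1≤k k≤m p≈f α ∣α∣ =
    trans (eval-mulE m k p 1≤k k≤m α) (*-congˡ {e k} {eval m p} {f} p≈f α ∣α∣)

  eval-term : ∀ k p f → k < m → eval m p ≈ f → eval m (+ k ⊡ mulE m (suc k) p) ≈ (+ k ·ₛ e (suc k)) *ₛ f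
  eval-term k p f k<m p≈f α ∣α∣ = begin
    eval m (+ k ⊡ mulE m (suc k) p) α   ≡⟨ eval-⊡ m (+ k) (mulE m (suc k) p) α ⟩
    + k ℤ.* eval m (mulE m (suc k) p) α ≡⟨ cong (ℤ._*_ (+ k)) (eval-mulE-cong (suc k) p f (s≤s z≤n) k<m p≈f α ∣α∣) ⟩
    + k ℤ.* (e (suc k) *ₛ f) α          ≡⟨ sym (·ₛ-*ₛ (+ k) (e (suc k)) f α) ⟩
    ((+ k ·ₛ e (suc k)) *ₛ f) α         ∎

  -- The bound on n keeps every eₖ that occurs within k ≤ m, where `mulE` really is multiplication
  -- by eₖ.
  eval-pathPoly : ∀ n → n ≤ m → eval m (pathPoly n) ≈ paths n
  eval-pathTail : ∀ n k → n ℕ.+ k < m →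
    eval m (pathTail n k) ≈ diagₛ n (λ i j → (+ (i ℕ.+ k) ·ₛ e (suc (i ℕ.+ k))) *ₛ paths j)
  eval-pathPoly zero    _   α ∣α∣ = eval-1ₚ m α
  eval-pathPoly (suc n) n<m α ∣α∣ = begin
    eval m (pathPoly (suc n)) α
      ≡⟨ eval-⊞ m (pathTail n 0) (mulE m (suc n) 1ₚ) α ⟩
    eval m (pathTail n 0) α ℤ.+ eval m (mulE m (suc n) 1ₚ) α
      ≡⟨ cong₂ ℤ._+_
           (trans (eval-pathTail n 0 (subst (_< m) (sym (ℕ.+-identityʳ n)) n<m) α ∣α∣)
             (diagₛ-cong n {λ i j → (+ (i ℕ.+ 0) ·ₛ e (suc (i ℕ.+ 0))) *ₛ paths j}
               (λ i j α _ → cong (λ k → ((+ k ·ₛ e (suc k)) *ₛ paths j) α) (ℕ.+-identityʳ i)) α ∣α∣))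
           (trans (eval-mulE-cong (suc n) 1ₚ 1ₛ (s≤s z≤n) n<m (λ α _ → eval-1ₚ m α) α ∣α∣)
             (trans (*ₛ-comm (e (suc n)) 1ₛ α) (*ₛ-identityˡ (e (suc n)) α))) ⟩
    diagₛ n (λ k j → (+ k ·ₛ e (suc k)) *ₛ paths j) α ℤ.+ e (suc n) α
      ≡⟨ sym (paths-suc n α ∣α∣) ⟩
    paths (suc n) α ∎
  eval-pathTail zero    k k<m = eval-term k (pathPoly 0) (paths 0) k<m (eval-pathPoly 0 z≤n)
  eval-pathTail (suc n) k k<m α ∣α∣ = trans
    (eval-⊞ m (+ k ⊡ mulE m (suc k) (pathPoly (suc n))) (pathTail n (suc k)) α)
    (cong₂ ℤ._+_
      (eval-term k (pathPoly (suc n)) (paths (suc n)) (ℕ.m+n≤o⇒n≤o (suc n) (ℕ.≤-trans (ℕ.≤-reflexive (ℕ.+-suc (suc n) k)) k<m))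
        (eval-pathPoly (suc n) (ℕ.m+n≤o⇒m≤o (suc n) (ℕ.<⇒≤ k<m))) α ∣α∣)
      (trans (eval-pathTail n (suc k) (subst (_< m) (sym (ℕ.+-suc n k)) k<m) α ∣α∣)
        (diagₛ-cong n {λ i j → (+ (i ℕ.+ suc k) ·ₛ e (suc (i ℕ.+ suc k))) *ₛ paths j}
          (λ i j α _ → cong (λ k → ((+ k ·ₛ e (suc k)) *ₛ paths j) α) (ℕ.+-suc i k)) α ∣α∣)))

  paths₂ : paths 2 ≈ + 2 ·ₛ e 2
  paths₂ α ∣α∣ = begin
    paths 2 α
      ≡⟨ paths-suc 1 α ∣α∣ ⟩
    (((+ 0 ·ₛ e 1) *ₛ paths 1) α ℤ.+ ((+ 1 ·ₛ e 2) *ₛ 1ₛ) α) ℤ.+ e 2 α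
      ≡⟨ cong (ℤ._+ e 2 α) (cong₂ ℤ._+_ (·ₛ-*ₛ (+ 0) (e 1) (paths 1) α)
           (trans (·ₛ-*ₛ (+ 1) (e 2) 1ₛ α) (cong (ℤ._*_ (+ 1)) (trans (*ₛ-comm (e 2) 1ₛ α) (*ₛ-identityˡ (e 2) α))))) ⟩
    (0ℤ ℤ.+ + 1 ℤ.* e 2 α) ℤ.+ e 2 α
      ≡⟨ lemma (e 2 α) ⟩
    + 2 ℤ.* e 2 α ∎
    where
    lemma : ∀ x → (0ℤ ℤ.+ + 1 ℤ.* x) ℤ.+ x ≡ + 2 ℤ.* x
    lemma = ℤ.solve-∀

  paths₂-* : ∀ f → paths 2 *ₛ f ≈ + 2 ·ₛ (e 2 *ₛ f)
  paths₂-* f α ∣α∣ = trans (*-congʳ {f} {paths 2} {+ 2 ·ₛ e 2} paths₂ α ∣α∣) (·ₛ-*ₛ (+ 2) (e 2) f α)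

  eval-twinnedPoly : ∀ n → 5 ℕ.+ n ≤ m → eval m (twinnedPoly n) ≈ twinnedPaths (suc n)
  eval-twinnedPoly n 5+n≤m α ∣α∣ = begin
    eval m (twinnedPoly n) α
      ≡⟨ trans (eval-⊞ m (+ 4 ⊡ P₅ ⊞ (ℤ.- + 8) ⊡ mulE m 2 P₃) (+ 4 ⊡ mulE m 2 (mulE m 2 P₁)) α)
           (cong₂ ℤ._+_
             (trans (eval-⊞ m (+ 4 ⊡ P₅) ((ℤ.- + 8) ⊡ mulE m 2 P₃) α)
               (cong₂ ℤ._+_ (eval-⊡ m (+ 4) P₅ α) (eval-⊡ m (ℤ.- + 8) (mulE m 2 P₃) α)))
             (eval-⊡ m (+ 4) (mulE m 2 (mulE m 2 P₁)) α)) ⟩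
    (+ 4 ℤ.* eval m P₅ α ℤ.+ (ℤ.- + 8) ℤ.* eval m (mulE m 2 P₃) α) ℤ.+ + 4 ℤ.* eval m (mulE m 2 (mulE m 2 P₁)) α
      ≡⟨ cong₂ (λ x y → x ℤ.+ + 4 ℤ.* y)
           (cong₂ (λ x y → + 4 ℤ.* x ℤ.+ (ℤ.- + 8) ℤ.* y) (eval-pathPoly (5 ℕ.+ n) 5+n≤m α ∣α∣)
             (eval-mulE-cong 2 P₃ (paths (3 ℕ.+ n)) (s≤s z≤n) 2≤m
               (eval-pathPoly (3 ℕ.+ n) (ℕ.≤-trans (ℕ.m≤n+m _ 2) 5+n≤m)) α ∣α∣))
           (eval-mulE-cong 2 (mulE m 2 P₁) (e 2 *ₛ paths (1 ℕ.+ n)) (s≤s z≤n) 2≤m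
             (eval-mulE-cong 2 P₁ (paths (1 ℕ.+ n)) (s≤s z≤n) 2≤m
               (eval-pathPoly (1 ℕ.+ n) (ℕ.≤-trans (ℕ.m≤n+m _ 4) 5+n≤m))) α ∣α∣) ⟩
    (+ 4 ℤ.* p ℤ.+ (ℤ.- + 8) ℤ.* q) ℤ.+ + 4 ℤ.* r
      -- The identity `twinnedPaths-paths` reads t + 8 q = 4 p + 4 r after inserting P₂ = 2 e₂;
      -- `lemma` solves it for t.
      ≡⟨ lemma t p q r (begin
           t ℤ.+ (+ 2 ℤ.* q ℤ.+ + 2 ℤ.* q ℤ.+ (+ 2 ℤ.* q ℤ.+ + 2 ℤ.* q))
             ≡⟨ cong (λ x → t ℤ.+ (x ℤ.+ x ℤ.+ (x ℤ.+ x))) (sym (paths₂-* (paths (3 ℕ.+ n)) α ∣α∣)) ⟩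
           _
             ≡⟨ twinnedPaths-paths n α ∣α∣ ⟩
           (p ℤ.+ p ℤ.+ (p ℤ.+ p)) ℤ.+ (paths 2 *ₛ (paths 2 *ₛ paths (1 ℕ.+ n))) α
             ≡⟨ cong (ℤ._+_ (p ℤ.+ p ℤ.+ (p ℤ.+ p))) r≡ ⟩
           (p ℤ.+ p ℤ.+ (p ℤ.+ p)) ℤ.+ + 2 ℤ.* (+ 2 ℤ.* r) ∎) ⟩
    t ∎
    where
    P₁ P₃ P₅ : Poly m
    P₁ = pathPoly (1 ℕ.+ n)
    P₃ = pathPoly (3 ℕ.+ n)
    P₅ = pathPoly (5 ℕ.+ n)
    2≤m : 2 ≤ m
    2≤m = ℕ.≤-trans (s≤s (s≤s z≤n)) 5+n≤m
    t p q r : ℤ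
    t = twinnedPaths (suc n) α
    p = paths (5 ℕ.+ n) α
    q = (e 2 *ₛ paths (3 ℕ.+ n)) α
    r = (e 2 *ₛ (e 2 *ₛ paths (1 ℕ.+ n))) α
    r≡ : (paths 2 *ₛ (paths 2 *ₛ paths (1 ℕ.+ n))) α ≡ + 2 ℤ.* (+ 2 ℤ.* r)
    r≡ = trans (paths₂-* (paths 2 *ₛ paths (1 ℕ.+ n)) α ∣α∣)
      (cong (ℤ._*_ (+ 2)) (trans
        (*-congˡ {e 2} {paths 2 *ₛ paths (1 ℕ.+ n)} {+ 2 ·ₛ (e 2 *ₛ paths (1 ℕ.+ n))} (paths₂-* (paths (1 ℕ.+ n))) α ∣α∣)
        (*ₛ-·ₛ (+ 2) (e 2) (e 2 *ₛ paths (1 ℕ.+ n)) α)))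
    lemma : ∀ t p q r →
      t ℤ.+ (+ 2 ℤ.* q ℤ.+ + 2 ℤ.* q ℤ.+ (+ 2 ℤ.* q ℤ.+ + 2 ℤ.* q)) ≡ (p ℤ.+ p ℤ.+ (p ℤ.+ p)) ℤ.+ + 2 ℤ.* (+ 2 ℤ.* r) →
      (+ 4 ℤ.* p ℤ.+ (ℤ.- + 8) ℤ.* q) ℤ.+ + 4 ℤ.* r ≡ t
    lemma t p q r eq = trans (regroup p q r) (trans (cong (ℤ._+ ((ℤ.- + 8) ℤ.* q)) (sym eq)) (cancel t q))
      where
      regroup : ∀ p q r → (+ 4 ℤ.* p ℤ.+ (ℤ.- + 8) ℤ.* q) ℤ.+ + 4 ℤ.* r
        ≡ ((p ℤ.+ p ℤ.+ (p ℤ.+ p)) ℤ.+ + 2 ℤ.* (+ 2 ℤ.* r)) ℤ.+ (ℤ.- + 8) ℤ.* q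
      regroup = ℤ.solve-∀
      cancel : ∀ t q → (t ℤ.+ (+ 2 ℤ.* q ℤ.+ + 2 ℤ.* q ℤ.+ (+ 2 ℤ.* q ℤ.+ + 2 ℤ.* q))) ℤ.+ (ℤ.- + 8) ℤ.* q ≡ t
      cancel = ℤ.solve-∀

-- Multisets of parts as exponent vectors.

mult : List ℕ → ℕ → ℕ
mult []       i = 0
mult (k ∷ xs) i = if does (k ℕ.≟ i) then suc (mult xs i) else mult xs i

mult-≡ : ∀ k xs → mult (k ∷ xs) k ≡ suc (mult xs k)
mult-≡ k xs = cong (if_then suc (mult xs k) else mult xs k) (dec-true (k ℕ.≟ k) refl)

mult-≢ : ∀ {k i} xs → k ≢ i → mult (k ∷ xs) i ≡ mult xs i
mult-≢ {k} {i} xs k≢i = cong (if_then suc (mult xs i) else mult xs i) (dec-false (k ℕ.≟ i) k≢i)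

mult-↭ : ∀ {xs ys} → xs ↭ ys → ∀ i → mult xs i ≡ mult ys i
mult-↭ Perm.refl i = refl
mult-↭ (prep k p) i = cong (λ n → if does (k ℕ.≟ i) then suc n else n) (mult-↭ p i)
mult-↭ (swap k l p) i with does (k ℕ.≟ i) | does (l ℕ.≟ i)
... | true  | true  = cong (λ n → suc (suc n)) (mult-↭ p i)
... | true  | false = cong suc (mult-↭ p i)
... | false | true  = cong suc (mult-↭ p i)
... | false | false = mult-↭ p i
mult-↭ (Perm.trans p q) i = trans (mult-↭ p i) (mult-↭ q i)

extract : ∀ k xs → mult xs k ≢ 0 → ∃[ ys ] xs ↭ k ∷ ys
extract k []       ≢0 = contradiction refl ≢0
extract k (x ∷ xs) ≢0 with x ℕ.≟ k
... | yes refl = xs , ↭-refl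
... | no x≢k with ys , p ← extract k xs (λ ≡0 → ≢0 (trans (mult-≢ xs x≢k) ≡0)) =
  x ∷ ys , ↭-trans (prep x p) (swap x k ↭-refl)

module _ (m : ℕ) where

  coeff-mulE-↭ : ∀ k p {xs ys} → 1 ≤ k → k ≤ m → xs ↭ k ∷ ys →
    coeff m (mulE m k p) (mult xs) ≡ coeff m p (mult ys)
  coeff-mulE-↭ k p {xs} {ys} 1≤k k≤m xs↭ = coeff-mulE-suc m k p 1≤k k≤m
    (trans (mult-↭ xs↭ k) (mult-≡ k ys)) (λ i i≢k → trans (mult-↭ xs↭ i) (mult-≢ ys (≢-sym i≢k)))

  wordPoly : List ℕ → Poly m
  wordPoly = foldr (mulE m) 1ₚ

  InRange : ℕ → Set
  InRange k = 1 ≤ k × k ≤ m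

  eval-wordPoly : ∀ w → All InRange w → ∀ α → eval m (wordPoly w) α ≡ foldr _*ₛ_ 1ₛ (map e w) α
  eval-wordPoly []      []                  α = eval-1ₚ m α
  eval-wordPoly (k ∷ w) ((1≤k , k≤m) ∷ rng) α =
    trans (eval-mulE m k (wordPoly w) 1≤k k≤m α) (*ₛ-congˡ (e k) (eval-wordPoly w rng) α)

  coeff-wordPoly : ∀ w → All InRange w → coeff m (wordPoly w) (mult w) ≡ 1ℤ
  coeff-wordPoly []      []                  = coeff-1ₚ m (λ _ → 0) (λ _ _ → refl)
  coeff-wordPoly (k ∷ w) ((1≤k , k≤m) ∷ rng) =
    trans (coeff-mulE-↭ k (wordPoly w) {k ∷ w} {w} 1≤k k≤m ↭-refl) (coeff-wordPoly w rng)

  -- Cancel the first letter k of w against an occurrence in xs. If there is none the coefficient is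
  -- 0 already; otherwise the shorter lists are still not permutations of each other.
  coeff-wordPoly-≢ : ∀ w xs → All InRange w → All InRange xs → ¬ (w ↭ xs) → coeff m (wordPoly w) (mult xs) ≡ 0ℤ
  coeff-wordPoly-≢ [] []       _ _ ¬↭ = contradiction ↭-refl ¬↭
  coeff-wordPoly-≢ [] (x ∷ xs) _ ((1≤x , x≤m) ∷ _) ¬↭ = coeff-1ₚ-≢0 m (mult (x ∷ xs)) x 1≤x x≤m
    λ ≡0 → contradiction (trans (sym ≡0) (mult-≡ x xs)) λ ()
  coeff-wordPoly-≢ (k ∷ w) xs ((1≤k , k≤m) ∷ rng) rng′ ¬↭ with mult xs k ℕ.≟ 0
  ... | yes ≡0 = coeff-mulE-0 m k (wordPoly w) (mult xs) ≡0
  ... | no  ≢0 with ys , xs↭ ← extract k xs ≢0 = trans (coeff-mulE-↭ k (wordPoly w) 1≤k k≤m xs↭)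
    (coeff-wordPoly-≢ w ys rng (All.tail (Perm.All-resp-↭ xs↭ rng′)) λ w↭ys → ¬↭ (↭-trans (prep k w↭ys) (↭-sym xs↭)))

-- Compositions, partitions and uniqueness of the expansion in the e-basis.

decreasing-head : ∀ {x xs y} → Linked _≥_ (x ∷ xs) → y ∈ x ∷ xs → y ≤ x
decreasing-head d = All.lookup (Linked.Linked⇒All (λ p q → ℕ.≤-trans q p) ℕ.≤-refl d)

decreasing-↭ : ∀ {xs ys} → Linked _≥_ xs → Linked _≥_ ys → xs ↭ ys → xs ≡ ys
decreasing-↭ {[]}     {[]}     _  _  p = refl
decreasing-↭ {[]}     {y ∷ ys} _  _  p with () ← Perm.∈-resp-↭ (↭-sym p) (here {xs = ys} refl)
decreasing-↭ {x ∷ xs} {[]}     _  _  p with () ← Perm.∈-resp-↭ p (here {xs = xs} refl)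
decreasing-↭ {x ∷ xs} {y ∷ ys} dx dy p
  with refl ← ℕ.≤-antisym (decreasing-head dy (Perm.∈-resp-↭ p (here refl))) (decreasing-head dx (Perm.∈-resp-↭ (↭-sym p) (here refl))) =
  cong (x ∷_) (decreasing-↭ (Linked.tail dx) (Linked.tail dy) (Perm.drop-∷ p))

IsComposition : ℕ → List ℕ → Set
IsComposition n w = All NonZero w × sum w ≡ n

sumℤ-zero : ∀ {A : Set} {P : A → Set} (g : A → ℤ) → (∀ x → P x → g x ≡ 0ℤ) → ∀ {xs} → All P xs → sumℤ (map g xs) ≡ 0ℤ
sumℤ-zero g g≡0 []         = refl
sumℤ-zero g g≡0 (px ∷ pxs) = cong₂ ℤ._+_ (g≡0 _ px) (sumℤ-zero g g≡0 pxs)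

sumℤ-concatMap : ∀ {A B : Set} (g : B → ℤ) (h : A → List B) xs →
  sumℤ (map g (concatMap h xs)) ≡ sumℤ (map (λ x → sumℤ (map g (h x))) xs)
sumℤ-concatMap g h []       = refl
sumℤ-concatMap g h (x ∷ xs) = trans (cong sumℤ (List.map-++ g (h x) (concatMap h xs)))
  (trans (sumℤ-++ (map g (h x)) _) (cong (ℤ._+_ (sumℤ (map g (h x)))) (sumℤ-concatMap g h xs)))

sumℤ-mapMaybe : ∀ {A B : Set} (g : B → ℤ) (h : A → Maybe B) xs →
  sumℤ (map g (mapMaybe h xs)) ≡ sumℤ (map (λ x → maybe g 0ℤ (h x)) xs)
sumℤ-mapMaybe g h []       = refl
sumℤ-mapMaybe g h (x ∷ xs) with h x
... | just y  = cong (ℤ._+_ (g y)) (sumℤ-mapMaybe g h xs)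
... | nothing = trans (sumℤ-mapMaybe g h xs) (sym (ℤ.+-identityˡ _))

compositions-sound : ∀ n → All (IsComposition n) (compositions n)
compositions-sound zero    = ([] , refl) ∷ []
compositions-sound (suc n) = All.++⁺
  (All.map⁺ (All.map (λ (pos , ∑≡n) → (_ ∷ pos) , cong suc ∑≡n) (compositions-sound n)))
  (All.concat⁺ (All.map⁺ (All.map (λ {w} → increment w) (compositions-sound n))))
  where
  increment : ∀ w → IsComposition n w → All (IsComposition (suc n)) (incrementHead w)
  increment []       _                = []
  increment (x ∷ xs) (_ ∷ pos , ∑≡n) = (_ ∷ pos , cong suc ∑≡n) ∷ []

-- Expresses through sums that xs occurs exactly once in `compositions n`. A first entry 1 arises
-- only by prepending, a larger one only by incrementing the head of a shorter total's composition,
-- so induction on n applies to one half of the list and the other half contributes 0.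
sumℤ-compositions : ∀ n xs (g : List ℕ → ℤ) → IsComposition n xs →
  (∀ w → IsComposition n w → w ≢ xs → g w ≡ 0ℤ) → sumℤ (map g (compositions n)) ≡ g xs
sumℤ-compositions zero    []               g _ _ = ℤ.+-identityʳ (g [])
sumℤ-compositions zero    (suc x ∷ xs)     g (_ , ()) _
sumℤ-compositions (suc n) []               g (_ , ()) _
sumℤ-compositions zero    (zero ∷ xs)      g (() ∷ _ , _) _
sumℤ-compositions (suc n) (zero ∷ xs)      g (() ∷ _ , _) _
sumℤ-compositions (suc n) (suc x ∷ xs) g (_ ∷ pos , ∑≡) g≡0 = begin
  sumℤ (map g (map (1 ∷_) C ++ concatMap incrementHead C))
    ≡⟨ cong sumℤ (List.map-++ g (map (1 ∷_) C) _) ⟩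
  sumℤ (map g (map (1 ∷_) C) ++ map g (concatMap incrementHead C))
    ≡⟨ sumℤ-++ (map g (map (1 ∷_) C)) _ ⟩
  sumℤ (map g (map (1 ∷_) C)) ℤ.+ sumℤ (map g (concatMap incrementHead C))
    ≡⟨ cong₂ ℤ._+_ (cong sumℤ (sym (List.map-∘ C))) (sumℤ-concatMap g incrementHead C) ⟩
  sumℤ (map (λ w → g (1 ∷ w)) C) ℤ.+ sumℤ (map h C)
    ≡⟨ select x xs pos (ℕ.suc-injective ∑≡) g≡0 ⟩
  g (suc x ∷ xs) ∎
  where
  C : List (List ℕ)
  C = compositions n
  h : List ℕ → ℤ
  h w = sumℤ (map g (incrementHead w))
  select : ∀ x xs → All NonZero xs → x ℕ.+ sum xs ≡ n →
    (∀ w → IsComposition (suc n) w → w ≢ suc x ∷ xs → g w ≡ 0ℤ) →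
    sumℤ (map (λ w → g (1 ∷ w)) C) ℤ.+ sumℤ (map h C) ≡ g (suc x ∷ xs)
  select zero xs pos ∑≡ g≡0 = trans
    (cong₂ ℤ._+_
      (sumℤ-compositions n xs (λ w → g (1 ∷ w)) (pos , ∑≡)
        λ w (pos , ∑≡) w≢ → g≡0 (1 ∷ w) (_ ∷ pos , cong suc ∑≡) (w≢ ∘ List.∷-injectiveʳ))
      (sumℤ-zero h h≡0 (compositions-sound n)))
    (ℤ.+-identityʳ _)
    where
    h≡0 : ∀ w → IsComposition n w → h w ≡ 0ℤ
    h≡0 []           _                 = refl
    h≡0 (zero ∷ w)   (() ∷ _ , _)
    h≡0 (suc y ∷ w)  (_ ∷ pos , ∑≡)    = trans (ℤ.+-identityʳ _) (g≡0 _ (_ ∷ pos , cong suc ∑≡) λ ())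
  select (suc x) xs pos ∑≡ g≡0 = trans
    (cong₂ ℤ._+_
      (sumℤ-zero _ (λ w (pos , ∑≡) → g≡0 (1 ∷ w) (_ ∷ pos , cong suc ∑≡) λ ()) (compositions-sound n))
      (trans (sumℤ-compositions n (suc x ∷ xs) h (_ ∷ pos , ∑≡) h≡0) (ℤ.+-identityʳ (g (suc (suc x) ∷ xs)))))
    (ℤ.+-identityˡ (g (suc (suc x) ∷ xs)))
    where
    h≡0 : ∀ w → IsComposition n w → w ≢ suc x ∷ xs → h w ≡ 0ℤ
    h≡0 []      _                _  = refl
    h≡0 (y ∷ w) (_ ∷ pos , ∑≡) w≢ = trans (ℤ.+-identityʳ _)
      (g≡0 (suc y ∷ w) (_ ∷ pos , cong suc ∑≡) λ { refl → w≢ refl })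

asPartition-parts : ∀ w {μ} → asPartition w ≡ just μ → parts μ ≡ w
asPartition-parts w eq with linked? ℕ._≥?_ w | all? ℕ.nonZero? w | eq
... | yes _ | yes _ | refl = refl

nonZero-irrelevant : ∀ {n} (p q : NonZero n) → p ≡ q
nonZero-irrelevant {suc n} _ _ = refl

asPartition-partition : ∀ μ → asPartition (parts μ) ≡ just μ
asPartition-partition (partition xs d p) with linked? ℕ._≥?_ xs | all? ℕ.nonZero? xs
... | yes d′ | yes p′ = cong₂ (λ d p → just (partition xs d p))
  (Linked.irrelevant ℕ.≤-irrelevant d′ d) (All.irrelevant nonZero-irrelevant p′ p)
... | no ¬d  | _      = contradiction d ¬d
... | yes _  | no ¬p  = contradiction p ¬p

composition-inRange : ∀ {n} w → IsComposition n w → All (InRange n) w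
composition-inRange w (pos , refl) = go w pos ℕ.≤-refl
  where
  go : ∀ {n} w → All NonZero w → sum w ≤ n → All (InRange n) w
  go []      []          _   = []
  go (k ∷ w) (pos ∷ poss) ∑≤n =
    (ℕ.>-nonZero⁻¹ k {{pos}} , ℕ.m+n≤o⇒m≤o k ∑≤n) ∷ go w poss (ℕ.m+n≤o⇒n≤o k ∑≤n)

partitionsOf-sound : ∀ n → All (λ μ → IsComposition n (parts μ)) (partitionsOf n)
partitionsOf-sound n = go (compositions n) (compositions-sound n)
  where
  go : ∀ ws → All (IsComposition n) ws → All (λ μ → IsComposition n (parts μ)) (mapMaybe asPartition ws)
  go []       []         = []
  go (w ∷ ws) (pw ∷ pws) with asPartition w in eq
  ... | just μ  = subst (IsComposition n) (sym (asPartition-parts w eq)) pw ∷ go ws pws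
  ... | nothing = go ws pws

module _ (c : Partition → ℤ) (N : ℕ) where

  ePoly : List Partition → Poly N
  ePoly = foldr (λ μ p → (c μ ⊡ wordPoly N (parts μ)) ⊞ p) 0ₚ

  eval-ePoly : ∀ μs → All (λ μ → IsComposition N (parts μ)) μs → ∀ α →
    eval N (ePoly μs) α ≡ ∑ₛ μs (λ μ → c μ ·ₛ e[ μ ]) α
  eval-ePoly []       []       α = eval-0ₚ N α
  eval-ePoly (μ ∷ μs) (p ∷ ps) α = trans (eval-⊞ N (c μ ⊡ wordPoly N (parts μ)) (ePoly μs) α)
    (cong₂ ℤ._+_
      (trans (eval-⊡ N (c μ) (wordPoly N (parts μ)) α)
        (cong (ℤ._*_ (c μ)) (eval-wordPoly N (parts μ) (composition-inRange (parts μ) p) α)))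
      (eval-ePoly μs ps α))

  coeff-ePoly : ∀ μs v → coeff N (ePoly μs) v ≡ sumℤ (map (λ μ → c μ ℤ.* coeff N (wordPoly N (parts μ)) v) μs)
  coeff-ePoly []       v = coeff-0ₚ N v
  coeff-ePoly (μ ∷ μs) v = trans (coeff-⊞ N (c μ ⊡ wordPoly N (parts μ)) (ePoly μs) v)
    (cong₂ ℤ._+_ (coeff-⊡ N (c μ) (wordPoly N (parts μ)) v) (coeff-ePoly μs v))

  -- The sum over `partitionsOf N` is pulled back to compositions, of which only the decreasing list
  -- `parts μ` contributes: another decreasing list is not a permutation of it.
  coeff-ePoly-partition : ∀ μ → sum (parts μ) ≡ N → coeff N (ePoly (partitionsOf N)) (mult (parts μ)) ≡ c μ
  coeff-ePoly-partition μ ∑μ≡N = begin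
    coeff N (ePoly (partitionsOf N)) (mult (parts μ))
      ≡⟨ coeff-ePoly (partitionsOf N) (mult (parts μ)) ⟩
    sumℤ (map g (partitionsOf N))
      ≡⟨ sumℤ-mapMaybe g asPartition (compositions N) ⟩
    sumℤ (map (λ w → maybe g 0ℤ (asPartition w)) (compositions N))
      ≡⟨ sumℤ-compositions N (parts μ) _ comp vanish ⟩
    maybe g 0ℤ (asPartition (parts μ))
      ≡⟨ cong (maybe g 0ℤ) (asPartition-partition μ) ⟩
    c μ ℤ.* coeff N (wordPoly N (parts μ)) (mult (parts μ))
      ≡⟨ cong (ℤ._*_ (c μ)) (coeff-wordPoly N (parts μ) (composition-inRange (parts μ) comp)) ⟩
    c μ ℤ.* 1ℤ
      ≡⟨ ℤ.*-identityʳ (c μ) ⟩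
    c μ ∎
    where
    g : Partition → ℤ
    g ν = c ν ℤ.* coeff N (wordPoly N (parts ν)) (mult (parts μ))
    comp : IsComposition N (parts μ)
    comp = positive μ , ∑μ≡N
    vanish : ∀ w → IsComposition N w → w ≢ parts μ → maybe g 0ℤ (asPartition w) ≡ 0ℤ
    vanish w pw w≢μ with asPartition w in eq
    ... | nothing = refl
    ... | just ν with refl ← asPartition-parts w eq = trans
      (cong (ℤ._*_ (c ν)) (coeff-wordPoly-≢ N (parts ν) (parts μ)
        (composition-inRange (parts ν) pw) (composition-inRange (parts μ) comp)
        λ ν↭μ → w≢μ (decreasing-↭ (decreasing ν) (decreasing μ) ν↭μ)))
      (ℤ.*-zeroʳ (c ν))

  -- The difference of q and the polynomial form of `eSeries c N` evaluates to 0 in N variables, so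
  -- by independence all its coefficients vanish.
  coeff-unique : (q : Poly N) → eval N q ≈[ N ] eSeries c N → ∀ μ → sum (parts μ) ≡ N →
    c μ ≡ coeff N q (mult (parts μ))
  coeff-unique q q≈ μ ∑μ≡N = begin
    c μ
      ≡⟨ sym (coeff-ePoly-partition μ ∑μ≡N) ⟩
    coeff N p v
      ≡⟨ lemma (coeff N p v) (coeff N q v) ⟩
    (coeff N p v ℤ.+ (ℤ.- 1ℤ) ℤ.* coeff N q v) ℤ.+ coeff N q v
      ≡⟨ cong (λ z → coeff N p v ℤ.+ z ℤ.+ coeff N q v) (sym (coeff-⊡ N (ℤ.- 1ℤ) q v)) ⟩
    (coeff N p v ℤ.+ coeff N ((ℤ.- 1ℤ) ⊡ q) v) ℤ.+ coeff N q v
      ≡⟨ cong (ℤ._+ coeff N q v) (sym (coeff-⊞ N p ((ℤ.- 1ℤ) ⊡ q) v)) ⟩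
    coeff N (p ⊞ (ℤ.- 1ℤ) ⊡ q) v ℤ.+ coeff N q v
      ≡⟨ cong (ℤ._+ coeff N q v) (coeff-isZero N (p ⊞ (ℤ.- 1ℤ) ⊡ q) v (eval-injective N _ vanishes)) ⟩
    0ℤ ℤ.+ coeff N q v
      ≡⟨ ℤ.+-identityˡ _ ⟩
    coeff N q v ∎
    where
    p : Poly N
    p = ePoly (partitionsOf N)
    v : ℕ → ℕ
    v = mult (parts μ)
    lemma : ∀ a b → a ≡ (a ℤ.+ (ℤ.- 1ℤ) ℤ.* b) ℤ.+ b
    lemma = ℤ.solve-∀
    vanishes : eval N (p ⊞ (ℤ.- 1ℤ) ⊡ q) ≈[ N ] 0ₛ
    vanishes α ∣α∣ = begin
      eval N (p ⊞ (ℤ.- 1ℤ) ⊡ q) α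
        ≡⟨ trans (eval-⊞ N p ((ℤ.- 1ℤ) ⊡ q) α) (cong (ℤ._+_ (eval N p α)) (eval-⊡ N (ℤ.- 1ℤ) q α)) ⟩
      eval N p α ℤ.+ (ℤ.- 1ℤ) ℤ.* eval N q α
        ≡⟨ cong₂ (λ a b → a ℤ.+ (ℤ.- 1ℤ) ℤ.* b) (eval-ePoly (partitionsOf N) (partitionsOf-sound N) α) (q≈ α ∣α∣) ⟩
      eSeries c N α ℤ.+ (ℤ.- 1ℤ) ℤ.* eSeries c N α
        ≡⟨ trans (cong (ℤ._+_ (eSeries c N α)) (ℤ.-1*i≡-i (eSeries c N α))) (ℤ.+-inverseʳ (eSeries c N α)) ⟩
      0ℤ ∎

-- The numbers c as coefficients of the twinned path polynomial.

module _ (c : Partition → ℤ) (c-𝒳 : IsECoefficientOf c 𝒳) where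

  coefficient-large : ∀ n μ {xs} → parts μ ↭ xs → sum xs ≡ 5 ℕ.+ n →
    c μ ≡ coeff (5 ℕ.+ n) (twinnedPoly (5 ℕ.+ n) n) (mult xs)
  coefficient-large n μ μ↭xs ∑xs = trans
    (coeff-unique c (5 ℕ.+ n) (twinnedPoly (5 ℕ.+ n) n)
      (λ α ∣α∣ → trans (eval-twinnedPoly (5 ℕ.+ n) n ℕ.≤-refl α ∣α∣)
        (trans (sym (X-twinnedPath n (5 ℕ.+ n) α ∣α∣)) (c-𝒳 (5 ℕ.+ n) α)))
      μ (trans (sum-↭ μ↭xs) ∑xs))
    (coeff-cong (5 ℕ.+ n) (twinnedPoly (5 ℕ.+ n) n) λ k _ → mult-↭ μ↭xs k)

  coefficient-small : ∀ μ → sum (parts μ) < 5 → c μ ≡ 0ℤ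
  coefficient-small μ ∑<5 = trans
    (coeff-unique c (sum (parts μ)) 0ₚ
      (λ α _ → trans (eval-0ₚ (sum (parts μ)) α) (trans (sym (𝒳-small (sum (parts μ)) ∑<5 α)) (c-𝒳 (sum (parts μ)) α)))
      μ refl)
    (coeff-0ₚ (sum (parts μ)) (mult (parts μ)))
    where
    𝒳-small : ∀ N → N < 5 → ∀ α → 𝒳 N α ≡ 0ℤ
    𝒳-small 0 _ α = refl
    𝒳-small 1 _ α = refl
    𝒳-small 2 _ α = refl
    𝒳-small 3 _ α = refl
    𝒳-small 4 _ α = refl
    𝒳-small (suc (suc (suc (suc (suc N))))) (s≤s (s≤s (s≤s (s≤s (s≤s ()))))) α

-- Coefficients of the path.

diag-single : ∀ n φ d → d ≤ n → (∀ i j → i ≢ d → φ i j ≡ 0ℤ) → diag n φ ≡ φ d (n ∸ d)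
diag-single n       φ zero    _         φ≡0 = diag-first n φ λ i j → φ≡0 (suc i) j λ ()
diag-single (suc n) φ (suc d) (s≤s d≤n) φ≡0 = trans
  (cong₂ ℤ._+_ (φ≡0 0 (suc n) λ ())
    (diag-single n (λ i → φ (suc i)) d d≤n λ i j i≢d → φ≡0 (suc i) j (i≢d ∘ ℕ.suc-injective)))
  (ℤ.+-identityˡ _)

diag-double : ∀ n φ a b → a ≢ b → a ≤ n → b ≤ n → (∀ i j → i ≢ a → i ≢ b → φ i j ≡ 0ℤ) →
  diag n φ ≡ φ a (n ∸ a) ℤ.+ φ b (n ∸ b)
diag-double n       φ zero    zero    a≢b _ _ _ = contradiction refl a≢b
diag-double (suc n) φ zero    (suc b) a≢b _ (s≤s b≤n) φ≡0 = cong (ℤ._+_ (φ 0 (suc n)))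
  (diag-single n (λ i → φ (suc i)) b b≤n λ i j i≢b → φ≡0 (suc i) j (λ ()) (i≢b ∘ ℕ.suc-injective))
diag-double (suc n) φ (suc a) zero    a≢b (s≤s a≤n) _ φ≡0 = trans
  (cong (ℤ._+_ (φ 0 (suc n)))
    (diag-single n (λ i → φ (suc i)) a a≤n λ i j i≢a → φ≡0 (suc i) j (i≢a ∘ ℕ.suc-injective) (λ ())))
  (ℤ.+-comm (φ 0 (suc n)) _)
diag-double (suc n) φ (suc a) (suc b) a≢b (s≤s a≤n) (s≤s b≤n) φ≡0 = trans
  (cong₂ ℤ._+_ (φ≡0 0 (suc n) (λ ()) (λ ()))
    (diag-double n (λ i → φ (suc i)) a b (a≢b ∘ cong suc) a≤n b≤n
      λ i j i≢a i≢b → φ≡0 (suc i) j (i≢a ∘ ℕ.suc-injective) (i≢b ∘ ℕ.suc-injective)))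
  (ℤ.+-identityˡ _)

module PathCoefficients (m : ℕ) where

  -- The degree is read off from xs, while the number m of variables stays fixed, so that the
  -- recursion can pass to shorter lists without changing the ambient `Poly m`.
  pathCoeff : List ℕ → ℤ
  pathCoeff xs = coeff m (pathPoly m (sum xs)) (mult xs)

  pathCoeff-↭ : ∀ {xs ys} → xs ↭ ys → pathCoeff xs ≡ pathCoeff ys
  pathCoeff-↭ {xs} {ys} p = trans
    (cong (λ n → coeff m (pathPoly m n) (mult xs)) (sum-↭ p))
    (coeff-cong m (pathPoly m (sum ys)) λ k _ → mult-↭ p k)

  term : List ℕ → ℕ → ℕ → ℤ
  term xs k j = + k ℤ.* coeff m (mulE m (suc k) (pathPoly m j)) (mult xs)

  coeff-pathTail : ∀ xs n k → coeff m (pathTail m n k) (mult xs) ≡ diag n (λ i j → term xs (i ℕ.+ k) j)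
  coeff-pathTail xs zero    k = coeff-⊡ m (+ k) (mulE m (suc k) 1ₚ) (mult xs)
  coeff-pathTail xs (suc n) k = trans
    (coeff-⊞ m (+ k ⊡ mulE m (suc k) (pathPoly m (suc n))) (pathTail m n (suc k)) (mult xs))
    (cong₂ ℤ._+_ (coeff-⊡ m (+ k) (mulE m (suc k) (pathPoly m (suc n))) (mult xs))
      (trans (coeff-pathTail xs n (suc k)) (diag-cong n λ i j → cong (λ k → term xs k j) (ℕ.+-suc i k))))

  coeff-pathPoly : ∀ xs n →
    coeff m (pathPoly m (suc n)) (mult xs) ≡ diag n (term xs) ℤ.+ coeff m (mulE m (suc n) 1ₚ) (mult xs)
  coeff-pathPoly xs n = trans (coeff-⊞ m (pathTail m n 0) (mulE m (suc n) 1ₚ) (mult xs))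
    (cong (ℤ._+ coeff m (mulE m (suc n) 1ₚ) (mult xs))
      (trans (coeff-pathTail xs n 0) (diag-cong n λ i j → cong (λ k → term xs k j) (ℕ.+-identityʳ i))))

  -- The summand k eₖ₊₁ Pⱼ with k = 0 has factor 0, so a part 1 never contributes; any other summand
  -- needs k + 1 to be a part.
  term-0 : ∀ xs k j → (k ≢ 0 → mult xs (suc k) ≡ 0) → term xs k j ≡ 0ℤ
  term-0 xs zero    j _  = refl
  term-0 xs (suc k) j ≡0 = trans
    (cong (ℤ._*_ (+ suc k)) (coeff-mulE-0 m (suc (suc k)) (pathPoly m j) (mult xs) (≡0 λ ())))
    (ℤ.*-zeroʳ (+ suc k))

  term-↭ : ∀ {xs} k ys → suc k ≤ m → xs ↭ suc k ∷ ys → term xs k (k ℕ.+ sum ys ∸ k) ≡ + k ℤ.* pathCoeff ys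
  term-↭ k ys k<m xs↭ = cong (ℤ._*_ (+ k)) (trans
    (cong (λ j → coeff m (mulE m (suc k) (pathPoly m j)) _) (ℕ.m+n∸m≡n k (sum ys)))
    (coeff-mulE-↭ m (suc k) (pathPoly m (sum ys)) (s≤s z≤n) k<m xs↭))

  pathCoeff-[] : pathCoeff [] ≡ 1ℤ
  pathCoeff-[] = coeff-1ₚ m (mult []) λ _ _ → refl

  -- Both pieces of the recursion contribute: k from k eₖ₊₁ P₀ and 1 from the separate summand eₖ₊₁.
  pathCoeff-[-] : ∀ k → suc k ≤ m → pathCoeff (suc k ∷ []) ≡ + suc k
  pathCoeff-[-] k k<m = begin
    pathCoeff (suc k ∷ [])
      ≡⟨ coeff-pathPoly (suc k ∷ []) (k ℕ.+ 0) ⟩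
    diag (k ℕ.+ 0) (term (suc k ∷ [])) ℤ.+ coeff m (mulE m (suc (k ℕ.+ 0)) 1ₚ) (mult (suc k ∷ []))
      ≡⟨ cong₂ ℤ._+_
           (trans (diag-single (k ℕ.+ 0) (term (suc k ∷ [])) k (ℕ.m≤m+n k 0)
               λ i j i≢k → term-0 (suc k ∷ []) i j λ _ → mult-≢ {suc k} {suc i} [] (i≢k ∘ sym ∘ ℕ.suc-injective))
             (term-↭ k [] k<m ↭-refl))
           (trans (cong (λ n → coeff m (mulE m (suc n) 1ₚ) (mult (suc k ∷ []))) (ℕ.+-identityʳ k))
             (coeff-mulE-↭ m (suc k) 1ₚ {suc k ∷ []} {[]} (s≤s z≤n) k<m ↭-refl)) ⟩
    + k ℤ.* pathCoeff [] ℤ.+ coeff m 1ₚ (mult [])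
      ≡⟨ cong₂ (λ a b → + k ℤ.* a ℤ.+ b) pathCoeff-[] (coeff-1ₚ m (mult []) λ _ _ → refl) ⟩
    + k ℤ.* 1ℤ ℤ.+ 1ℤ
      ≡⟨ trans (cong (ℤ._+ 1ℤ) (ℤ.*-identityʳ (+ k))) (ℤ.+-comm (+ k) 1ℤ) ⟩
    + suc k ∎

  -- Every positive part is 1 or k + 1, so only the summand at k survives in the sum. The separate
  -- summand eₙ₊₁ drops out because the nonzero part y makes the total exceed k + 1.
  pathCoeff-single : ∀ {xs} k y ys → suc k ≤ m → .{{NonZero y}} → xs ↭ suc k ∷ y ∷ ys →
    (∀ i → i ≢ 0 → i ≢ k → mult xs (suc i) ≡ 0) →
    pathCoeff xs ≡ + k ℤ.* pathCoeff (y ∷ ys)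
  pathCoeff-single {xs} k y@(suc _) ys k<m xs↭ ≡0 = begin
    pathCoeff xs
      ≡⟨ cong (λ n → coeff m (pathPoly m n) (mult xs)) (sum-↭ xs↭) ⟩
    coeff m (pathPoly m (suc n)) (mult xs)
      ≡⟨ coeff-pathPoly xs n ⟩
    diag n (term xs) ℤ.+ coeff m (mulE m (suc n) 1ₚ) (mult xs)
      ≡⟨ cong₂ ℤ._+_
           (trans (diag-single n (term xs) k (ℕ.m≤m+n k _) λ i j i≢k → term-0 xs i j λ i≢0 → ≡0 i i≢0 i≢k)
             (term-↭ k (y ∷ ys) k<m xs↭))
           (coeff-mulE-0 m (suc n) 1ₚ (mult xs) (≡0 n (ℕ.m+1+n≢0 k) (ℕ.m+1+n≢m k))) ⟩
    + k ℤ.* pathCoeff (y ∷ ys) ℤ.+ 0ℤ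
      ≡⟨ ℤ.+-identityʳ _ ⟩
    + k ℤ.* pathCoeff (y ∷ ys) ∎
    where
    n : ℕ
    n = k ℕ.+ sum (y ∷ ys)

  pathCoeff-double : ∀ {xs} a y ys b z zs → a ≢ b → suc a ≤ m → suc b ≤ m → .{{NonZero y}} → .{{NonZero z}} →
    xs ↭ suc a ∷ y ∷ ys → xs ↭ suc b ∷ z ∷ zs →
    (∀ i → i ≢ 0 → i ≢ a → i ≢ b → mult xs (suc i) ≡ 0) →
    pathCoeff xs ≡ + a ℤ.* pathCoeff (y ∷ ys) ℤ.+ + b ℤ.* pathCoeff (z ∷ zs)
  pathCoeff-double {xs} a y@(suc _) ys b z@(suc _) zs a≢b a<m b<m xs↭a xs↭b ≡0 = begin
    pathCoeff xs
      ≡⟨ cong (λ n → coeff m (pathPoly m n) (mult xs)) (sum-↭ xs↭a) ⟩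
    coeff m (pathPoly m (suc n)) (mult xs)
      ≡⟨ coeff-pathPoly xs n ⟩
    diag n (term xs) ℤ.+ coeff m (mulE m (suc n) 1ₚ) (mult xs)
      ≡⟨ cong₂ ℤ._+_
           (diag-double n (term xs) a b a≢b (ℕ.m≤m+n a _) (subst (b ≤_) (sym n≡) (ℕ.m≤m+n b _))
             λ i j i≢a i≢b → term-0 xs i j λ i≢0 → ≡0 i i≢0 i≢a i≢b)
           (coeff-mulE-0 m (suc n) 1ₚ (mult xs) (≡0 n (ℕ.m+1+n≢0 a) (ℕ.m+1+n≢m a)
             (λ n≡b → ℕ.m+1+n≢m b (trans (sym n≡) n≡b)))) ⟩
    term xs a (n ∸ a) ℤ.+ term xs b (n ∸ b) ℤ.+ 0ℤ
      ≡⟨ ℤ.+-identityʳ _ ⟩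
    term xs a (n ∸ a) ℤ.+ term xs b (n ∸ b)
      ≡⟨ cong₂ ℤ._+_ (term-↭ a (y ∷ ys) a<m xs↭a)
           (trans (cong (λ n → term xs b (n ∸ b)) n≡) (term-↭ b (z ∷ zs) b<m xs↭b)) ⟩
    + a ℤ.* pathCoeff (y ∷ ys) ℤ.+ + b ℤ.* pathCoeff (z ∷ zs) ∎
    where
    n : ℕ
    n = a ℕ.+ sum (y ∷ ys)
    n≡ : n ≡ b ℕ.+ sum (z ∷ zs)
    n≡ = ℕ.suc-injective (trans (sym (sum-↭ xs↭a)) (sum-↭ xs↭b))

  coeff-mulE-vanishes : ∀ k p {v} → 1 ≤ k → k ≤ m →
    (∀ w → v k ≡ suc (w k) → (∀ i → i ≢ k → v i ≡ w i) → coeff m p w ≡ 0ℤ) →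
    coeff m (mulE m k p) v ≡ 0ℤ
  coeff-mulE-vanishes k p {v} 1≤k k≤m ≡0 with v k in vk
  ... | zero  = coeff-mulE-0 m k p v vk
  ... | suc j = trans (coeff-mulE-suc m k p 1≤k k≤m vk′ v≡w) (≡0 w (cong suc (sym wk)) v≡w)
    where
    w : ℕ → ℕ
    w i = if does (i ℕ.≟ k) then j else v i
    wk : w k ≡ j
    wk = cong (if_then j else v k) (dec-true (k ℕ.≟ k) refl)
    vk′ : v k ≡ suc (w k)
    vk′ = trans vk (cong suc (sym wk))
    v≡w : ∀ i → i ≢ k → v i ≡ w i
    v≡w i i≢k = sym (cong (if_then j else v i) (dec-false (i ℕ.≟ k) i≢k))

  coeff-mulE-11 : ∀ k p → 2 ≤ k → k ≤ m → (∀ v → 2 ≤ v 1 → coeff m p v ≡ 0ℤ) →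
    ∀ v → 2 ≤ v 1 → coeff m (mulE m k p) v ≡ 0ℤ
  coeff-mulE-11 k p 2≤k k≤m ≡0 v 2≤v = coeff-mulE-vanishes k p (ℕ.≤-trans (s≤s z≤n) 2≤k) k≤m
    λ w _ v≡w → ≡0 w (subst (2 ≤_) (v≡w 1 (ℕ.<⇒≢ 2≤k)) 2≤v)

  -- Multiplication by e₁ occurs only for k = 0, where the factor k is 0; for larger k the degree in
  -- e₁ does not grow.
  coeff-term-11 : ∀ k p → k < m → (∀ v → 2 ≤ v 1 → coeff m p v ≡ 0ℤ) →
    ∀ v → 2 ≤ v 1 → coeff m (+ k ⊡ mulE m (suc k) p) v ≡ 0ℤ
  coeff-term-11 zero    p k<m ≡0 v 2≤v = coeff-⊡ m 0ℤ (mulE m 1 p) v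
  coeff-term-11 (suc k) p k<m ≡0 v 2≤v = trans (coeff-⊡ m (+ suc k) (mulE m (suc (suc k)) p) v)
    (trans (cong (ℤ._*_ (+ suc k)) (coeff-mulE-11 (suc (suc k)) p (s≤s (s≤s z≤n)) k<m ≡0 v 2≤v)) (ℤ.*-zeroʳ (+ suc k)))

  module _ (1≤m : 1 ≤ m) where

    coeff-1ₚ-1 : ∀ v → v 1 ≢ 0 → coeff m 1ₚ v ≡ 0ℤ
    coeff-1ₚ-1 v v≢0 = coeff-1ₚ-≢0 m v 1 ℕ.≤-refl 1≤m v≢0

    coeff-e-11 : ∀ n → n < m → ∀ v → 2 ≤ v 1 → coeff m (mulE m (suc n) 1ₚ) v ≡ 0ℤ
    coeff-e-11 zero    n<m v 2≤v = coeff-mulE-vanishes 1 1ₚ (s≤s z≤n) n<m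
      λ w v≡ _ → coeff-1ₚ-1 w (ℕ.m<n⇒n≢0 (ℕ.≤-pred (subst (2 ≤_) v≡ 2≤v)))
    coeff-e-11 (suc n) n<m = coeff-mulE-11 (suc (suc n)) 1ₚ (s≤s (s≤s z≤n)) n<m
      λ v 2≤v → coeff-1ₚ-1 v (ℕ.m<n⇒n≢0 2≤v)

    -- Path polynomials have degree at most one in e₁: the sum in the recursion effectively
    -- multiplies only by eₖ₊₁ with k ≥ 1, and e₁ itself enters just as the separate summand of P₁.
    coeff-pathPoly-11 : ∀ n → n ≤ m → ∀ v → 2 ≤ v 1 → coeff m (pathPoly m n) v ≡ 0ℤ
    coeff-pathTail-11 : ∀ n k → n ℕ.+ k < m → ∀ v → 2 ≤ v 1 → coeff m (pathTail m n k) v ≡ 0ℤ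
    coeff-pathPoly-11 zero    _   v 2≤v = coeff-1ₚ-1 v (ℕ.m<n⇒n≢0 2≤v)
    coeff-pathPoly-11 (suc n) n<m v 2≤v = trans (coeff-⊞ m (pathTail m n 0) (mulE m (suc n) 1ₚ) v)
      (cong₂ ℤ._+_ (coeff-pathTail-11 n 0 (subst (_< m) (sym (ℕ.+-identityʳ n)) n<m) v 2≤v) (coeff-e-11 n n<m v 2≤v))
    coeff-pathTail-11 zero    k k<m = coeff-term-11 k (pathPoly m 0) k<m (coeff-pathPoly-11 0 z≤n)
    coeff-pathTail-11 (suc n) k k<m v 2≤v = trans
      (coeff-⊞ m (+ k ⊡ mulE m (suc k) (pathPoly m (suc n))) (pathTail m n (suc k)) v)
      (cong₂ ℤ._+_
        (coeff-term-11 k (pathPoly m (suc n)) (ℕ.≤-<-trans (ℕ.m≤n+m k (suc n)) k<m)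
          (coeff-pathPoly-11 (suc n) (ℕ.m+n≤o⇒m≤o (suc n) (ℕ.<⇒≤ k<m))) v 2≤v)
        (coeff-pathTail-11 n (suc k) (subst (_< m) (sym (ℕ.+-suc n k)) k<m) v 2≤v))

mult-∉ : ∀ {i xs} → All (_≢ i) xs → mult xs i ≡ 0
mult-∉ []         = refl
mult-∉ {xs = _ ∷ xs} (x≢i ∷ ≢i) = trans (mult-≢ xs x≢i) (mult-∉ ≢i)

suc-≢ : ∀ {i k} → i ≢ k → suc k ≢ suc i
suc-≢ i≢k = i≢k ∘ sym ∘ ℕ.suc-injective

-- Path coefficients needed for the individual cases.

module PathCoefficientValues (m : ℕ) (1≤m : 1 ≤ m) where
  open PathCoefficients m

  pathCoeff-i1 : ∀ a → suc a ≤ m → pathCoeff (suc a ∷ 1 ∷ []) ≡ + a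
  pathCoeff-i1 a a<m = begin
    pathCoeff (suc a ∷ 1 ∷ [])
      ≡⟨ pathCoeff-single a 1 [] a<m ↭-refl (λ i i≢0 i≢a → mult-∉ (suc-≢ i≢a ∷ suc-≢ i≢0 ∷ [])) ⟩
    + a ℤ.* pathCoeff (1 ∷ []) ≡⟨ cong (ℤ._*_ (+ a)) (pathCoeff-[-] 0 1≤m) ⟩
    + a ℤ.* 1ℤ                 ≡⟨ ℤ.*-identityʳ (+ a) ⟩
    + a                        ∎

  pathCoeff-ii : ∀ a → suc a ≤ m → pathCoeff (suc a ∷ suc a ∷ []) ≡ + a ℤ.* + suc a
  pathCoeff-ii a a<m = trans
    (pathCoeff-single a (suc a) [] a<m ↭-refl (λ i _ i≢a → mult-∉ (suc-≢ i≢a ∷ suc-≢ i≢a ∷ [])))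
    (cong (ℤ._*_ (+ a)) (pathCoeff-[-] a a<m))

  pathCoeff-ij : ∀ a b → a ≢ b → suc a ≤ m → suc b ≤ m →
    pathCoeff (suc a ∷ suc b ∷ []) ≡ + a ℤ.* + suc b ℤ.+ + b ℤ.* + suc a
  pathCoeff-ij a b a≢b a<m b<m = trans
    (pathCoeff-double a (suc b) [] b (suc a) [] a≢b a<m b<m ↭-refl (swap _ _ ↭-refl)
      λ i _ i≢a i≢b → mult-∉ (suc-≢ i≢a ∷ suc-≢ i≢b ∷ []))
    (cong₂ (λ x y → + a ℤ.* x ℤ.+ + b ℤ.* y) (pathCoeff-[-] b b<m) (pathCoeff-[-] a a<m))

  pathCoeff-ii1 : ∀ a → suc a ≤ m → pathCoeff (suc a ∷ suc a ∷ 1 ∷ []) ≡ + a ℤ.* + a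
  pathCoeff-ii1 a a<m = trans
    (pathCoeff-single a (suc a) (1 ∷ []) a<m ↭-refl
      λ i i≢0 i≢a → mult-∉ (suc-≢ i≢a ∷ suc-≢ i≢a ∷ suc-≢ i≢0 ∷ []))
    (cong (ℤ._*_ (+ a)) (pathCoeff-i1 a a<m))

  pathCoeff-ij1 : ∀ a b → a ≢ b → suc a ≤ m → suc b ≤ m →
    pathCoeff (suc a ∷ suc b ∷ 1 ∷ []) ≡ + a ℤ.* + b ℤ.+ + b ℤ.* + a
  pathCoeff-ij1 a b a≢b a<m b<m = trans
    (pathCoeff-double a (suc b) (1 ∷ []) b (suc a) (1 ∷ []) a≢b a<m b<m ↭-refl (swap _ _ ↭-refl)
      λ i i≢0 i≢a i≢b → mult-∉ (suc-≢ i≢a ∷ suc-≢ i≢b ∷ suc-≢ i≢0 ∷ []))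
    (cong₂ (λ x y → + a ℤ.* x ℤ.+ + b ℤ.* y) (pathCoeff-i1 b b<m) (pathCoeff-i1 a a<m))

  -- Treats both families of (e) at once, with `ones` empty or a single 1. Below, gₖ and hₖ denote
  -- the path coefficients of `3 ∷ twos k` and `3 ∷ 3 ∷ twos k`.
  module Twos (3≤m : 3 ≤ m) (ones : List ℕ) (all1 : All (_≡ 1) ones)
    (u : ℤ) (u≡ : pathCoeff (2 ∷ ones) ≡ u) (pathCoeff-33 : pathCoeff (3 ∷ 3 ∷ ones) ≡ + 2 ℤ.* pathCoeff (3 ∷ ones))
    where

    twos : ℕ → List ℕ
    twos k = replicate k 2 ++ ones

    twos-≢ : ∀ k {i} → i ≢ 0 → i ≢ 1 → All (_≢ suc i) (twos k)
    twos-≢ k i≢0 i≢1 = All.++⁺ (All.replicate⁺ k (suc-≢ i≢1)) (All.map (λ { refl → suc-≢ i≢0 }) all1)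

    2≤m : 2 ≤ m
    2≤m = ℕ.≤-trans (s≤s (s≤s z≤n)) 3≤m

    pathCoeff-2 : ∀ k → pathCoeff (2 ∷ twos k) ≡ u
    pathCoeff-2 zero    = u≡
    pathCoeff-2 (suc k) = trans
      (pathCoeff-single 1 2 (twos k) 2≤m ↭-refl λ i i≢0 i≢1 → mult-∉ (twos-≢ (suc (suc k)) i≢0 i≢1))
      (trans (ℤ.*-identityˡ _) (pathCoeff-2 k))

    pathCoeff-32 : ∀ k → pathCoeff (3 ∷ twos (suc k)) ≡ + 2 ℤ.* u ℤ.+ pathCoeff (3 ∷ twos k)
    pathCoeff-32 k = trans
      (pathCoeff-double 2 2 (twos k) 1 3 (twos k) (λ ()) 3≤m 2≤m ↭-refl (swap 3 2 ↭-refl)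
        λ i i≢0 i≢2 i≢1 → mult-∉ (suc-≢ i≢2 ∷ twos-≢ (suc k) i≢0 i≢1))
      (cong₂ ℤ._+_ (cong (ℤ._*_ (+ 2)) (pathCoeff-2 k)) (ℤ.*-identityˡ _))

    pathCoeff-332 : ∀ k →
      pathCoeff (3 ∷ 3 ∷ twos (suc k)) ≡ + 2 ℤ.* pathCoeff (3 ∷ twos (suc k)) ℤ.+ pathCoeff (3 ∷ 3 ∷ twos k)
    pathCoeff-332 k = trans
      (pathCoeff-double 2 3 (twos (suc k)) 1 3 (3 ∷ twos k) (λ ()) 3≤m 2≤m ↭-refl (Perm.shift 2 (3 ∷ 3 ∷ []) (twos k))
        λ i i≢0 i≢2 i≢1 → mult-∉ (suc-≢ i≢2 ∷ suc-≢ i≢2 ∷ twos-≢ (suc k) i≢0 i≢1))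
      (cong (ℤ._+_ (+ 2 ℤ.* pathCoeff (3 ∷ twos (suc k)))) (ℤ.*-identityˡ _))

    -- The hypothesis h₀ = 2 g₀ is the recursion hₖ = 2 gₖ + hₖ₋₁ continued by h₋₁ = 0, so this is
    -- the second difference at the boundary.
    difference : pathCoeff (3 ∷ 3 ∷ twos 1) ℤ.+ (ℤ.- + 2) ℤ.* pathCoeff (3 ∷ 3 ∷ twos 0) ≡ + 4 ℤ.* u
    difference = begin
      pathCoeff (3 ∷ 3 ∷ twos 1) ℤ.+ (ℤ.- + 2) ℤ.* pathCoeff (3 ∷ 3 ∷ twos 0)
        ≡⟨ cong (λ x → x ℤ.+ (ℤ.- + 2) ℤ.* pathCoeff (3 ∷ 3 ∷ twos 0)) (pathCoeff-332 0) ⟩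
      (+ 2 ℤ.* pathCoeff (3 ∷ twos 1) ℤ.+ pathCoeff (3 ∷ 3 ∷ ones)) ℤ.+ (ℤ.- + 2) ℤ.* pathCoeff (3 ∷ 3 ∷ ones)
        ≡⟨ cong₂ (λ x y → (+ 2 ℤ.* x ℤ.+ y) ℤ.+ (ℤ.- + 2) ℤ.* y) (pathCoeff-32 0) pathCoeff-33 ⟩
      (+ 2 ℤ.* (+ 2 ℤ.* u ℤ.+ v) ℤ.+ + 2 ℤ.* v) ℤ.+ (ℤ.- + 2) ℤ.* (+ 2 ℤ.* v)
        ≡⟨ lemma u v ⟩
      + 4 ℤ.* u ∎
      where
      v : ℤ
      v = pathCoeff (3 ∷ ones)
      lemma : ∀ u v → (+ 2 ℤ.* (+ 2 ℤ.* u ℤ.+ v) ℤ.+ + 2 ℤ.* v) ℤ.+ (ℤ.- + 2) ℤ.* (+ 2 ℤ.* v) ≡ + 4 ℤ.* u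
      lemma = ℤ.solve-∀

    -- From hₖ₊₁ = 2 gₖ₊₁ + hₖ and gₖ₊₁ = 2 u + gₖ the second difference of h is 2 (gₖ₊₂ - gₖ₊₁) = 4
    -- u.
    secondDifference : ∀ k →
      pathCoeff (3 ∷ 3 ∷ twos (2 ℕ.+ k)) ℤ.+ (ℤ.- + 2) ℤ.* pathCoeff (3 ∷ 3 ∷ twos (1 ℕ.+ k)) ℤ.+ pathCoeff (3 ∷ 3 ∷ twos k)
        ≡ + 4 ℤ.* u
    secondDifference k = begin
      h₂ ℤ.+ (ℤ.- + 2) ℤ.* h₁ ℤ.+ h₀
        ≡⟨ cong₂ (λ x y → x ℤ.+ (ℤ.- + 2) ℤ.* y ℤ.+ h₀)
             (trans (pathCoeff-332 (suc k)) (cong₂ (λ x y → + 2 ℤ.* x ℤ.+ y) (pathCoeff-32 (suc k)) (pathCoeff-332 k)))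
             (pathCoeff-332 k) ⟩
      (+ 2 ℤ.* (+ 2 ℤ.* u ℤ.+ g₁) ℤ.+ (+ 2 ℤ.* g₁ ℤ.+ h₀)) ℤ.+ (ℤ.- + 2) ℤ.* (+ 2 ℤ.* g₁ ℤ.+ h₀) ℤ.+ h₀
        ≡⟨ lemma u g₁ h₀ ⟩
      + 4 ℤ.* u ∎
      where
      g₁ h₀ h₁ h₂ : ℤ
      g₁ = pathCoeff (3 ∷ twos (1 ℕ.+ k))
      h₀ = pathCoeff (3 ∷ 3 ∷ twos k)
      h₁ = pathCoeff (3 ∷ 3 ∷ twos (1 ℕ.+ k))
      h₂ = pathCoeff (3 ∷ 3 ∷ twos (2 ℕ.+ k))
      lemma : ∀ u g h →
        (+ 2 ℤ.* (+ 2 ℤ.* u ℤ.+ g) ℤ.+ (+ 2 ℤ.* g ℤ.+ h)) ℤ.+ (ℤ.- + 2) ℤ.* (+ 2 ℤ.* g ℤ.+ h) ℤ.+ h ≡ + 4 ℤ.* u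
      lemma = ℤ.solve-∀

-- The coefficients c, case by case in the number of parts 2.

coeff-twinnedPoly : ∀ m n v → coeff m (twinnedPoly m n) v
  ≡ (+ 4 ℤ.* coeff m (pathPoly m (5 ℕ.+ n)) v ℤ.+ (ℤ.- + 8) ℤ.* coeff m (mulE m 2 (pathPoly m (3 ℕ.+ n))) v)
    ℤ.+ + 4 ℤ.* coeff m (mulE m 2 (mulE m 2 (pathPoly m (1 ℕ.+ n)))) v
coeff-twinnedPoly m n v = trans
  (coeff-⊞ m (+ 4 ⊡ P₅ ⊞ (ℤ.- + 8) ⊡ mulE m 2 P₃) (+ 4 ⊡ mulE m 2 (mulE m 2 P₁)) v)
  (cong₂ ℤ._+_
    (trans (coeff-⊞ m (+ 4 ⊡ P₅) ((ℤ.- + 8) ⊡ mulE m 2 P₃) v)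
      (cong₂ ℤ._+_ (coeff-⊡ m (+ 4) P₅ v) (coeff-⊡ m (ℤ.- + 8) (mulE m 2 P₃) v)))
    (coeff-⊡ m (+ 4) (mulE m 2 (mulE m 2 P₁)) v))
  where
  P₁ P₃ P₅ : Poly m
  P₁ = pathPoly m (1 ℕ.+ n)
  P₃ = pathPoly m (3 ℕ.+ n)
  P₅ = pathPoly m (5 ℕ.+ n)

module Coefficients (c : Partition → ℤ) (c-𝒳 : IsECoefficientOf c 𝒳) where

  c-11 : ∀ μ → 2 ≤ mult (parts μ) 1 → c μ ≡ 0ℤ
  c-11 μ 2≤ with sum (parts μ) ℕ.<? 5
  ... | yes ∑<5 = coefficient-small c c-𝒳 μ ∑<5
  ... | no  ∑≮5 with n , ∑≡ ← ℕ.m≤n⇒∃[o]m+o≡n (ℕ.≮⇒≥ ∑≮5) = begin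
    c μ
      ≡⟨ coefficient-large c c-𝒳 n μ ↭-refl (sym ∑≡) ⟩
    coeff m (twinnedPoly m n) v
      ≡⟨ coeff-twinnedPoly m n v ⟩
    _
      ≡⟨ cong₂ (λ x y → x ℤ.+ + 4 ℤ.* y)
           (cong₂ (λ x y → + 4 ℤ.* x ℤ.+ (ℤ.- + 8) ℤ.* y)
             (coeff-pathPoly-11 (s≤s z≤n) m ℕ.≤-refl v 2≤)
             (coeff-mulE-11 2 (pathPoly m (3 ℕ.+ n)) ℕ.≤-refl 2≤m (coeff-pathPoly-11 (s≤s z≤n) (3 ℕ.+ n) (ℕ.m≤n+m (3 ℕ.+ n) 2)) v 2≤))
           (coeff-mulE-11 2 (mulE m 2 (pathPoly m (1 ℕ.+ n))) ℕ.≤-refl 2≤m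
             (coeff-mulE-11 2 (pathPoly m (1 ℕ.+ n)) ℕ.≤-refl 2≤m (coeff-pathPoly-11 (s≤s z≤n) (1 ℕ.+ n) (ℕ.m≤n+m (1 ℕ.+ n) 4))) v 2≤) ⟩
    0ℤ ∎
    where
    m : ℕ
    m = 5 ℕ.+ n
    v : ℕ → ℕ
    v = mult (parts μ)
    2≤m : 2 ≤ m
    2≤m = s≤s (s≤s z≤n)
    open PathCoefficients m

  module _ (n : ℕ) where
    open PathCoefficients (5 ℕ.+ n)

    private
      m : ℕ
      m = 5 ℕ.+ n
      2≤m : 2 ≤ m
      2≤m = s≤s (s≤s z≤n)

    c-no2ₙ : ∀ {xs} → sum xs ≡ m → mult xs 2 ≡ 0 → c at xs equals (+ 4 ℤ.* pathCoeff xs)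
    c-no2ₙ {xs} ∑≡ no2 μ μ↭ = begin
      c μ
        ≡⟨ trans (coefficient-large c c-𝒳 n μ μ↭ ∑≡) (coeff-twinnedPoly m n (mult xs)) ⟩
      _
        ≡⟨ cong₂ (λ x y → x ℤ.+ + 4 ℤ.* y)
             (cong₂ (λ x y → + 4 ℤ.* x ℤ.+ (ℤ.- + 8) ℤ.* y)
               (cong (λ k → coeff m (pathPoly m k) (mult xs)) (sym ∑≡))
               (coeff-mulE-0 m 2 (pathPoly m (3 ℕ.+ n)) (mult xs) no2))
             (coeff-mulE-0 m 2 (mulE m 2 (pathPoly m (1 ℕ.+ n))) (mult xs) no2) ⟩
      (+ 4 ℤ.* pathCoeff xs ℤ.+ (ℤ.- + 8) ℤ.* 0ℤ) ℤ.+ + 4 ℤ.* 0ℤ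
        ≡⟨ lemma (pathCoeff xs) ⟩
      + 4 ℤ.* pathCoeff xs ∎
      where
      lemma : ∀ x → (+ 4 ℤ.* x ℤ.+ (ℤ.- + 8) ℤ.* 0ℤ) ℤ.+ + 4 ℤ.* 0ℤ ≡ + 4 ℤ.* x
      lemma = ℤ.solve-∀

    c-one2ₙ : ∀ {xs} ys → sum xs ≡ m → xs ↭ 2 ∷ ys → mult ys 2 ≡ 0 →
      c at xs equals (+ 4 ℤ.* pathCoeff xs ℤ.+ (ℤ.- + 8) ℤ.* pathCoeff ys)
    c-one2ₙ {xs} ys ∑≡ xs↭ no2 μ μ↭ = begin
      c μ
        ≡⟨ trans (coefficient-large c c-𝒳 n μ μ↭ ∑≡) (coeff-twinnedPoly m n (mult xs)) ⟩
      _
        ≡⟨ cong₂ (λ x y → x ℤ.+ + 4 ℤ.* y)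
             (cong₂ (λ x y → + 4 ℤ.* x ℤ.+ (ℤ.- + 8) ℤ.* y)
               (cong (λ k → coeff m (pathPoly m k) (mult xs)) (sym ∑≡))
               (trans (coeff-mulE-↭ m 2 (pathPoly m (3 ℕ.+ n)) (s≤s z≤n) 2≤m xs↭)
                 (cong (λ k → coeff m (pathPoly m k) (mult ys)) (sym ∑ys))))
             (trans (coeff-mulE-↭ m 2 (mulE m 2 (pathPoly m (1 ℕ.+ n))) (s≤s z≤n) 2≤m xs↭)
               (coeff-mulE-0 m 2 (pathPoly m (1 ℕ.+ n)) (mult ys) no2)) ⟩
      (+ 4 ℤ.* pathCoeff xs ℤ.+ (ℤ.- + 8) ℤ.* pathCoeff ys) ℤ.+ + 4 ℤ.* 0ℤ
        ≡⟨ ℤ.+-identityʳ _ ⟩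
      + 4 ℤ.* pathCoeff xs ℤ.+ (ℤ.- + 8) ℤ.* pathCoeff ys ∎
      where
      ∑ys : sum ys ≡ 3 ℕ.+ n
      ∑ys = ℕ.+-cancelˡ-≡ 2 _ _ (trans (sym (sum-↭ xs↭)) ∑≡)

    c-two2ₙ : ∀ {xs} ys → sum xs ≡ m → xs ↭ 2 ∷ 2 ∷ ys →
      c at xs equals (+ 4 ℤ.* pathCoeff xs ℤ.+ (ℤ.- + 8) ℤ.* pathCoeff (2 ∷ ys) ℤ.+ + 4 ℤ.* pathCoeff ys)
    c-two2ₙ {xs} ys ∑≡ xs↭ μ μ↭ = begin
      c μ
        ≡⟨ trans (coefficient-large c c-𝒳 n μ μ↭ ∑≡) (coeff-twinnedPoly m n (mult xs)) ⟩
      _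
        ≡⟨ cong₂ (λ x y → x ℤ.+ + 4 ℤ.* y)
             (cong₂ (λ x y → + 4 ℤ.* x ℤ.+ (ℤ.- + 8) ℤ.* y)
               (cong (λ k → coeff m (pathPoly m k) (mult xs)) (sym ∑≡))
               (trans (coeff-mulE-↭ m 2 (pathPoly m (3 ℕ.+ n)) (s≤s z≤n) 2≤m xs↭)
                 (cong (λ k → coeff m (pathPoly m k) (mult (2 ∷ ys))) (sym ∑2ys))))
             (trans (coeff-mulE-↭ m 2 (mulE m 2 (pathPoly m (1 ℕ.+ n))) (s≤s z≤n) 2≤m xs↭)
               (trans (coeff-mulE-↭ m 2 (pathPoly m (1 ℕ.+ n)) {2 ∷ ys} {ys} (s≤s z≤n) 2≤m ↭-refl)
                 (cong (λ k → coeff m (pathPoly m k) (mult ys)) (sym ∑ys)))) ⟩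
      + 4 ℤ.* pathCoeff xs ℤ.+ (ℤ.- + 8) ℤ.* pathCoeff (2 ∷ ys) ℤ.+ + 4 ℤ.* pathCoeff ys ∎
      where
      ∑2ys : sum (2 ∷ ys) ≡ 3 ℕ.+ n
      ∑2ys = ℕ.+-cancelˡ-≡ 2 _ _ (trans (sym (sum-↭ xs↭)) ∑≡)
      ∑ys : sum ys ≡ 1 ℕ.+ n
      ∑ys = ℕ.+-cancelˡ-≡ 2 _ _ ∑2ys

  open PathCoefficients using (pathCoeff; pathCoeff-↭; pathCoeff-[-])
  open PathCoefficientValues

  -- Replaces the index 5 + n by `sum xs`, so that the bounds on the parts become plain inequalities
  -- between a part and the total.
  c-no2 : ∀ {xs} → 5 ≤ sum xs → All (_≢ 2) xs → c at xs equals (+ 4 ℤ.* pathCoeff (sum xs) xs)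
  c-no2 {xs} 5≤ no2 with n , eq ← ℕ.m≤n⇒∃[o]m+o≡n 5≤ =
    subst (λ m → c at xs equals (+ 4 ℤ.* pathCoeff m xs)) eq (c-no2ₙ n (sym eq) (mult-∉ {2} {xs} no2))

  c-one2 : ∀ {xs} ys → 5 ≤ sum xs → xs ↭ 2 ∷ ys → All (_≢ 2) ys →
    c at xs equals (+ 4 ℤ.* pathCoeff (sum xs) xs ℤ.+ (ℤ.- + 8) ℤ.* pathCoeff (sum xs) ys)
  c-one2 {xs} ys 5≤ xs↭ no2 with n , eq ← ℕ.m≤n⇒∃[o]m+o≡n 5≤ =
    subst (λ m → c at xs equals (+ 4 ℤ.* pathCoeff m xs ℤ.+ (ℤ.- + 8) ℤ.* pathCoeff m ys)) eq (c-one2ₙ n ys (sym eq) xs↭ (mult-∉ {2} {ys} no2))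

  c-two2 : ∀ {xs} ys → 5 ≤ sum xs → xs ↭ 2 ∷ 2 ∷ ys → let m = sum xs in
    c at xs equals (+ 4 ℤ.* pathCoeff m xs ℤ.+ (ℤ.- + 8) ℤ.* pathCoeff m (2 ∷ ys) ℤ.+ + 4 ℤ.* pathCoeff m ys)
  c-two2 {xs} ys 5≤ xs↭ with n , eq ← ℕ.m≤n⇒∃[o]m+o≡n 5≤ =
    subst (λ m → c at xs equals (+ 4 ℤ.* pathCoeff m xs ℤ.+ (ℤ.- + 8) ℤ.* pathCoeff m (2 ∷ ys) ℤ.+ + 4 ℤ.* pathCoeff m ys))
      eq (c-two2ₙ n ys (sym eq) xs↭)

  c-k+2 : ∀ k → 3 ≤ k → c at (k ℕ.+ 2 ∷ []) equals (+ 4 ℤ.* (+ k ℤ.+ + 2))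
  c-k+2 k 3≤k = subst (λ z → c at (z ∷ []) equals (+ 4 ℤ.* + z)) (ℕ.+-comm 2 k) λ μ μ↭ → trans
    (c-no2 {suc (suc k) ∷ []} (s≤s (s≤s (ℕ.≤-trans 3≤k (ℕ.m≤m+n k 0))))
      ((λ { refl → contradiction 3≤k λ () }) ∷ []) μ μ↭)
    (cong (ℤ._*_ (+ 4)) (pathCoeff-[-] _ (suc k) (ℕ.m≤m+n (2 ℕ.+ k) 0)))

  c-k2 : ∀ k → 3 ≤ k → c at (k ∷ 2 ∷ []) equals (+ 4 ℤ.* (+ k ℤ.- + 2))
  c-k2 1 (s≤s ())
  c-k2 2 (s≤s (s≤s ()))
  c-k2 (suc (suc (suc k))) _ μ μ↭ = trans
    (c-one2 {xs} (suc (suc (suc k)) ∷ []) (s≤s (s≤s (s≤s (ℕ.m≤n+m 2 k)))) (swap _ _ ↭-refl) ((λ ()) ∷ []) μ μ↭)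
    -- For the part j = k + 3, the path coefficients of (j, 2) and (j) are 3 j - 2 and j, whence 4
    -- (3 j - 2) - 8 j = 4 (j - 2).
    (trans (cong₂ (λ x y → + 4 ℤ.* x ℤ.+ (ℤ.- + 8) ℤ.* y)
        (pathCoeff-ij m (s≤s z≤n) (suc (suc k)) 1 (λ ()) k<m (s≤s (s≤s z≤n)))
        (pathCoeff-[-] m (suc (suc k)) k<m))
      (lemma (+ k)))
    where
    xs : List ℕ
    xs = suc (suc (suc k)) ∷ 2 ∷ []
    m : ℕ
    m = sum xs
    k<m : suc (suc (suc k)) ≤ m
    k<m = ℕ.m≤m+n _ 2
    lemma : ∀ x → + 4 ℤ.* ((+ 2 ℤ.+ x) ℤ.* + 2 ℤ.+ + 1 ℤ.* (+ 3 ℤ.+ x)) ℤ.+ (ℤ.- + 8) ℤ.* (+ 3 ℤ.+ x)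
      ≡ + 4 ℤ.* (+ 1 ℤ.+ x)
    lemma = ℤ.solve-∀

  c-k+1,1 : ∀ k → 3 ≤ k → c at (k ℕ.+ 1 ∷ 1 ∷ []) equals (+ 4 ℤ.* + k)
  c-k+1,1 k 3≤k = subst (λ z → c at (z ∷ 1 ∷ []) equals (+ 4 ℤ.* + k)) (ℕ.+-comm 1 k) λ μ μ↭ → trans
    (c-no2 {suc k ∷ 1 ∷ []} (s≤s (ℕ.+-mono-≤ 3≤k ℕ.≤-refl))
      ((λ { refl → contradiction 3≤k λ { (s≤s ()) } }) ∷ (λ ()) ∷ []) μ μ↭)
    (cong (ℤ._*_ (+ 4)) (pathCoeff-i1 _ (s≤s z≤n) k (ℕ.m≤m+n (suc k) 1)))

  c-ii : ∀ i → 3 ≤ i → c at (i ∷ i ∷ []) equals (+ 4 ℤ.* (+ i ℤ.- + 1) ℤ.* + i)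
  c-ii i@(suc a) 3≤i μ μ↭ = trans
    (c-no2 {i ∷ i ∷ []} (ℕ.≤-trans (s≤s (s≤s (s≤s (s≤s (s≤s z≤n))))) (ℕ.+-mono-≤ 3≤i (ℕ.≤-trans 3≤i (ℕ.m≤m+n i 0))))
      (ℕ.>⇒≢ 3≤i ∷ ℕ.>⇒≢ 3≤i ∷ []) μ μ↭)
    (trans (cong (ℤ._*_ (+ 4)) (pathCoeff-ii _ (s≤s z≤n) a (ℕ.m≤m+n i _))) (sym (ℤ.*-assoc (+ 4) (+ a) (+ i))))

  c-ij : ∀ i j → 3 ≤ i → 3 ≤ j → i ≢ j →
    c at (i ∷ j ∷ []) equals (+ 4 ℤ.* (+ j ℤ.- + 1) ℤ.* + i ℤ.+ + 4 ℤ.* (+ i ℤ.- + 1) ℤ.* + j)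
  c-ij i@(suc a) j@(suc b) 3≤i 3≤j i≢j μ μ↭ = trans
    (c-no2 {i ∷ j ∷ []} (ℕ.≤-trans (s≤s (s≤s (s≤s (s≤s (s≤s z≤n))))) (ℕ.+-mono-≤ 3≤i (ℕ.≤-trans 3≤j (ℕ.m≤m+n j 0))))
      (ℕ.>⇒≢ 3≤i ∷ ℕ.>⇒≢ 3≤j ∷ []) μ μ↭)
    (trans (cong (ℤ._*_ (+ 4)) (pathCoeff-ij _ (s≤s z≤n) a b (i≢j ∘ cong suc) (ℕ.m≤m+n i _) (ℕ.≤-trans (ℕ.m≤m+n j 0) (ℕ.m≤n+m _ i))))
      (lemma (+ a) (+ i) (+ b) (+ j)))
    where
    lemma : ∀ a i b j → + 4 ℤ.* (a ℤ.* j ℤ.+ b ℤ.* i) ≡ + 4 ℤ.* b ℤ.* i ℤ.+ + 4 ℤ.* a ℤ.* j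
    lemma = ℤ.solve-∀

  c-ii1 : ∀ i → 3 ≤ i → c at (i ∷ i ∷ 1 ∷ []) equals (+ 4 ℤ.* ((+ i ℤ.- + 1) ℤ.* (+ i ℤ.- + 1)))
  c-ii1 i@(suc a) 3≤i μ μ↭ = trans
    (c-no2 {i ∷ i ∷ 1 ∷ []} (ℕ.≤-trans (s≤s (s≤s (s≤s (s≤s (s≤s z≤n))))) (ℕ.+-mono-≤ 3≤i (ℕ.≤-trans 3≤i (ℕ.m≤m+n i 1))))
      (ℕ.>⇒≢ 3≤i ∷ ℕ.>⇒≢ 3≤i ∷ (λ ()) ∷ []) μ μ↭)
    (cong (ℤ._*_ (+ 4)) (pathCoeff-ii1 _ (s≤s z≤n) a (ℕ.m≤m+n i _)))

  c-ij1 : ∀ i j → 3 ≤ i → 3 ≤ j → i ≢ j →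
    c at (i ∷ j ∷ 1 ∷ []) equals (+ 8 ℤ.* (+ i ℤ.- + 1) ℤ.* (+ j ℤ.- + 1))
  c-ij1 i@(suc a) j@(suc b) 3≤i 3≤j i≢j μ μ↭ = trans
    (c-no2 {i ∷ j ∷ 1 ∷ []} (ℕ.≤-trans (s≤s (s≤s (s≤s (s≤s (s≤s z≤n))))) (ℕ.+-mono-≤ 3≤i (ℕ.≤-trans 3≤j (ℕ.m≤m+n j 1))))
      (ℕ.>⇒≢ 3≤i ∷ ℕ.>⇒≢ 3≤j ∷ (λ ()) ∷ []) μ μ↭)
    (trans (cong (ℤ._*_ (+ 4)) (pathCoeff-ij1 _ (s≤s z≤n) a b (i≢j ∘ cong suc) (ℕ.m≤m+n i _) (ℕ.≤-trans (ℕ.m≤m+n j 1) (ℕ.m≤n+m _ i))))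
      (lemma (+ a) (+ b)))
    where
    lemma : ∀ a b → + 4 ℤ.* (a ℤ.* b ℤ.+ b ℤ.* a) ≡ + 8 ℤ.* a ℤ.* b
    lemma = ℤ.solve-∀

  c-is1∪ : ∀ {xs} → 1 ∈ xs → c at (1 ∷ xs) equals 0ℤ
  c-is1∪ {xs} 1∈xs μ μ↭ = c-11 μ (subst (2 ≤_) (sym (mult-↭ μ↭ 1)) (s≤s (mult-∈ 1∈xs)))
    where
    mult-∈ : ∀ {k xs} → k ∈ xs → 1 ≤ mult xs k
    mult-∈ {k} {x ∷ xs} (here refl) = subst (1 ≤_) (sym (mult-≡ k xs)) (s≤s z≤n)
    mult-∈ {k} {x ∷ xs} (there k∈) with x ℕ.≟ k
    ... | yes refl = subst (1 ≤_) (sym (mult-≡ k xs)) (s≤s z≤n)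
    ... | no x≢k   = subst (1 ≤_) (sym (mult-≢ xs x≢k)) (mult-∈ k∈)

  c-2j1 : ∀ i j → i ≤ 2 → c at (i ∷ j ∷ 1 ∷ []) equals 0ℤ
  c-2j1 0 j _ μ μ↭ with () ∷ _ ← Perm.All-resp-↭ μ↭ (positive μ)
  c-2j1 1 j _ μ μ↭ = c-is1∪ (there (here refl)) μ μ↭
  c-2j1 2 0 _ μ μ↭ with _ ∷ () ∷ _ ← Perm.All-resp-↭ μ↭ (positive μ)
  c-2j1 2 1 _ μ μ↭ = c-is1∪ (there (here refl)) μ (↭-trans μ↭ (swap 2 1 ↭-refl))
  -- A closed term: all three path coefficients are 1, and the value 4 - 8 + 4 computes to 0.
  c-2j1 2 2 _ μ μ↭ = c-two2 (1 ∷ []) ℕ.≤-refl ↭-refl μ μ↭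
  -- The path coefficients of (2, j, 1) and (j, 1) are 2 b and b, and 4 (2 b) - 8 b = 0.
  c-2j1 2 j@(suc b@(suc (suc b′))) _ μ μ↭ = trans
    (c-one2 {2 ∷ j ∷ 1 ∷ []} (j ∷ 1 ∷ []) (s≤s (s≤s (s≤s (s≤s (s≤s z≤n))))) ↭-refl
      ((λ ()) ∷ (λ ()) ∷ []) μ μ↭)
    (trans (cong₂ (λ x y → + 4 ℤ.* x ℤ.+ (ℤ.- + 8) ℤ.* y)
        (pathCoeff-ij1 _ (s≤s z≤n) 1 b (λ ()) (s≤s (s≤s z≤n)) j≤m)
        (pathCoeff-i1 _ (s≤s z≤n) b j≤m))
      (lemma (+ b)))
    where
    j≤m : j ≤ sum (2 ∷ j ∷ 1 ∷ [])
    j≤m = ℕ.≤-trans (ℕ.m≤m+n j 1) (ℕ.m≤n+m _ 2)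
    lemma : ∀ b → + 4 ℤ.* (+ 1 ℤ.* b ℤ.+ b ℤ.* + 1) ℤ.+ (ℤ.- + 8) ℤ.* b ≡ 0ℤ
    lemma = ℤ.solve-∀
  c-2j1 (suc (suc (suc i))) j (s≤s (s≤s ()))

  c-i⊓j≤2 : ∀ i j → i ⊓ j ≤ 2 → c at (i ∷ j ∷ 1 ∷ []) equals 0ℤ
  c-i⊓j≤2 i j i⊓j≤2 μ μ↭ with ℕ.⊓-sel i j
  ... | inj₁ ≡i = c-2j1 i j (subst (_≤ 2) ≡i i⊓j≤2) μ μ↭
  ... | inj₂ ≡j = c-2j1 j i (subst (_≤ 2) ≡j i⊓j≤2) μ (↭-trans μ↭ (swap i j ↭-refl))

  -- The factor 16 is 4 from `twinnedPoly` times 4 from the second difference 4 u. A single part 2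
  -- is separate since the term with e₂² is then absent.
  c-33twos : ∀ ones u → All (_≡ 1) ones →
    (∀ m → 3 ≤ m → pathCoeff m (2 ∷ ones) ≡ u) →
    (∀ m → 3 ≤ m → pathCoeff m (3 ∷ 3 ∷ ones) ≡ + 2 ℤ.* pathCoeff m (3 ∷ ones)) →
    ∀ k → c at (3 ∷ 3 ∷ replicate (suc k) 2 ++ ones) equals (+ 16 ℤ.* u)
  c-33twos ones u all1 u≡ p33 zero μ μ↭ = trans
    (c-one2 {3 ∷ 3 ∷ 2 ∷ ones} (3 ∷ 3 ∷ ones) (s≤s (s≤s (s≤s (s≤s (s≤s z≤n))))) (Perm.shift 2 (3 ∷ 3 ∷ []) ones)
      ((λ ()) ∷ (λ ()) ∷ All.map (λ { refl () }) all1) μ μ↭)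
    (trans (factor (pathCoeff m (3 ∷ 3 ∷ twos 1)) (pathCoeff m (3 ∷ 3 ∷ ones))) (trans (cong (ℤ._*_ (+ 4)) difference) (sym (ℤ.*-assoc (+ 4) (+ 4) u))))
    where
    m : ℕ
    m = sum (3 ∷ 3 ∷ 2 ∷ ones)
    3≤m : 3 ≤ m
    3≤m = s≤s (s≤s (s≤s z≤n))
    open Twos m (s≤s z≤n) 3≤m ones all1 u (u≡ m 3≤m) (p33 m 3≤m)
    factor : ∀ x y → + 4 ℤ.* x ℤ.+ (ℤ.- + 8) ℤ.* y ≡ + 4 ℤ.* (x ℤ.+ (ℤ.- + 2) ℤ.* y)
    factor = ℤ.solve-∀
  c-33twos ones u all1 u≡ p33 (suc k) μ μ↭ = trans
    (c-two2 {3 ∷ 3 ∷ 2 ∷ 2 ∷ twos k} (3 ∷ 3 ∷ twos k) (s≤s (s≤s (s≤s (s≤s (s≤s z≤n)))))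
      (↭-trans (Perm.shift 2 (3 ∷ 3 ∷ []) (2 ∷ twos k)) (prep 2 (Perm.shift 2 (3 ∷ 3 ∷ []) (twos k)))) μ μ↭)
    -- Removing one 2 leaves the other in front of the 3s; it is moved behind them to match
    -- `twos (suc k)`.
    (trans (cong (λ y → + 4 ℤ.* pathCoeff m (3 ∷ 3 ∷ 2 ∷ 2 ∷ twos k) ℤ.+ (ℤ.- + 8) ℤ.* y ℤ.+ + 4 ℤ.* pathCoeff m (3 ∷ 3 ∷ twos k))
        (pathCoeff-↭ m {2 ∷ 3 ∷ 3 ∷ twos k} {3 ∷ 3 ∷ twos (suc k)} (↭-sym (Perm.shift 2 (3 ∷ 3 ∷ []) (twos k)))))
      (trans (factor (pathCoeff m (3 ∷ 3 ∷ twos (2 ℕ.+ k))) (pathCoeff m (3 ∷ 3 ∷ twos (1 ℕ.+ k))) (pathCoeff m (3 ∷ 3 ∷ twos k))) (trans (cong (ℤ._*_ (+ 4)) (secondDifference k)) (sym (ℤ.*-assoc (+ 4) (+ 4) u)))))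
    where
    m : ℕ
    m = sum (3 ∷ 3 ∷ 2 ∷ 2 ∷ replicate k 2 ++ ones)
    3≤m : 3 ≤ m
    3≤m = s≤s (s≤s (s≤s z≤n))
    open Twos m (s≤s z≤n) 3≤m ones all1 u (u≡ m 3≤m) (p33 m 3≤m)
    factor : ∀ x y z → + 4 ℤ.* x ℤ.+ (ℤ.- + 8) ℤ.* y ℤ.+ + 4 ℤ.* z ≡ + 4 ℤ.* (x ℤ.+ (ℤ.- + 2) ℤ.* y ℤ.+ z)
    factor = ℤ.solve-∀

  -- Here u = 2 because P₂ = 2 e₂. With the extra part 1 below, u = 1 is the coefficient of e₂ e₁ in
  -- P₃.
  c-33twos₀ : ∀ k → c at (3 ∷ 3 ∷ replicate (suc k) 2) equals (+ 32)
  c-33twos₀ k = subst (λ xs → c at (3 ∷ 3 ∷ xs) equals (+ 32)) (List.++-identityʳ (replicate (suc k) 2))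
    (c-33twos [] (+ 2) [] (λ m 3≤m → pathCoeff-[-] m 1 (ℕ.<⇒≤ 3≤m))
      (λ m 3≤m → trans (pathCoeff-ii m (ℕ.≤-trans (s≤s z≤n) 3≤m) 2 3≤m) (cong (ℤ._*_ (+ 2)) (sym (pathCoeff-[-] m 2 3≤m)))) k)

  c-33twos₁ : ∀ k → c at (3 ∷ 3 ∷ replicate (suc k) 2 ++ 1 ∷ []) equals (+ 16)
  c-33twos₁ = c-33twos (1 ∷ []) (+ 1) (refl ∷ [])
    (λ m 3≤m → pathCoeff-i1 m (ℕ.≤-trans (s≤s z≤n) 3≤m) 1 (ℕ.<⇒≤ 3≤m))
    (λ m 3≤m → trans (pathCoeff-ii1 m (ℕ.≤-trans (s≤s z≤n) 3≤m) 2 3≤m)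
      (cong (ℤ._*_ (+ 2)) (sym (pathCoeff-i1 m (ℕ.≤-trans (s≤s z≤n) 3≤m) 2 3≤m))))

open import Data.Integer using (_+_; _-_; _*_)

corollary3p15 : (c : Partition → ℤ) → IsECoefficientOf c 𝒳 →
  -- (a)
  (∀ k → 3 ≤ k →
    (c at (k ℕ.+ 2 ∷ []) equals (+ 4 * (+ k + + 2)))
    × (c at (k ∷ 2 ∷ []) equals (+ 4 * (+ k - + 2)))
    × (c at (k ℕ.+ 1 ∷ 1 ∷ []) equals (+ 4 * + k)))
  -- (b)
  × (∀ i → 3 ≤ i → c at (i ∷ i ∷ []) equals (+ 4 * (+ i - + 1) * + i))
  × (∀ i j → 3 ≤ i → 3 ≤ j → i ≢ j →
      c at (i ∷ j ∷ []) equals (+ 4 * (+ j - + 1) * + i + + 4 * (+ i - + 1) * + j))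
  -- (c)
  × (∀ i → 3 ≤ i → c at (i ∷ i ∷ 1 ∷ []) equals (+ 4 * ((+ i - + 1) * (+ i - + 1))))
  × (∀ i j → 3 ≤ i → 3 ≤ j → i ≢ j →
      c at (i ∷ j ∷ 1 ∷ []) equals (+ 8 * (+ i - + 1) * (+ j - + 1)))
  × (∀ i j → i ⊓ j ≤ 2 → c at (i ∷ j ∷ 1 ∷ []) equals (+ 0))
  -- (d)
  × (∀ ρ μ → ρ is1∪ μ → c ρ ≢ + 0 → 1 ∉ parts μ)
  -- (e)
  × (∀ k →
      (c at (3 ∷ 3 ∷ replicate (suc k) 2) equals (+ 32))
      × (c at (3 ∷ 3 ∷ replicate (suc k) 2 ++ 1 ∷ []) equals (+ 16)))
corollary3p15 c c-𝒳 =
  (λ k 3≤k → c-k+2 k 3≤k , c-k2 k 3≤k , c-k+1,1 k 3≤k) ,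
  c-ii , c-ij , c-ii1 , c-ij1 , c-i⊓j≤2 ,
  (λ ρ μ ρ↭ cρ≢0 1∈μ → cρ≢0 (c-is1∪ 1∈μ ρ ρ↭)) ,
  (λ k → c-33twos₀ k , c-33twos₁ k)
  where open Coefficients c c-𝒳
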